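{- For every constant $\epsilon\in(0,1)$ there exists an algorithm for the submodular random order streaming problem that outputs a set whose value is (in expectation) at least $\left(1-\frac{1}{e}-\epsilon-O(\frac{1}{k})\right)\mathrm{OPT}$, while using a memory buffer of size at most $\eta_\epsilon(k)=O(k)$ (with $\eta_\epsilon(k)=O(2^{\mathrm{poly}(1/\epsilon)}k)$). Moreover, the number of evaluations of the objective function per item, amortized over the $n$ items, is $O(1+\frac{k^2}{n})$.
   Context: Submodular random order streaming problem: a fixed but unknown set $\mathcal U$ of $n$ items arrives one at a time in a uniformly random order. $f:2^{\mathcal U}\to\mathbb{R}$ is a monotone submodular function accessible through a value oracle. The algorithm maintains a memory buffer of bounded size (items stored in the buffer may later be discarded and replaced by newly arriving items) and at the end outputs a set $S\subseteq\mathcal U$ with $|S|\le k$; the goal is to maximize $f(S)$. $\mathrm{OPT}=\max_{S\subseteq\mathcal U,|S|\le k}f(S)$. Asymptotic notation is with respect to $k$ and $n$.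
   Formalization: The objective f is additionally assumed nonnegative (f(∅) ≥ 0, with monotonicity); without this the claim fails, for example for the constant function f = −1, where every output has value −1 = OPT, below the claimed multiple of OPT. -}

module Defs where

open import Algebra.Bundles using (CommutativeRing; Semiring)
open import Data.Fin using (Fin)
open import Data.Fin.Subset using (Subset; inside; outside; ⊥; ⁅_⁆; ⋃; _∪_; _∩_; _⊆_; ∣_∣)
open import Data.List as List using (List; []; _∷_; _++_; concatMap; filter; foldr; length)
open import Data.Nat as ℕ using (ℕ; zero; suc; NonZero; _!)
open import Data.Nat.Properties using (_!≢0)
open import Data.Product using (∃; _×_; _,_; proj₁; proj₂)
open import Data.Sum using (inj₁; inj₂)
open import Data.Vec as Vec using (Vec; []; _∷_)
open import Level using (0ℓ)
open import Relation.Binary using (Rel; DecTotalOrder; IsDecTotalOrder)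
open import Relation.Nullary using (¬_; contradiction)
import Data.List.Extrema
import Relation.Binary.Construct.NonStrictToStrict as NonStrictToStrict
import Algebra.Definitions.RawSemiring
import Algebra.Properties.Group
import Algebra.Properties.Ring
import Algebra.Properties.Semiring.Mult

-- The real numbers, presented by their axioms: a Dedekind-complete ordered
-- field, unique up to isomorphism.  As in classical mathematics the order is
-- total and decidable.  `archimedean` follows classically from `complete`; it
-- is listed so that the natural number is available as a witness.
record Reals : Set₁ where
  infix  4 _≤_
  infixl 9 _⁻¹
  field
    commutativeRing : CommutativeRing 0ℓ 0ℓ

  open CommutativeRing commutativeRing public

  open Algebra.Definitions.RawSemiring (Semiring.rawSemiring semiring) public
    using (_^_) renaming (_×_ to _·_)

  fromℕ : ℕ → Carrier
  fromℕ n = n · 1#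

  field
    _≤_             : Rel Carrier 0ℓ
    isDecTotalOrder : IsDecTotalOrder _≈_ _≤_
    +-monoʳ-≤       : ∀ x {y z} → y ≤ z → x + y ≤ x + z
    *-nonneg        : ∀ {x y} → 0# ≤ x → 0# ≤ y → 0# ≤ x * y
    0#≉1#           : ¬ 0# ≈ 1#
    -- total; the value of 0# ⁻¹ is unspecified
    _⁻¹             : Carrier → Carrier
    ⁻¹-inverseʳ     : ∀ {x} → ¬ x ≈ 0# → x * x ⁻¹ ≈ 1#

  IsUpperBound : (Carrier → Set) → Carrier → Set
  IsUpperBound P b = ∀ x → P x → x ≤ b

  IsSupremum : (Carrier → Set) → Carrier → Set
  IsSupremum P s = IsUpperBound P s × (∀ b → IsUpperBound P b → s ≤ b)

  field
    archimedean : ∀ x → ∃ λ n → x ≤ fromℕ n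
    complete    : (P : Carrier → Set) → ∃ P → ∃ (IsUpperBound P) → ∃ (IsSupremum P)

  decTotalOrder : DecTotalOrder 0ℓ 0ℓ 0ℓ
  decTotalOrder = record { isDecTotalOrder = isDecTotalOrder }

  open NonStrictToStrict _≈_ _≤_ public using (_<_)

module Euler (ℛ : Reals) where
  open Reals ℛ
  open DecTotalOrder decTotalOrder
    using (total; antisym; ≤-respˡ-≈; ≤-respʳ-≈)
    renaming (refl to ≤-refl; trans to ≤-trans)
  open Algebra.Properties.Ring ring using (-‿distribˡ-*; -‿distribʳ-*)
  open Algebra.Properties.Group +-group using (⁻¹-involutive)
  open Algebra.Properties.Semiring.Mult semiring using (×1-homo-*)

  expSum : ℕ → Carrier
  expSum zero    = 0#
  expSum (suc n) = expSum n + fromℕ (n !) ⁻¹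

  IsExpSum : Carrier → Set
  IsExpSum x = ∃ λ n → x ≈ expSum n

  private
    neg-nonneg : ∀ {x} → x ≤ 0# → 0# ≤ - x
    neg-nonneg {x} x≤0 =
      ≤-respˡ-≈ (-‿inverseˡ x) (≤-respʳ-≈ (+-identityʳ (- x)) (+-monoʳ-≤ (- x) x≤0))

    0≤1 : 0# ≤ 1#
    0≤1 with total 0# 1#
    ... | inj₁ p = p
    ... | inj₂ p = ≤-respʳ-≈ eq (*-nonneg (neg-nonneg p) (neg-nonneg p))
      where
      eq : - 1# * - 1# ≈ 1#
      eq = trans (sym (-‿distribˡ-* 1# (- 1#)))
             (trans (-‿cong (*-identityˡ (- 1#))) (⁻¹-involutive 1#))

    ≤-+ʳ : ∀ x {y} → 0# ≤ y → x ≤ x + y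
    ≤-+ʳ x 0≤y = ≤-respˡ-≈ (+-identityʳ x) (+-monoʳ-≤ x 0≤y)

    +-nonneg : ∀ {x y} → 0# ≤ x → 0# ≤ y → 0# ≤ x + y
    +-nonneg 0≤x 0≤y = ≤-trans 0≤x (≤-+ʳ _ 0≤y)

    fromℕ-nonneg : ∀ n → 0# ≤ fromℕ n
    fromℕ-nonneg zero    = ≤-refl
    fromℕ-nonneg (suc n) = +-nonneg 0≤1 (fromℕ-nonneg n)

    fromℕ≉0 : ∀ n → .{{NonZero n}} → ¬ fromℕ n ≈ 0#
    fromℕ≉0 (suc n) eq =
      0#≉1# (antisym 0≤1 (≤-respʳ-≈ eq (≤-+ʳ 1# (fromℕ-nonneg n))))

    ⁻¹-nonneg : ∀ {x} → 0# ≤ x → ¬ x ≈ 0# → 0# ≤ x ⁻¹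
    ⁻¹-nonneg {x} 0≤x x≉0 with total 0# (x ⁻¹)
    ... | inj₁ p = p
    ... | inj₂ p = contradiction (antisym 0≤1 1≤0) 0#≉1#
      where
      0≤-1 : 0# ≤ - 1#
      0≤-1 = ≤-respʳ-≈
        (trans (sym (-‿distribʳ-* x (x ⁻¹))) (-‿cong (⁻¹-inverseʳ x≉0)))
        (*-nonneg 0≤x (neg-nonneg p))
      1≤0 : 1# ≤ 0#
      1≤0 = ≤-respʳ-≈ (-‿inverseʳ 1#) (≤-+ʳ 1# 0≤-1)

    term : ℕ → Carrier
    term n = fromℕ (n !) ⁻¹

    term-nonneg : ∀ n → 0# ≤ term n
    term-nonneg n = ⁻¹-nonneg (fromℕ-nonneg (n !)) (fromℕ≉0 (n !) {{n !≢0}})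

    term-suc : ∀ n → term (suc n) * fromℕ (suc n) ≈ term n
    term-suc n =
      trans (sym (*-identityʳ _))
      (trans (*-congˡ (sym (⁻¹-inverseʳ (fromℕ≉0 (n !) {{n !≢0}}))))
      (trans (sym (*-assoc _ _ _))
      (trans (*-congʳ
        (trans (*-assoc _ _ _)
        (trans (*-congˡ (sym (×1-homo-* (suc n) (n !))))
        (trans (*-comm _ _)
               (⁻¹-inverseʳ (fromℕ≉0 (suc n !) {{suc n !≢0}}))))))
      (*-identityˡ _))))

    term-halves : ∀ n → term (2 ℕ.+ n) + term (2 ℕ.+ n) ≤ term (1 ℕ.+ n)
    term-halves n =
      ≤-respʳ-≈ (trans (sym eq) (term-suc (1 ℕ.+ n)))
        (≤-+ʳ _ (*-nonneg (term-nonneg (2 ℕ.+ n)) (fromℕ-nonneg n)))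
      where
      t = term (2 ℕ.+ n)
      eq : t * fromℕ (2 ℕ.+ n) ≈ (t + t) + t * fromℕ n
      eq = trans (distribˡ t 1# _)
        (trans (+-cong (*-identityʳ t) (trans (distribˡ t 1# _) (+-congʳ (*-identityʳ t))))
               (sym (+-assoc t t _)))

    bound : Carrier
    bound = expSum 2 + term 1

    expSum+term≤ : ∀ n → expSum (2 ℕ.+ n) + term (1 ℕ.+ n) ≤ bound
    expSum+term≤ zero    = ≤-refl
    expSum+term≤ (suc n) = ≤-trans
      (≤-respˡ-≈ (sym (+-assoc _ _ _)) (+-monoʳ-≤ (expSum (2 ℕ.+ n)) (term-halves n)))
      (expSum+term≤ n)

    expSum≤ : ∀ n → expSum n ≤ bound
    expSum≤ n = ≤-trans (≤-+ʳ _ (term-nonneg n))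
      (≤-trans (≤-+ʳ _ (term-nonneg (suc n)))
      (≤-trans (≤-+ʳ _ (term-nonneg (suc n))) (expSum+term≤ n)))

  e-supremum : ∃ (IsSupremum IsExpSum)
  e-supremum = complete IsExpSum (0# , 0 , refl)
    (bound , λ { x (n , x≈) → ≤-respˡ-≈ (sym x≈) (expSum≤ n) })

  -- e = Σᵢ 1 / i!
  e : Carrier
  e = proj₁ e-supremum

private
  variable
    A       : Set
    m n t η k : ℕ

subsets : ∀ n → List (Subset n)
subsets zero    = [] ∷ []
subsets (suc n) = List.map (outside ∷_) (subsets n) ++ List.map (inside ∷_) (subsets n)

insertions : A → Vec A n → List (Vec A (suc n))
insertions x []       = (x ∷ []) ∷ []
insertions x (y ∷ ys) = (x ∷ y ∷ ys) ∷ List.map (y ∷_) (insertions x ys)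

permutations : Vec A n → List (Vec A n)
permutations []       = [] ∷ []
permutations (x ∷ xs) = concatMap (insertions x) (permutations xs)

-- All n! arrival orders of the ground set Fin n, each exactly once.
orders : ∀ n → List (Vec (Fin n) n)
orders n = permutations (Vec.allFin n)

select : (p : Subset m) → Vec A m → Vec A ∣ p ∣
select []            []       = []
select (inside  ∷ p) (x ∷ xs) = x ∷ select p xs
select (outside ∷ p) (x ∷ xs) = select p xs

-- The set of items stored in the buffer slots p.
items : Subset m → Vec (Fin n) m → Subset n
items p b = ⋃ (List.map ⁅_⁆ (Vec.toList (select p b)))

module Streaming (ℛ : Reals) where
  open Reals ℛ public
  open Euler ℛ using (e) public
  open Data.List.Extrema (DecTotalOrder.totalOrder decTotalOrder) using (max)

  -- Nonnegativity (here in the form 0 ≤ f ∅, given monotonicity) is implicit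
  -- in any multiplicative approximation guarantee.
  record MonotoneSubmodular (f : Subset n → Carrier) : Set where
    field
      nonneg     : 0# ≤ f ⊥
      monotone   : ∀ {S T} → S ⊆ T → f S ≤ f T
      submodular : ∀ S T → f (S ∪ T) + f (S ∩ T) ≤ f S + f T

  OPT : ℕ → (Subset n → Carrier) → Carrier
  OPT {n} k f = max (f ⊥) (List.map f (filter (λ S → ∣ S ∣ ℕ.≤? k) (subsets n)))

  -- A deterministic streaming algorithm, as a decision tree: `Strategy η k t m`
  -- is what the algorithm does when t items are still to arrive and m items
  -- are stored.  It sees items only as anonymous buffer slots, so it can query
  -- the value oracle only on sets of items currently in memory and can neither
  -- recognise nor refer to any other item.  At most η items, including
  -- the one just arrived, are ever stored.  Information other than items (past
  -- oracle answers, say) is not charged to the buffer.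
  data Strategy (η k : ℕ) : (t m : ℕ) → Set where
    query   : Subset m → (Carrier → Strategy η k t m) → Strategy η k t m
    keep    : (p : Subset m) → Strategy η k t ∣ p ∣ → Strategy η k t m
    receive : m ℕ.< η → Strategy η k t (suc m) → Strategy η k (suc t) m
    output  : (p : Subset m) → ∣ p ∣ ℕ.≤ k → Strategy η k 0 m

  -- The output set and the number of oracle queries made, given the objective,
  -- the items still to arrive (in order) and the current buffer.
  run : (Subset n → Carrier) → Strategy η k t m →
        Vec (Fin n) t → Vec (Fin n) m → Subset n × ℕ
  run f (query p s)   xs       b = let S , q = run f (s (f (items p b))) xs b in S , suc q
  run f (keep p s)    xs       b = run f s xs (select p b)
  run f (receive _ s) (x ∷ xs) b = run f s xs (x ∷ b)
  run f (output p _)  []       b = items p b , 0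

  -- A randomized algorithm: a uniformly random seed selects the strategy.
  -- It knows k and the length n of the stream, but not the objective.
  record Algorithm (η k n : ℕ) : Set where
    field
      seeds       : ℕ
      {{nonZero}} : NonZero seeds
      strategy    : Fin seeds → Strategy η k n 0

  module _ (𝒜 : Algorithm η k n) where
    open Algorithm 𝒜

    -- Each pair of a seed and an arrival order, all equally likely.
    sampleSpace : List (Fin seeds × Vec (Fin n) n)
    sampleSpace = List.cartesianProduct (List.allFin seeds) (orders n)

    outcome : (Subset n → Carrier) → Fin seeds × Vec (Fin n) n → Subset n × ℕ
    outcome f (i , σ) = run f (strategy i) σ []

    value : (Subset n → Carrier) → Fin seeds × Vec (Fin n) n → Carrier
    value f ω = f (proj₁ (outcome f ω))

    evaluations : (Subset n → Carrier) → Fin seeds × Vec (Fin n) n → ℕ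
    evaluations f ω = proj₂ (outcome f ω)

  average : List Carrier → Carrier
  average xs = foldr _+_ 0# xs * fromℕ (length xs) ⁻¹

  expectedValue : Algorithm η k n → (Subset n → Carrier) → Carrier
  expectedValue 𝒜 f = average (List.map (value 𝒜 f) (sampleSpace 𝒜))

{-# OPTIONS --safe #-}
-- Every position of the stream receives an independent uniform label in
-- {0, …, W - 1}, and window i consists of the items labelled i; rearranging a
-- uniformly random order by its labels keeps it uniformly random.  The windows
-- form groups.  Within a group the algorithm keeps, for each ℓ ≤ μ, the best
-- solution L_ℓ it knows that adds at most ℓ items to the solution at the start
-- of the group: in each window L_(ℓ+1) competes with the extensions of L_ℓ by
-- an item of the window or by a stored item, where every item that won such a
-- competition is stored.  The next group starts from L_μ.
--
-- Moving an item that is not stored to another window does not change the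
-- states reached earlier.  Resampling its label therefore shows that, given the
-- state before window i, each item of a set O is available with probability at
-- least q = 1/W and that for lower bounds these events may be taken to be
-- independent.  By submodularity the expected losses δ(i, ℓ) of f(L_ℓ) against
-- f(O) then satisfy δ(i+1, ℓ+1) ≤ (1 - p) δ(i, ℓ+1) + p (1 - 1/k) δ(i, ℓ).  This
-- is the recursion of E[(1 - 1/k)^min(ℓ, X)] for a binomial X with parameters i
-- and p, and a second moment bound on X gives the decrease per group.
--
-- For c ≥ 2/ε there are N = ⌊k/c²⌋ groups of G = 2c³ windows, with μ = c² - c
-- and p = μ/G, and the total loss is at most
-- ((1 - c²/k)^N + O(1/c) + O(c²/k)) f(O) ≤ (1/e + ε + O(c²/k)) f(O).
module Submission where

open import Defs
open import Algebra.Solver.Ring.AlmostCommutativeRing using (fromCommutativeRing; _-Raw-AlmostCommutative⟶_)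
open import Data.Bool using (Bool; true; false; if_then_else_; _∨_)
open import Data.Fin as Fin using (Fin; zero; suc; toℕ; inject₁)
open import Data.Fin.Subset using (Subset; inside; outside; ⊥; ⊤; ⁅_⁆; ⋃; _∪_; _⊆_; ∣_∣) renaming (_∈_ to _∈ₛ_; _∉_ to _∉ₛ_)
open import Data.Fin.Subset.Properties as Subset using (_∈?_)
open import Data.Integer as ℤ using (ℤ; -[1+_])
open import Data.List as List using (List; []; _∷_; _++_; _ʳ++_; filter; length; concatMap; allFin; foldr; map; replicate)
open import Data.List.Membership.DecPropositional using () renaming (_∈?_ to mem?)
open import Data.List.Membership.Propositional using (_∈_; _∉_; find; lose)
open import Data.List.Membership.Propositional.Properties using (∈-filter⁻; ∈-filter⁺; ∈-map⁻; ∈-map⁺; ∈-++⁺ˡ; ∈-++⁺ʳ; ∈-concatMap⁺; ∈-concatMap⁻; ∈-allFin; ∈-cartesianProduct⁺; ∈-cartesianProduct⁻)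
open import Data.List.Relation.Binary.Permutation.Propositional using (_↭_; ↭-refl; ↭-prep; ↭-trans; ↭-swap; ↭-sym; ↭⇒↭ₛ)
open import Data.List.Relation.Binary.Permutation.Propositional.Properties using (∈-resp-↭)
open import Data.List.Relation.Unary.All as All using (All; []; _∷_)
open import Data.List.Relation.Unary.AllPairs as AllPairs using ([]; _∷_)
open import Data.List.Relation.Unary.Any using (here; there)
open import Data.List.Relation.Unary.Unique.Propositional using (Unique)
open import Data.Maybe using (Maybe; just; nothing)
open import Data.Nat as ℕ using (ℕ; zero; suc; NonZero; _!)
open import Data.Nat.DivMod using (_/_; _%_; m/n*n≤m; m≥n⇒m/n>0; m%n<n; m≡m%n+[m/n]*n; [m+kn]%n≡m%n; m*n%n≡0; m<n⇒m%n≡m)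
open import Data.Nat.Solver using (module +-*-Solver)
open import Data.Product using (Σ-syntax; _×_; _,_; proj₁; proj₂; map₂)
open import Data.Sum using (_⊎_; inj₁; inj₂; [_,_]′)
open import Data.Unit using (tt) renaming (⊤ to Unit)
open import Data.Vec as Vec using (Vec; []; _∷_; lookup; tabulate; _[_]≔_)
open import Function using (_∘_; id)
open import Relation.Binary using (DecTotalOrder)
open import Relation.Binary.PropositionalEquality as ≡ using (_≡_; _≢_; module ≡-Reasoning)
open import Relation.Nullary using (¬_; Dec; yes; no; does; contradiction)
open import Relation.Nullary.Decidable using (dec-true; dec-false)
import Algebra.Construct.NaturalChoice.Max as Max
import Algebra.Properties.AbelianGroup
import Algebra.Properties.Ring
import Algebra.Properties.Semiring.Mult
import Algebra.Properties.Semiring.Mult.TCOptimised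
import Algebra.Solver.IdempotentCommutativeMonoid
import Algebra.Solver.Ring
import Data.Fin.Properties as Fin
import Data.Integer.Properties as ℤ
import Data.List.Extrema
import Data.List.Properties as List
import Data.List.Relation.Binary.Permutation.Setoid.Properties as ↭ₛ
import Data.List.Relation.Unary.All.Properties as All
import Data.List.Relation.Unary.Unique.Propositional.Properties as Unique
import Data.Nat.Properties as ℕ
import Data.Vec.Properties as Vec

-- The past of the algorithm carries information about which items have arrived, so members of O are
-- not independent of the state. Two choices make this harmless. An item that holds no level when
-- its window closes leaves no trace, because levels are running maxima. An item that does hold one
-- is stored for good and offered again in every window, so the items the state knows about are
-- always available. Each window stores at most μ items, hence O(k) in total for fixed c.
--
-- The bound is proved for every single arrival order, over the labels alone. The random order
-- serves only to make the stream sorted by labels as good as the original one.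
--
-- All levels are carried along because success of a window cannot be observed. A group has Gp = μ
-- expected successes with standard deviation below c, so capping their number at μ wastes O(c) of
-- about c² additions. With G = 2c³ a window holds between 1/(2c) and 1/c members of a k-set in
-- expectation; the loss from several of them sharing a window is then a 1/c fraction, which the c
-- in μ = c² - c absorbs.

private
  variable
    A B : Set
    m n t j : ℕ

-- Ring normalisation with integer coefficients.

module RingSolver (ℛ : Reals) where
  open Reals ℛ
  open Algebra.Properties.Ring ring using (-‿distribˡ-*; -‿distribʳ-*)
  open Algebra.Properties.AbelianGroup +-abelianGroup using (⁻¹-involutive; ⁻¹-∙-comm; ε⁻¹≈ε)
  open Algebra.Properties.Semiring.Mult.TCOptimised semiring
    using (1+×; ×-homo-+; ×1-homo-*) renaming (_×_ to _×′_)

  -- The optimised multiple takes 1 to `1#` and 2 to `1# + 1#` by computation, so the solver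
  -- constants `𝟙` and `𝟚` match goals written with these terms.
  fromℤ : ℤ → Carrier
  fromℤ (ℤ.+ n)    = n ×′ 1#
  fromℤ -[1+ n ] = - (suc n ×′ 1#)

  private
    cancel : ∀ x y z → (x + y) - (x + z) ≈ y - z
    cancel x y z =
      trans (+-congˡ (sym (⁻¹-∙-comm x z)))
      (trans (+-congʳ (+-comm x y))
      (trans (+-assoc y x _)
      (+-congˡ (trans (sym (+-assoc x (- x) (- z)))
               (trans (+-congʳ (-‿inverseʳ x)) (+-identityˡ _))))))

    fromℤ-⊖ : ∀ m n → fromℤ (m ℤ.⊖ n) ≈ m ×′ 1# - n ×′ 1#
    fromℤ-⊖ zero zero = sym (-‿inverseʳ 0#)
    fromℤ-⊖ zero (suc n) = sym (+-identityˡ _)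
    fromℤ-⊖ (suc m) zero = sym (trans (+-congˡ ε⁻¹≈ε) (+-identityʳ _))
    fromℤ-⊖ (suc m) (suc n) = trans (reflexive (≡.cong fromℤ (ℤ.[1+m]⊖[1+n]≡m⊖n m n)))
      (trans (fromℤ-⊖ m n)
      (trans (sym (cancel 1# (m ×′ 1#) (n ×′ 1#)))
             (+-cong (sym (1+× m 1#)) (-‿cong (sym (1+× n 1#))))))

    fromℤ-+ : ∀ i j → fromℤ (i ℤ.+ j) ≈ fromℤ i + fromℤ j
    fromℤ-+ (ℤ.+ m) (ℤ.+ n) = ×-homo-+ 1# m n
    fromℤ-+ (ℤ.+ m) -[1+ n ] = fromℤ-⊖ m (suc n)
    fromℤ-+ -[1+ m ] (ℤ.+ n) = trans (fromℤ-⊖ n (suc m)) (+-comm _ _)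
    fromℤ-+ -[1+ m ] -[1+ n ] =
      trans (-‿cong (trans (reflexive (≡.cong (λ k → suc k ×′ 1#) (≡.sym (ℕ.+-suc m n))))
                           (×-homo-+ 1# (suc m) (suc n))))
            (sym (⁻¹-∙-comm _ _))

    fromℤ-neg : ∀ i → fromℤ (ℤ.- i) ≈ - fromℤ i
    fromℤ-neg (ℤ.+ zero)  = sym ε⁻¹≈ε
    fromℤ-neg (ℤ.+ suc n) = refl
    fromℤ-neg -[1+ n ]  = sym (⁻¹-involutive _)

    fromℤ-* : ∀ i j → fromℤ (i ℤ.* j) ≈ fromℤ i * fromℤ j
    fromℤ-* (ℤ.+ m) (ℤ.+ n) =
      trans (reflexive (≡.cong fromℤ (ℤ.+◃n≡+n (m ℕ.* n)))) (×1-homo-* m n)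
    fromℤ-* (ℤ.+ m) -[1+ n ] =
      trans (reflexive (≡.cong fromℤ (ℤ.-◃n≡-n (m ℕ.* suc n))))
      (trans (fromℤ-neg (ℤ.+ (m ℕ.* suc n)))
      (trans (-‿cong (×1-homo-* m (suc n))) (-‿distribʳ-* _ _)))
    fromℤ-* -[1+ m ] (ℤ.+ n) =
      trans (reflexive (≡.cong fromℤ (ℤ.-◃n≡-n (suc m ℕ.* n))))
      (trans (fromℤ-neg (ℤ.+ (suc m ℕ.* n)))
      (trans (-‿cong (×1-homo-* (suc m) n)) (-‿distribˡ-* _ _)))
    fromℤ-* -[1+ m ] -[1+ n ] =
      trans (×1-homo-* (suc m) (suc n))
      (sym (trans (sym (-‿distribˡ-* _ _))
           (trans (-‿cong (sym (-‿distribʳ-* _ _))) (⁻¹-involutive _))))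

    morphism : ℤ.+-*-rawRing -Raw-AlmostCommutative⟶ fromCommutativeRing commutativeRing
    morphism = record
      { ⟦_⟧ = fromℤ ; +-homo = fromℤ-+ ; *-homo = fromℤ-* ; -‿homo = fromℤ-neg
      ; 0-homo = refl ; 1-homo = refl }

    dec : ∀ i j → Maybe (fromℤ i ≈ fromℤ j)
    dec i j with i ℤ.≟ j
    ... | yes eq = just (reflexive (≡.cong fromℤ eq))
    ... | no _   = nothing

  open Algebra.Solver.Ring ℤ.+-*-rawRing (fromCommutativeRing commutativeRing) morphism dec public
    using (solve; _:=_; _:+_; _:*_; _:-_; :-_; _:^_; con; Polynomial)

  𝟙 : ∀ {n} → Polynomial n
  𝟙 = con (ℤ.+ 1)

  𝟚 : ∀ {n} → Polynomial n
  𝟚 = con (ℤ.+ 2)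

-- Arithmetic in an ordered field.

module OrderedField (ℛ : Reals) where
  open Reals ℛ public hiding (zero)
  open RingSolver ℛ public
  open DecTotalOrder decTotalOrder public
    using (total; antisym; ≤-respˡ-≈; ≤-respʳ-≈; _≤?_; _≟_; totalOrder; poset)
    renaming (refl to ≤-refl; trans to ≤-trans; reflexive to ≤-reflexive)
  open Max totalOrder public using (_⊔_; x≤x⊔y; x≤y⊔x; ⊔-lub; ⊔-monoˡ-≤)

  -- The equation b ≈ a + d + h certifies a ≤ b when d is nonnegative and h vanishes.
  ≤-by : ∀ {a b} d h → 0# ≤ d → h ≈ 0# → b ≈ a + d + h → a ≤ b
  ≤-by {a} d h 0≤d h≈0 eq =
    ≤-respʳ-≈ (sym (trans eq (trans (+-congˡ h≈0) (+-identityʳ _))))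
      (≤-respˡ-≈ (+-identityʳ a) (+-monoʳ-≤ a 0≤d))

  ≤-via : ∀ {a b} d → 0# ≤ d → b ≈ a + d → a ≤ b
  ≤-via d 0≤d eq = ≤-by d 0# 0≤d refl (trans eq (sym (+-identityʳ _)))

  x≤x+ : ∀ x {d} → 0# ≤ d → x ≤ x + d
  x≤x+ x {d} 0≤d = ≤-via d 0≤d refl

  +-nonneg : ∀ {x y} → 0# ≤ x → 0# ≤ y → 0# ≤ x + y
  +-nonneg {x} 0≤x 0≤y = ≤-trans 0≤x (x≤x+ x 0≤y)

  +-mono : ∀ {a b c d} → a ≤ b → c ≤ d → a + c ≤ b + d
  +-mono {a} {b} {c} {d} a≤b c≤d = ≤-trans (+-monoʳ-≤ a c≤d)
    (≤-respˡ-≈ (+-comm d a) (≤-respʳ-≈ (+-comm d b) (+-monoʳ-≤ d a≤b)))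

  x≤y⇒0≤y-x : ∀ {x y} → x ≤ y → 0# ≤ y - x
  x≤y⇒0≤y-x {x} {y} x≤y =
    ≤-respˡ-≈ (-‿inverseˡ x) (≤-respʳ-≈ (+-comm _ _) (+-monoʳ-≤ (- x) x≤y))

  0≤y-x⇒x≤y : ∀ {x y} → 0# ≤ y - x → x ≤ y
  0≤y-x⇒x≤y {x} {y} p = ≤-via (y - x) p (solve 2 (λ x y → y := x :+ (y :- x)) refl x y)

  *-monoˡ : ∀ {a x y} → 0# ≤ a → x ≤ y → a * x ≤ a * y
  *-monoˡ {a} {x} {y} 0≤a x≤y = ≤-via (a * (y - x)) (*-nonneg 0≤a (x≤y⇒0≤y-x x≤y))
    (solve 3 (λ a x y → a :* y := a :* x :+ a :* (y :- x)) refl a x y)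

  *-monoʳ : ∀ {a x y} → 0# ≤ a → x ≤ y → x * a ≤ y * a
  *-monoʳ 0≤a x≤y = ≤-respˡ-≈ (*-comm _ _) (≤-respʳ-≈ (*-comm _ _) (*-monoˡ 0≤a x≤y))

  *-mono : ∀ {a b x y} → 0# ≤ a → 0# ≤ y → a ≤ b → x ≤ y → a * x ≤ b * y
  *-mono 0≤a 0≤y a≤b x≤y = ≤-trans (*-monoˡ 0≤a x≤y) (*-monoʳ 0≤y a≤b)

  neg-antitone : ∀ {x y} → x ≤ y → - y ≤ - x
  neg-antitone {x} {y} x≤y = ≤-via (y - x) (x≤y⇒0≤y-x x≤y)
    (solve 2 (λ x y → :- x := :- y :+ (y :- x)) refl x y)

  sq-nonneg : ∀ x → 0# ≤ x * x
  sq-nonneg x with total 0# x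
  ... | inj₁ p = *-nonneg p p
  ... | inj₂ p = ≤-respʳ-≈ (solve 1 (λ x → (:- x) :* (:- x) := x :* x) refl x)
    (*-nonneg 0≤-x 0≤-x)
    where
    0≤-x : 0# ≤ - x
    0≤-x = ≤-respʳ-≈ (+-identityˡ _) (x≤y⇒0≤y-x p)

  0≤1 : 0# ≤ 1#
  0≤1 = ≤-respʳ-≈ (*-identityʳ 1#) (sq-nonneg 1#)

  ^-nonneg : ∀ {x} n → 0# ≤ x → 0# ≤ x ^ n
  ^-nonneg zero    0≤x = 0≤1
  ^-nonneg (suc n) 0≤x = *-nonneg 0≤x (^-nonneg n 0≤x)

  ^-≤1 : ∀ {x} n → 0# ≤ x → x ≤ 1# → x ^ n ≤ 1#
  ^-≤1 zero    0≤x x≤1 = ≤-refl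
  ^-≤1 (suc n) 0≤x x≤1 = ≤-respʳ-≈ (*-identityʳ 1#) (*-mono 0≤x 0≤1 x≤1 (^-≤1 n 0≤x x≤1))

  fromℕ-nonneg : ∀ n → 0# ≤ fromℕ n
  fromℕ-nonneg zero    = ≤-refl
  fromℕ-nonneg (suc n) = +-nonneg 0≤1 (fromℕ-nonneg n)

  open Algebra.Properties.Semiring.Mult semiring using (×1-homo-*; ×-homo-+)

  fromℕ-+ : ∀ m n → fromℕ (m ℕ.+ n) ≈ fromℕ m + fromℕ n
  fromℕ-+ = ×-homo-+ 1#

  fromℕ-* : ∀ m n → fromℕ (m ℕ.* n) ≈ fromℕ m * fromℕ n
  fromℕ-* = ×1-homo-*

  fromℕ-1 : fromℕ 1 ≈ 1#
  fromℕ-1 = +-identityʳ 1#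

  fromℕ-mono : ∀ {m n} → m ℕ.≤ n → fromℕ m ≤ fromℕ n
  fromℕ-mono {n = n} ℕ.z≤n = fromℕ-nonneg n
  fromℕ-mono (ℕ.s≤s m≤n)   = +-monoʳ-≤ 1# (fromℕ-mono m≤n)

  1≤fromℕ : ∀ n → .{{NonZero n}} → 1# ≤ fromℕ n
  1≤fromℕ (suc n) = x≤x+ 1# (fromℕ-nonneg n)

  1≤⇒≉0 : ∀ {x} → 1# ≤ x → ¬ x ≈ 0#
  1≤⇒≉0 1≤x x≈0 = 0#≉1# (antisym 0≤1 (≤-respʳ-≈ x≈0 1≤x))

  fromℕ-inverse : ∀ n → .{{NonZero n}} → fromℕ n * fromℕ n ⁻¹ ≈ 1#
  fromℕ-inverse n = ⁻¹-inverseʳ (1≤⇒≉0 (1≤fromℕ n))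

  *-cancel-nonneg : ∀ {a x} → 0# ≤ a → ¬ a ≈ 0# → 0# ≤ a * x → 0# ≤ x
  *-cancel-nonneg {a} {x} 0≤a a≉0 0≤ax with total 0# x
  ... | inj₁ p = p
  ... | inj₂ p = ≤-reflexive (sym x≈0)
    where
    ax≈0 : a * x ≈ 0#
    ax≈0 = antisym (≤-respʳ-≈ (zeroʳ a) (*-monoˡ 0≤a p)) 0≤ax
    x≈0 : x ≈ 0#
    x≈0 = trans (sym (*-identityˡ x)) (trans (*-congʳ (sym (⁻¹-inverseʳ a≉0)))
      (trans (solve 3 (λ a i x → (a :* i) :* x := i :* (a :* x)) refl a (a ⁻¹) x)
      (trans (*-congˡ ax≈0) (zeroʳ _))))

  *-cancel-≤ : ∀ {a x y} → 0# ≤ a → ¬ a ≈ 0# → a * x ≤ a * y → x ≤ y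
  *-cancel-≤ {a} {x} {y} 0≤a a≉0 p = 0≤y-x⇒x≤y (*-cancel-nonneg 0≤a a≉0
    (≤-respʳ-≈ (solve 3 (λ a x y → a :* y :- a :* x := a :* (y :- x)) refl a x y) (x≤y⇒0≤y-x p)))

  ⁻¹-nonneg : ∀ {x} → 0# ≤ x → ¬ x ≈ 0# → 0# ≤ x ⁻¹
  ⁻¹-nonneg 0≤x x≉0 = *-cancel-nonneg 0≤x x≉0 (≤-respʳ-≈ (sym (⁻¹-inverseʳ x≉0)) 0≤1)

  fromℕ⁻¹-nonneg : ∀ n → .{{NonZero n}} → 0# ≤ fromℕ n ⁻¹
  fromℕ⁻¹-nonneg n = ⁻¹-nonneg (fromℕ-nonneg n) (1≤⇒≉0 (1≤fromℕ n))

-- Powers of 1 - x compared with 1/e.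

module Exponential (ℛ : Reals) where
  open OrderedField ℛ
  open Euler ℛ

  private
    term : ℕ → Carrier
    term n = fromℕ (n !) ⁻¹

    term-nonneg : ∀ n → 0# ≤ term n
    term-nonneg n = fromℕ⁻¹-nonneg (n !) {{n ℕ.!≢0}}

    term-suc : ∀ n → term n ≈ fromℕ (suc n) * term (suc n)
    term-suc n = begin
      term n ≈⟨ *-identityʳ _ ⟨
      term n * 1# ≈⟨ *-congˡ (fromℕ-inverse (suc n !) {{suc n ℕ.!≢0}}) ⟨
      term n * (fromℕ (suc n !) * term (suc n)) ≈⟨ *-congˡ (*-congʳ (fromℕ-* (suc n) (n !))) ⟩
      term n * ((fromℕ (suc n) * fromℕ (n !)) * term (suc n))
        ≈⟨ solve 4 (λ i s f u → i :* ((s :* f) :* u) := (f :* i) :* (s :* u)) refl _ _ _ _ ⟩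
      (fromℕ (n !) * term n) * (fromℕ (suc n) * term (suc n)) ≈⟨ *-congʳ (fromℕ-inverse (n !) {{n ℕ.!≢0}}) ⟩
      1# * (fromℕ (suc n) * term (suc n)) ≈⟨ *-identityˡ _ ⟩
      fromℕ (suc n) * term (suc n) ∎
      where open import Relation.Binary.Reasoning.Setoid setoid

  -- The exponential series at y, cut off after n terms. Since `e` is known only as a supremum of
  -- such sums, every estimate is made on the truncations, uniformly in n.
  expSumAt : ℕ → Carrier → Carrier
  expSumAt zero    y = 0#
  expSumAt (suc n) y = expSumAt n y + y ^ n * term n

  ^-cong : ∀ n {x y} → x ≈ y → x ^ n ≈ y ^ n
  ^-cong zero    x≈y = refl
  ^-cong (suc n) x≈y = *-cong x≈y (^-cong n x≈y)

  expSumAt-cong : ∀ n {x y} → x ≈ y → expSumAt n x ≈ expSumAt n y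
  expSumAt-cong zero    x≈y = refl
  expSumAt-cong (suc n) x≈y = +-cong (expSumAt-cong n x≈y) (*-congʳ (^-cong n x≈y))

  1^n≈1 : ∀ n → 1# ^ n ≈ 1#
  1^n≈1 zero    = refl
  1^n≈1 (suc n) = trans (*-identityˡ _) (1^n≈1 n)

  expSum≈ : ∀ n → expSum n ≈ expSumAt n 1#
  expSum≈ zero    = refl
  expSum≈ (suc n) = +-cong (expSum≈ n) (sym (trans (*-congʳ (1^n≈1 n)) (*-identityˡ _)))

  ^-monoˡ : ∀ n {x y} → 0# ≤ x → x ≤ y → x ^ n ≤ y ^ n
  ^-monoˡ zero    0≤x x≤y = ≤-refl
  ^-monoˡ (suc n) 0≤x x≤y = *-mono 0≤x (^-nonneg n (≤-trans 0≤x x≤y)) x≤y (^-monoˡ n 0≤x x≤y)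

  expSumAt-mono : ∀ n {x y} → 0# ≤ x → x ≤ y → expSumAt n x ≤ expSumAt n y
  expSumAt-mono zero    0≤x x≤y = ≤-refl
  expSumAt-mono (suc n) 0≤x x≤y =
    +-mono (expSumAt-mono n 0≤x x≤y) (*-monoʳ (term-nonneg n) (^-monoˡ n 0≤x x≤y))

  -- Convexity of t^(n+1): the left side is its tangent at y, evaluated at y - x.
  bernoulli : ∀ n {x y} → 0# ≤ x → x ≤ y → y ^ suc n - fromℕ (suc n) * (x * y ^ n) ≤ (y - x) ^ suc n
  bernoulli zero {x} {y} 0≤x x≤y = ≤-reflexive
    (solve 2 (λ x y → y :* 𝟙 :- (𝟙 :+ con (ℤ.+ 0)) :* (x :* 𝟙) := (y :- x) :* 𝟙) refl x y)
  bernoulli (suc n) {x} {y} 0≤x x≤y = ≤-trans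
    (≤-via (fromℕ (suc n) * (x * x) * y ^ n)
      (*-nonneg (*-nonneg (fromℕ-nonneg (suc n)) (sq-nonneg x)) (^-nonneg n (≤-trans 0≤x x≤y)))
      (solve 4 (λ x y p s → (y :- x) :* (y :* p :- s :* (x :* p))
         := (y :* (y :* p) :- (𝟙 :+ s) :* (x :* (y :* p))) :+ s :* (x :* x) :* p)
         refl x y (y ^ n) (fromℕ (suc n))))
    (*-monoˡ (x≤y⇒0≤y-x x≤y) (bernoulli n 0≤x x≤y))

  -- The truncation with n terms is the derivative of the one with n + 1 terms, so this is a tangent
  -- bound again: `bernoulli` in each degree, divided by the factorial and summed.
  expSumAt-shift : ∀ n {x y} → 0# ≤ x → x ≤ y →
    expSumAt (suc n) y - x * expSumAt n y ≤ expSumAt (suc n) (y - x)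
  expSumAt-shift zero {x} {y} 0≤x x≤y = ≤-reflexive
    (solve 3 (λ x z u → (z :+ u) :- x :* con (ℤ.+ 0) := z :+ u) refl x 0# (1# * term 0))
  expSumAt-shift (suc n) {x} {y} 0≤x x≤y = ≤-trans
    (≤-reflexive (trans (+-congˡ (-‿cong (*-congˡ (+-congˡ (*-congˡ (term-suc n))))))
      (solve 7 (λ x y E₁ E₀ p s u →
        (E₁ :+ (y :* p) :* u) :- x :* (E₀ :+ p :* (s :* u)) :=
        (E₁ :- x :* E₀) :+ (y :* p :- s :* (x :* p)) :* u)
        refl x y (expSumAt (suc n) y) (expSumAt n y) (y ^ n) (fromℕ (suc n)) (term (suc n)))))
    (+-mono (expSumAt-shift n 0≤x x≤y) (*-monoʳ (term-nonneg (suc n)) (bernoulli n 0≤x x≤y)))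

  -- A truncated form of exp(y) (1 - x) ≤ exp(y - x). Compared with `expSumAt-shift`, x multiplies a
  -- sum longer by one nonnegative term, which only lowers the left side.
  expSumAt-decay : ∀ n {x y} → 0# ≤ x → x ≤ y → expSumAt n y * (1# - x) ≤ expSumAt n (y - x)
  expSumAt-decay zero 0≤x x≤y = ≤-reflexive (zeroˡ _)
  expSumAt-decay (suc n) {x} {y} 0≤x x≤y = ≤-trans
    (≤-via (x * (y ^ n * term n)) (*-nonneg 0≤x (*-nonneg (^-nonneg n (≤-trans 0≤x x≤y)) (term-nonneg n)))
      (solve 3 (λ x E u → (E :+ u) :- x :* E := (E :+ u) :* (𝟙 :- x) :+ x :* u) refl
        x (expSumAt n y) (y ^ n * term n)))
    (expSumAt-shift n 0≤x x≤y)

  expSumAt-0 : ∀ n → expSumAt n 0# ≤ 1#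
  expSumAt-0 zero = 0≤1
  expSumAt-0 (suc zero) = ≤-reflexive (trans (+-identityˡ _) (trans (*-identityˡ _)
    (trans (sym (*-identityˡ _)) (trans (*-congʳ (sym fromℕ-1)) (fromℕ-inverse 1)))))
  expSumAt-0 (suc (suc n)) = ≤-respˡ-≈
    (sym (trans (+-congˡ (trans (*-congʳ (zeroˡ _)) (zeroˡ _))) (+-identityʳ _))) (expSumAt-0 (suc n))

  -- Each factor 1 - x is traded for a shift of the argument by x; after j trades the argument is 0.
  expSumAt-geometric : ∀ n j {x} → 0# ≤ x → x ≤ 1# → expSumAt n (fromℕ j * x) * (1# - x) ^ j ≤ 1#
  expSumAt-geometric n zero {x} 0≤x x≤1 = ≤-respˡ-≈
    (trans (expSumAt-cong n (sym (zeroˡ x))) (sym (*-identityʳ _))) (expSumAt-0 n)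
  expSumAt-geometric n (suc j) {x} 0≤x x≤1 = ≤-trans
    (≤-respˡ-≈ (*-assoc _ _ _) (*-monoʳ (^-nonneg j (x≤y⇒0≤y-x x≤1))
      (≤-trans (expSumAt-decay n 0≤x (≤-via (fromℕ j * x) (*-nonneg (fromℕ-nonneg j) 0≤x)
          (solve 2 (λ j x → (𝟙 :+ j) :* x := x :+ j :* x) refl (fromℕ j) x)))
        (expSumAt-mono n (≤-respʳ-≈ (sym eq) (*-nonneg (fromℕ-nonneg j) 0≤x)) (≤-reflexive eq)))))
    (expSumAt-geometric n j 0≤x x≤1)
    where
    eq : fromℕ (suc j) * x - x ≈ fromℕ j * x
    eq = solve 2 (λ j x → (𝟙 :+ j) :* x :- x := j :* x) refl (fromℕ j) x

  1≤e : 1# ≤ e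
  1≤e = ≤-trans (≤-reflexive (sym (trans (+-identityˡ _)
      (trans (sym (*-identityˡ _)) (trans (*-congʳ (sym fromℕ-1)) (fromℕ-inverse 1))))))
    (proj₁ (proj₂ e-supremum) (expSum 1) (1 , refl))

  -- The reciprocal of (1 - x)^j bounds every partial sum of the series for `e`, hence their
  -- supremum. A vanishing power is treated apart because its inverse is unspecified.
  geometric≤e⁻¹ : ∀ j {x} → 0# ≤ x → x ≤ 1# → 1# ≤ fromℕ j * x → (1# - x) ^ j ≤ e ⁻¹
  geometric≤e⁻¹ j {x} 0≤x x≤1 1≤jx with (1# - x) ^ j ≟ 0#
  ... | yes y≈0 = ≤-trans (≤-reflexive y≈0) (⁻¹-nonneg (≤-trans 0≤1 1≤e) (1≤⇒≉0 1≤e))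
  ... | no  y≉0 = *-cancel-≤ (≤-trans 0≤1 1≤e) (1≤⇒≉0 1≤e)
      (≤-respʳ-≈ (sym (⁻¹-inverseʳ (1≤⇒≉0 1≤e)))
        (≤-trans (*-monoʳ 0≤y e≤) (≤-reflexive (trans (*-comm _ _) (⁻¹-inverseʳ y≉0)))))
    where
    y = (1# - x) ^ j
    0≤y : 0# ≤ y
    0≤y = ^-nonneg j (x≤y⇒0≤y-x x≤1)
    expSum≤y⁻¹ : ∀ n → expSum n ≤ y ⁻¹
    expSum≤y⁻¹ n = *-cancel-≤ 0≤y y≉0 (≤-trans
      (≤-trans (≤-reflexive (trans (*-comm _ _) (*-congʳ (expSum≈ n))))
        (≤-trans (*-monoʳ 0≤y (expSumAt-mono n 0≤1 1≤jx)) (expSumAt-geometric n j 0≤x x≤1)))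
      (≤-reflexive (sym (⁻¹-inverseʳ y≉0))))
    e≤ : e ≤ y ⁻¹
    e≤ = proj₂ (proj₂ e-supremum) (y ⁻¹) (λ z (n , z≈) → ≤-respˡ-≈ (sym z≈) (expSum≤y⁻¹ n))

  -- On [0, 1] the N-th power is Lipschitz with constant N. This separates the error terms of a
  -- group from the main factor, which alone is compared with 1/e.
  power-perturbation : ∀ {a t} N → 0# ≤ a → 0# ≤ t → a + t ≤ 1# → (a + t) ^ N ≤ a ^ N + fromℕ N * t
  power-perturbation {a} {t} zero 0≤a 0≤t a+t≤1 = ≤-reflexive (sym (trans (+-congˡ (zeroˡ t)) (+-identityʳ 1#)))
  power-perturbation {a} {t} (suc N) 0≤a 0≤t a+t≤1 = ≤-trans
    (≤-via (a * (a ^ N + fromℕ N * t - (a + t) ^ N) + t * (1# - (a + t) ^ N))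
      (+-nonneg (*-nonneg 0≤a (x≤y⇒0≤y-x (power-perturbation N 0≤a 0≤t a+t≤1)))
                (*-nonneg 0≤t (x≤y⇒0≤y-x (^-≤1 N (+-nonneg 0≤a 0≤t) a+t≤1))))
      (solve 5 (λ a t p n q → a :* p :+ a :* (n :* t) :+ t
                 := (a :+ t) :* q :+ (a :* (p :+ n :* t :- q) :+ t :* (𝟙 :- q)))
               refl a t (a ^ N) (fromℕ N) ((a + t) ^ N)))
    (≤-via ((1# - a) * (fromℕ N * t))
      (*-nonneg (x≤y⇒0≤y-x (≤-trans (x≤x+ a 0≤t) a+t≤1)) (*-nonneg (fromℕ-nonneg N) 0≤t))
      (solve 4 (λ a t p n → a :* p :+ (𝟙 :+ n) :* t
                 := a :* p :+ a :* (n :* t) :+ t :+ (𝟙 :- a) :* (n :* t))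
               refl a t (a ^ N) (fromℕ N)))

-- A second-moment potential for the recursion within a group.

module Potential (ℛ : Reals) where
  open OrderedField ℛ

  module _ (c μ κ γ p Δ : Carrier)
    (0≤c : 0# ≤ c) (0≤κ : 0# ≤ κ) (κ≤1 : κ ≤ 1#) (0≤γ : 0# ≤ γ) (0≤p : 0# ≤ p) (p≤1 : p ≤ 1#)
    (0≤μ : 0# ≤ μ) (0≤Δ : 0# ≤ Δ) (γ-inverse : γ * ((1# + 1#) * c) ≈ 1#) where

    -- Let X be binomial with parameters I and p. As max(t, 0) ≤ (t² + c²)/(2c), taking t = l - X
    -- gives min(l, X) ≥ l - ((l - X)² + c²)/(2c). The variance of X is at most I p, so -γ Q is a
    -- lower bound for E[min(l, X)], where γ stands for 1/(2c).
    Q : Carrier → Carrier → Carrier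
    Q I l = (l - I * p) * (l - I * p) + I * p - (1# + 1#) * c * l + c * c

    -- From (1 - κ)^m ≤ 1 - κ m + κ² m² for m = min(l, X), with m² ≤ l μ. Keeping the last term
    -- linear in l makes the induction step a polynomial identity with visible slack.
    C : Carrier → Carrier → Carrier
    C I l = 1# + κ * (γ * Q I l) + l * μ * (κ * κ)

    h≈0 : ∀ z → (γ * ((1# + 1#) * c) - 1#) * z ≈ 0#
    h≈0 z = trans (*-congʳ (trans (+-congʳ γ-inverse) (-‿inverseʳ 1#))) (zeroˡ z)

    γQ+μ : ∀ {I l} → 0# ≤ I → l ≤ μ → 0# ≤ γ * Q I l + μ
    γQ+μ {I} {l} 0≤I l≤μ = ≤-by
      (γ * ((l - I * p) * (l - I * p) + I * p + c * c) + (μ - l))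
      ((γ * ((1# + 1#) * c) - 1#) * (- l))
      (+-nonneg (*-nonneg 0≤γ (+-nonneg (+-nonneg (sq-nonneg _) (*-nonneg 0≤I 0≤p)) (sq-nonneg c)))
                (x≤y⇒0≤y-x l≤μ))
      (h≈0 _)
      (solve 6 (λ I l p c γ μ →
          γ :* ((l :- I :* p) :* (l :- I :* p) :+ I :* p :- 𝟚 :* c :* l :+ c :* c) :+ μ
          := con (ℤ.+ 0) :+ (γ :* ((l :- I :* p) :* (l :- I :* p) :+ I :* p :+ c :* c) :+ (μ :- l))
             :+ (γ :* (𝟚 :* c) :- 𝟙) :* (:- l))
        refl I l p c γ μ)

    -- The expectation of (1 - κ)^min(l, X) satisfies this with equality. The slack of `C` consists
    -- of p² per step, from bounding the variance by I p, and of higher-order terms in κ. Among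
    -- these, the product of κ with the first-order term κ γ Q is covered by the μ κ² that one more
    -- level adds, since -γ Q ≤ μ.
    C-step : ∀ {I l} → 0# ≤ I → 0# ≤ l → l ≤ μ →
      (1# - p) * C I (1# + l) + (p - p * κ) * C I l ≤ C (1# + I) (1# + l)
    C-step {I} {l} 0≤I 0≤l l≤μ = ≤-by
      (κ * γ * (p * p) + (p * (κ * κ)) * (γ * Q I l + μ) + (p * (κ * κ)) * (κ * (l * μ)))
      ((γ * ((1# + 1#) * c) - 1#) * (- (κ * p)))
      (+-nonneg (+-nonneg (*-nonneg (*-nonneg 0≤κ 0≤γ) (sq-nonneg p)) (*-nonneg pκκ (γQ+μ 0≤I l≤μ)))
                (*-nonneg pκκ (*-nonneg 0≤κ (*-nonneg 0≤l 0≤μ))))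
      (h≈0 _)
      (solve 7 (λ I l p κ c γ μ → let
          q = λ I l → (l :- I :* p) :* (l :- I :* p) :+ I :* p :- 𝟚 :* c :* l :+ c :* c
          k = λ I l → 𝟙 :+ κ :* (γ :* q I l) :+ l :* μ :* (κ :* κ) in
          k (𝟙 :+ I) (𝟙 :+ l)
          := ((𝟙 :- p) :* k I (𝟙 :+ l) :+ (p :- p :* κ) :* k I l)
             :+ (κ :* γ :* (p :* p) :+ (p :* (κ :* κ)) :* (γ :* q I l :+ μ) :+ (p :* (κ :* κ)) :* (κ :* (l :* μ)))
             :+ (γ :* (𝟚 :* c) :- 𝟙) :* (:- (κ :* p)))
        refl I l p κ c γ μ)
      where
      pκκ : 0# ≤ p * (κ * κ)
      pκκ = *-nonneg 0≤p (sq-nonneg κ)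

    1≤C-bottom : ∀ {I} → 0# ≤ I → 1# ≤ C I 0#
    1≤C-bottom {I} 0≤I = ≤-via (κ * (γ * ((I * p) * (I * p) + I * p + c * c)))
      (*-nonneg 0≤κ (*-nonneg 0≤γ (+-nonneg (+-nonneg (sq-nonneg _) (*-nonneg 0≤I 0≤p)) (sq-nonneg c))))
      (solve 6 (λ I p κ c γ μ → let z = con (ℤ.+ 0) in
          𝟙 :+ κ :* (γ :* ((z :- I :* p) :* (z :- I :* p) :+ I :* p :- 𝟚 :* c :* z :+ c :* c)) :+ z :* μ :* (κ :* κ)
          := 𝟙 :+ κ :* (γ :* ((I :* p) :* (I :* p) :+ I :* p :+ c :* c)))
        refl I p κ c γ μ)

    1≤C-initial : ∀ {l} → 0# ≤ l → 1# ≤ C 0# l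
    1≤C-initial {l} 0≤l = ≤-via (κ * (γ * ((l - c) * (l - c))) + l * μ * (κ * κ))
      (+-nonneg (*-nonneg 0≤κ (*-nonneg 0≤γ (sq-nonneg _))) (*-nonneg (*-nonneg 0≤l 0≤μ) (sq-nonneg κ)))
      (solve 6 (λ l p κ c γ μ → let z = con (ℤ.+ 0) in
          𝟙 :+ κ :* (γ :* ((l :- z :* p) :* (l :- z :* p) :+ z :* p :- 𝟚 :* c :* l :+ c :* c)) :+ l :* μ :* (κ :* κ)
          := 𝟙 :+ (κ :* (γ :* ((l :- c) :* (l :- c))) :+ l :* μ :* (κ :* κ)))
        refl l p κ c γ μ)

    -- At the mean, where I p and l are both μ, the squared deviation vanishes and γ Q = (μ +
    -- c²)/(2c) - μ. With μ = c² - c this is c - 1/2 - μ, so the spread of X costs at most c of the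
    -- μ additions.
    C-final : ∀ {I} → I * p ≈ μ → μ ≈ c * c - c → C I μ ≤ 1# - (μ - c) * κ + μ * μ * (κ * κ)
    C-final {I} Ip≈μ μ≈ = ≤-respˡ-≈ (+-congʳ (+-congˡ (*-congˡ (*-congˡ (+-congʳ (+-congʳ
        (+-cong (*-cong e e) (sym Ip≈μ))))))))
      (≤-by (κ * (γ * c))
        ((γ * ((1# + 1#) * c) - 1#) * (κ * (μ - c)) + (- (μ - (c * c - c))) * (κ * γ))
        (*-nonneg 0≤κ (*-nonneg 0≤γ 0≤c))
        (trans (+-cong (h≈0 _) (trans (*-congʳ (trans (-‿cong (trans (+-congˡ (-‿cong (sym μ≈))) (-‿inverseʳ μ))) (trans (sym (+-identityˡ _)) (-‿inverseʳ 0#)))) (zeroˡ _)))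
               (+-identityʳ 0#))
        (solve 4 (λ κ c γ μ →
          𝟙 :- (μ :- c) :* κ :+ μ :* μ :* (κ :* κ)
          := (𝟙 :+ κ :* (γ :* (con (ℤ.+ 0) :* con (ℤ.+ 0) :+ μ :- 𝟚 :* c :* μ :+ c :* c)) :+ μ :* μ :* (κ :* κ))
             :+ κ :* (γ :* c) :+ ((γ :* (𝟚 :* c) :- 𝟙) :* (κ :* (μ :- c)) :+ (:- (μ :- (c :* c :- c))) :* (κ :* γ)))
          refl κ c γ μ))
      where
      e : 0# ≈ μ - I * p
      e = sym (trans (+-congˡ (-‿cong Ip≈μ)) (-‿inverseʳ μ))

    -- Chebyshev's bound in potential form: δ i l is compared with Δ E[(1 - κ)^min(l, X)]
    -- for a binomial X with parameters i and p, through a quadratic minorant of min(l, ·).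
    potential : ∀ {b} G (δ : ℕ → Fin (suc b) → Carrier) →
      (∀ l → δ 0 l ≤ Δ) →
      (∀ i → i ℕ.< G → δ (suc i) zero ≤ δ i zero) →
      (∀ i l → i ℕ.< G → δ (suc i) (suc l) ≤ (1# - p) * δ i (suc l) + (p - p * κ) * δ i (inject₁ l)) →
      fromℕ b ≤ μ →
      ∀ i l → i ℕ.≤ G → δ i l ≤ Δ * C (fromℕ i) (fromℕ (toℕ l))
    potential G δ δ₀ δ-bottom δ-step b≤μ zero l _ = ≤-trans (δ₀ l)
      (≤-respˡ-≈ (*-identityʳ Δ) (*-monoˡ 0≤Δ (1≤C-initial (fromℕ-nonneg (toℕ l)))))
    potential G δ δ₀ δ-bottom δ-step b≤μ (suc i) zero i≤G = ≤-trans (bottom (suc i) i≤G)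
      (≤-respˡ-≈ (*-identityʳ Δ) (*-monoˡ 0≤Δ (1≤C-bottom (fromℕ-nonneg (suc i)))))
      where
      bottom : ∀ i → i ℕ.≤ G → δ i zero ≤ Δ
      bottom zero    _   = δ₀ zero
      bottom (suc i) i<G = ≤-trans (δ-bottom i i<G) (bottom i (ℕ.<⇒≤ i<G))
    potential {b} G δ δ₀ δ-bottom δ-step b≤μ (suc i) (suc l) i<G = ≤-trans (δ-step i l i<G)
      (≤-trans (+-mono (*-monoˡ (x≤y⇒0≤y-x p≤1) (ih (suc l)))
                       (*-monoˡ 0≤p-pκ (≡.subst (λ t → δ i (inject₁ l) ≤ Δ * C (fromℕ i) (fromℕ t)) (Fin.toℕ-inject₁ l) (ih (inject₁ l)))))
      (≤-respˡ-≈ (solve 5 (λ D a x b y → D :* (a :* x :+ b :* y) := a :* (D :* x) :+ b :* (D :* y)) refl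
                    Δ _ _ _ _)
        (*-monoˡ 0≤Δ (C-step (fromℕ-nonneg i) (fromℕ-nonneg (toℕ l))
           (≤-trans (fromℕ-mono (ℕ.<⇒≤ (Fin.toℕ<n l))) b≤μ)))))
      where
      ih : ∀ l → δ i l ≤ Δ * C (fromℕ i) (fromℕ (toℕ l))
      ih l = potential G δ δ₀ δ-bottom δ-step b≤μ i l (ℕ.<⇒≤ i<G)
      0≤p-pκ : 0# ≤ p - p * κ
      0≤p-pκ = ≤-respʳ-≈ (solve 2 (λ p κ → p :* (𝟙 :- κ) := p :- p :* κ) refl p κ)
        (*-nonneg 0≤p (x≤y⇒0≤y-x κ≤1))

-- Finite sums and transformations that preserve the uniform order.

module Sums (ℛ : Reals) where
  open OrderedField ℛ
  open import Relation.Binary.Reasoning.Setoid setoid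

  ∑ : List A → (A → Carrier) → Carrier
  ∑ xs F = foldr _+_ 0# (map F xs)

  ∑-cong : ∀ {F G : A → Carrier} (xs : List A) → (∀ x → F x ≈ G x) → ∑ xs F ≈ ∑ xs G
  ∑-cong []       F≈G = refl
  ∑-cong (x ∷ xs) F≈G = +-cong (F≈G x) (∑-cong xs F≈G)

  ∑-mono∈ : ∀ {F G : A → Carrier} (xs : List A) → (∀ x → x ∈ xs → F x ≤ G x) → ∑ xs F ≤ ∑ xs G
  ∑-mono∈ []       F≤G = ≤-refl
  ∑-mono∈ (x ∷ xs) F≤G = +-mono (F≤G x (here ≡.refl)) (∑-mono∈ xs (λ y y∈ → F≤G y (there y∈)))

  ∑-mono : ∀ {F G : A → Carrier} (xs : List A) → (∀ x → F x ≤ G x) → ∑ xs F ≤ ∑ xs G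
  ∑-mono xs F≤G = ∑-mono∈ xs (λ x _ → F≤G x)

  ∑-+ : ∀ (F G : A → Carrier) xs → ∑ xs (λ x → F x + G x) ≈ ∑ xs F + ∑ xs G
  ∑-+ F G []       = sym (+-identityʳ 0#)
  ∑-+ F G (x ∷ xs) = trans (+-congˡ (∑-+ F G xs))
    (solve 4 (λ a b c d → (a :+ b) :+ (c :+ d) := (a :+ c) :+ (b :+ d)) refl _ _ _ _)

  ∑-*ˡ : ∀ a (F : A → Carrier) xs → ∑ xs (λ x → a * F x) ≈ a * ∑ xs F
  ∑-*ˡ a F []       = sym (zeroʳ a)
  ∑-*ˡ a F (x ∷ xs) = trans (+-congˡ (∑-*ˡ a F xs)) (sym (distribˡ a _ _))

  ∑-zero : ∀ (xs : List A) → ∑ xs (λ _ → 0#) ≈ 0#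
  ∑-zero []       = refl
  ∑-zero (x ∷ xs) = trans (+-identityˡ _) (∑-zero xs)

  ∑-const : ∀ a (xs : List A) → ∑ xs (λ _ → a) ≈ fromℕ (length xs) * a
  ∑-const a []       = sym (zeroˡ a)
  ∑-const a (x ∷ xs) = trans (+-congˡ (∑-const a xs))
    (solve 2 (λ a n → a :+ n :* a := (𝟙 :+ n) :* a) refl a _)

  ∑-++ : ∀ (F : A → Carrier) xs ys → ∑ (xs ++ ys) F ≈ ∑ xs F + ∑ ys F
  ∑-++ F []       ys = sym (+-identityˡ _)
  ∑-++ F (x ∷ xs) ys = trans (+-congˡ (∑-++ F xs ys)) (sym (+-assoc _ _ _))

  ∑-map : ∀ (F : B → Carrier) (g : A → B) xs → ∑ (map g xs) F ≈ ∑ xs (F ∘ g)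
  ∑-map F g xs = reflexive (≡.cong (foldr _+_ 0#) (≡.sym (List.map-∘ xs)))

  ∑-concatMap : ∀ (F : B → Carrier) (g : A → List B) xs → ∑ (concatMap g xs) F ≈ ∑ xs (λ x → ∑ (g x) F)
  ∑-concatMap F g []       = refl
  ∑-concatMap F g (x ∷ xs) = trans (∑-++ F (g x) _) (+-congˡ (∑-concatMap F g xs))

  ∑-swap : ∀ (F : A → B → Carrier) xs ys → ∑ xs (λ x → ∑ ys (F x)) ≈ ∑ ys (λ y → ∑ xs (λ x → F x y))
  ∑-swap F []       ys = sym (∑-zero ys)
  ∑-swap F (x ∷ xs) ys = trans (+-congˡ (∑-swap F xs ys)) (sym (∑-+ (F x) _ ys))

  ∑-cartesianProduct : ∀ (F : A × B → Carrier) xs ys →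
    ∑ (List.cartesianProduct xs ys) F ≈ ∑ xs (λ x → ∑ ys (λ y → F (x , y)))
  ∑-cartesianProduct F []       ys = refl
  ∑-cartesianProduct F (x ∷ xs) ys =
    trans (∑-++ F (map (x ,_) ys) _) (+-cong (∑-map F (x ,_) ys) (∑-cartesianProduct F xs ys))

  -- The choices of a first element together with the rest. `permutations` works by insertion and
  -- does not display the first element of an arrangement.
  selects : Vec A (suc n) → List (A × Vec A n)
  selects {n = zero}  (x ∷ [])         = (x , []) ∷ []
  selects {n = suc n} (x ∷ xs) = (x , xs) ∷ map (map₂ (x ∷_)) (selects xs)

  -- After x is inserted into an arrangement of the tail, the first element is either x itself or
  -- the old first element y; in the second case x has been inserted into what follows y, and
  -- induction applies to the tail.
  ∑-permutations-selects : ∀ (xs : Vec A (suc n)) (F : Vec A (suc n) → Carrier) →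
    ∑ (permutations xs) F ≈ ∑ (selects xs) λ (y , r) → ∑ (permutations r) λ τ → F (y ∷ τ)
  ∑-permutations-selects {n = zero} (x ∷ []) F = solve 2 (λ a z → a :+ z := (a :+ z) :+ con (ℤ.+ 0)) refl _ _
  ∑-permutations-selects {n = suc n} (x ∷ xs) F = begin
    ∑ (permutations (x ∷ xs)) F ≈⟨ ∑-concatMap F (insertions x) (permutations xs) ⟩
    ∑ (permutations xs) (λ τ → ∑ (insertions x τ) F) ≈⟨ ∑-permutations-selects xs _ ⟩
    ∑ (selects xs) (λ (y , r) → ∑ (permutations r) λ τ → F (x ∷ y ∷ τ) + ∑ (map (y ∷_) (insertions x τ)) F)
      ≈⟨ ∑-cong (selects xs) (λ (y , r) → trans (∑-+ _ _ (permutations r)) (+-congˡ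
           (trans (∑-cong (permutations r) (λ τ → ∑-map F (y ∷_) (insertions x τ)))
                  (sym (∑-concatMap (F ∘ (y ∷_)) (insertions x) (permutations r)))))) ⟩
    ∑ (selects xs) (λ (y , r) → ∑ (permutations r) (λ τ → F (x ∷ y ∷ τ)) + ∑ (permutations (x ∷ r)) (F ∘ (y ∷_)))
      ≈⟨ ∑-+ _ _ (selects xs) ⟩
    ∑ (selects xs) (λ (y , r) → ∑ (permutations r) (λ τ → F (x ∷ y ∷ τ)))
      + ∑ (selects xs) (λ (y , r) → ∑ (permutations (x ∷ r)) (F ∘ (y ∷_)))
      ≈⟨ +-cong (∑-permutations-selects xs (F ∘ (x ∷_))) (∑-map _ (map₂ (x ∷_)) (selects xs)) ⟨
    _ ∎

  -- Among ordered pairs of chosen positions, those with the head in first and in second place are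
  -- exchanged; the pairs avoiding the head are handled by induction.
  ∑-selects-swap : ∀ (xs : Vec A (suc (suc n))) (Φ : A → A → Vec A n → Carrier) →
    (∑ (selects xs) λ (y , r) → ∑ (selects r) λ (z , r′) → Φ y z r′) ≈
    (∑ (selects xs) λ (y , r) → ∑ (selects r) λ (z , r′) → Φ z y r′)
  ∑-selects-swap {n = zero} (x ∷ y ∷ []) Φ =
    solve 2 (λ a b → (a :+ z) :+ ((b :+ z) :+ z) := (b :+ z) :+ ((a :+ z) :+ z)) refl _ _
    where
    z : Polynomial 2
    z = con (ℤ.+ 0)
  ∑-selects-swap {A = A} {n = suc n} (x ∷ xs) Φ = begin
    ∑ (selects xs) (λ (z , r) → Φ x z r) + ∑ (map (map₂ (x ∷_)) (selects xs)) _
      ≈⟨ +-congˡ (split Φ) ⟩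
    ∑ (selects xs) (λ (z , r) → Φ x z r) + (∑ (selects xs) (λ (y , r) → Φ y x r) + S Φ)
      ≈⟨ solve 3 (λ a b c → a :+ (b :+ c) := b :+ (a :+ c)) refl _ _ _ ⟩
    ∑ (selects xs) (λ (y , r) → Φ y x r) + (∑ (selects xs) (λ (z , r) → Φ x z r) + S Φ)
      ≈⟨ +-congˡ (+-congˡ (∑-selects-swap xs (λ y z r → Φ y z (x ∷ r)))) ⟩
    ∑ (selects xs) (λ (y , r) → Φ y x r) + (∑ (selects xs) (λ (z , r) → Φ x z r) + S (λ y z → Φ z y))
      ≈⟨ +-congˡ (split (λ y z → Φ z y)) ⟨
    _ ∎
    where
    S : (A → A → Vec A (suc n) → Carrier) → Carrier
    S Ψ = ∑ (selects xs) λ (y , r) → ∑ (selects r) λ (z , r′) → Ψ y z (x ∷ r′)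
    split : ∀ Ψ → (∑ (map (map₂ (x ∷_)) (selects xs)) λ (y , r) → ∑ (selects r) λ (z , r′) → Ψ y z r′) ≈
      ∑ (selects xs) (λ (y , r) → Ψ y x r) + S Ψ
    split Ψ = trans (∑-map _ (map₂ (x ∷_)) (selects xs))
      (trans (∑-cong (selects xs) (λ (y , r) → +-congˡ (∑-map _ (map₂ (x ∷_)) (selects r))))
             (∑-+ _ _ (selects xs)))

  -- Invariance of the uniform distribution, tested against all sums, which is the form in which
  -- expectations use it.
  PreservesUniform : (Vec A n → Vec A n) → Set _
  PreservesUniform {A} {n} π = ∀ (xs : Vec A n) F → ∑ (permutations xs) (F ∘ π) ≈ ∑ (permutations xs) F

  onTail : (Vec A n → Vec A n) → Vec A (suc n) → Vec A (suc n)
  onTail π (x ∷ xs) = x ∷ π xs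

  swapHead : Vec A (suc (suc n)) → Vec A (suc (suc n))
  swapHead (x ∷ y ∷ xs) = y ∷ x ∷ xs

  onTail-uniform : {π : Vec A n → Vec A n} → PreservesUniform π → PreservesUniform (onTail π)
  onTail-uniform {π = π} π-uniform xs F = begin
    ∑ (permutations xs) (F ∘ onTail π) ≈⟨ ∑-permutations-selects xs _ ⟩
    _ ≈⟨ ∑-cong (selects xs) (λ (y , r) → π-uniform r (F ∘ (y ∷_))) ⟩
    _ ≈⟨ ∑-permutations-selects xs F ⟨
    ∑ (permutations xs) F ∎

  swapHead-uniform : PreservesUniform (swapHead {A} {n})
  swapHead-uniform xs F = begin
    ∑ (permutations xs) (F ∘ swapHead) ≈⟨ twice (F ∘ swapHead) ⟩
    _ ≈⟨ ∑-selects-swap xs (λ y z r → ∑ (permutations r) λ τ → F (z ∷ y ∷ τ)) ⟩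
    _ ≈⟨ twice F ⟨
    ∑ (permutations xs) F ∎
    where
    twice : ∀ F → ∑ (permutations xs) F ≈
      ∑ (selects xs) λ (y , r) → ∑ (selects r) λ (z , r′) → ∑ (permutations r′) λ τ → F (y ∷ z ∷ τ)
    twice F = trans (∑-permutations-selects xs F)
      (∑-cong (selects xs) (λ (y , r) → ∑-permutations-selects r (F ∘ (y ∷_))))

-- Schedules: sorting an arrival order by random labels.

data Schedule : ℕ → Set where
  done  : Schedule 0
  item  : Schedule t → Schedule (suc t)
  close : Schedule t → Schedule t

closes : ℕ → Schedule 0
closes zero    = done
closes (suc W) = close (closes W)

-- The new arrival goes to the front of window l. Labels are inserted from the last position to the
-- first, so items of one window keep their order and `arrange` is a stable sort by label.
insertItem : ℕ → Schedule t → Schedule (suc t)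
insertItem zero    sc         = item sc
insertItem (suc l) done       = item done
insertItem (suc l) (item sc)  = item (insertItem (suc l) sc)
insertItem (suc l) (close sc) = close (insertItem l sc)

moveHead : ℕ → Schedule t → Vec A (suc t) → Vec A (suc t)
moveHead zero    sc         xs           = xs
moveHead (suc l) done       xs           = xs
moveHead (suc l) (item sc)  (x ∷ y ∷ xs) = y ∷ moveHead (suc l) sc (x ∷ xs)
moveHead (suc l) (close sc) xs           = moveHead l sc xs

schedule : ∀ {W} → Vec (Fin W) n → Schedule n
schedule {W = W} []      = closes W
schedule         (l ∷ s) = insertItem (toℕ l) (schedule s)

arrange : ∀ {W} → Vec (Fin W) n → Vec A n → Vec A n
arrange []      []       = []
arrange (l ∷ s) (x ∷ xs) = moveHead (toℕ l) (schedule s) (x ∷ arrange s xs)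

addAt : ℕ → A → List (List A) → List (List A)
addAt l       x []       = []
addAt zero    x (w ∷ ws) = (x ∷ w) ∷ ws
addAt (suc l) x (w ∷ ws) = w ∷ addAt l x ws

-- Items that arrive after the last close belong to no window.
windows : Schedule t → Vec A t → List (List A)
windows done       []       = []
windows (item sc)  (x ∷ xs) = addAt 0 x (windows sc xs)
windows (close sc) xs       = [] ∷ windows sc xs

bins : ∀ {W} → Vec (Fin W) n → Vec A n → List (List A)
bins {W = W} []      []       = replicate W []
bins         (l ∷ s) (x ∷ xs) = addAt (toℕ l) x (bins s xs)

windows-insertItem : ∀ l (sc : Schedule t) (x : A) xs →
  windows (insertItem l sc) (moveHead l sc (x ∷ xs)) ≡ addAt l x (windows sc xs)
windows-insertItem zero    sc         x xs = ≡.refl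
windows-insertItem (suc l) done       x [] = ≡.refl
windows-insertItem (suc l) (item sc)  x (y ∷ xs)
  rewrite windows-insertItem (suc l) sc x xs with windows sc xs
... | []    = ≡.refl
... | _ ∷ _ = ≡.refl
windows-insertItem (suc l) (close sc) x xs = ≡.cong ([] ∷_) (windows-insertItem l sc x xs)

windows-closes : ∀ W → windows {A = A} (closes W) [] ≡ replicate W []
windows-closes zero    = ≡.refl
windows-closes (suc W) = ≡.cong ([] ∷_) (windows-closes W)

-- With this the analysis speaks of positions and labels in the original order; the sorted stream is
-- seen by the algorithm only.
windows-schedule : ∀ {W} (s : Vec (Fin W) n) (xs : Vec A n) → windows (schedule s) (arrange s xs) ≡ bins s xs
windows-schedule {W = W} [] [] = windows-closes W
windows-schedule (l ∷ s) (x ∷ xs) = ≡.trans (windows-insertItem (toℕ l) (schedule s) x (arrange s xs))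
  (≡.cong (addAt (toℕ l) x) (windows-schedule s xs))

insertions-↭ : ∀ (x : A) (xs : Vec A n) {ys} → ys ∈ insertions x xs → Vec.toList ys ↭ x ∷ Vec.toList xs
insertions-↭ x []       (here ≡.refl) = ↭-refl
insertions-↭ x (y ∷ xs) (here ≡.refl) = ↭-refl
insertions-↭ x (y ∷ xs) (there ys∈) with ∈-map⁻ (y ∷_) ys∈
... | zs , zs∈ , ≡.refl = ↭-trans (↭-prep y (insertions-↭ x xs zs∈)) (↭-swap y x ↭-refl)

permutations-↭ : ∀ (xs : Vec A n) {ys} → ys ∈ permutations xs → Vec.toList ys ↭ Vec.toList xs
permutations-↭ []       (here ≡.refl) = ↭-refl
permutations-↭ (x ∷ xs) ys∈ with find (∈-concatMap⁻ (insertions x) {xs = permutations xs} ys∈)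
... | zs , zs∈ , ys∈zs = ↭-trans (insertions-↭ x zs ys∈zs) (↭-prep x (permutations-↭ xs zs∈))

module UniformArrangement (ℛ : Reals) where
  open OrderedField ℛ
  open Sums ℛ

  -- The head travels by adjacent transpositions whose places are dictated by the schedule and never
  -- by the items, and each of them preserves the uniform order.
  moveHead-uniform : ∀ l (sc : Schedule t) → PreservesUniform (moveHead {A = A} l sc)
  moveHead-uniform zero    sc         xs F = refl
  moveHead-uniform (suc l) done       xs F = refl
  moveHead-uniform (suc l) (item sc)  xs F =
    trans (∑-cong (permutations xs) (λ { (x ∷ y ∷ τ) → refl }))
    (trans (swapHead-uniform xs (F ∘ onTail (moveHead (suc l) sc)))
           (onTail-uniform (moveHead-uniform (suc l) sc) xs F))
  moveHead-uniform (suc l) (close sc) xs F = moveHead-uniform l sc xs F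

  arrange-uniform : ∀ {W} (s : Vec (Fin W) n) → PreservesUniform (arrange {A = A} s)
  arrange-uniform []      [] F = refl
  arrange-uniform (l ∷ s) xs F =
    trans (∑-cong (permutations xs) (λ { (x ∷ τ) → refl }))
    (trans (onTail-uniform (arrange-uniform s) xs (F ∘ moveHead (toℕ l) (schedule s)))
           (moveHead-uniform (toℕ l) (schedule s) xs F))

-- Sets of items and sets of buffer slots.

filter-cong : ∀ {P Q : A → Set} (P? : ∀ x → Dec (P x)) (Q? : ∀ x → Dec (Q x)) xs →
  (∀ {y} → y ∈ xs → P y → Q y) → (∀ {y} → y ∈ xs → Q y → P y) → filter P? xs ≡ filter Q? xs
filter-cong P? Q? [] P⇒Q Q⇒P = ≡.refl
filter-cong P? Q? (x ∷ xs) P⇒Q Q⇒P with P? x | Q? x | filter-cong P? Q? xs (P⇒Q ∘ there) (Q⇒P ∘ there)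
... | yes _  | yes _  | eq = ≡.cong (x ∷_) eq
... | yes px | no ¬qx | _  = contradiction (P⇒Q (here ≡.refl) px) ¬qx
... | no ¬px | yes qx | _  = contradiction (Q⇒P (here ≡.refl) qx) ¬px
... | no _   | no _   | eq = eq

filter-filter : ∀ {P Q : A → Set} (P? : ∀ x → Dec (P x)) (Q? : ∀ x → Dec (Q x)) xs →
  (∀ {y} → y ∈ xs → P y → Q y) → filter P? (filter Q? xs) ≡ filter P? xs
filter-filter P? Q? [] P⇒Q = ≡.refl
filter-filter P? Q? (x ∷ xs) P⇒Q with ih ← filter-filter P? Q? xs (P⇒Q ∘ there) | Q? x
... | no ¬qx = ≡.trans ih (≡.sym (List.filter-reject P? (¬qx ∘ P⇒Q (here ≡.refl))))
... | yes qx with P? x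
... | yes _ = ≡.cong (x ∷_) ih
... | no _  = ih

lookup-ext : (xs ys : Vec A n) → (∀ i → lookup xs i ≡ lookup ys i) → xs ≡ ys
lookup-ext xs ys eq = ≡.trans (≡.sym (Vec.tabulate∘lookup xs)) (≡.trans (Vec.tabulate-cong eq) (Vec.tabulate∘lookup ys))

-- Inclusion as an equation, so that every union homomorphism preserves it.
infix 4 _⊑_
_⊑_ : Subset n → Subset n → Set
p ⊑ q = p ∪ q ≡ q

⊑-∪ˡ : ∀ {p q : Subset n} r → p ⊑ q → p ⊑ q ∪ r
⊑-∪ˡ {p = p} {q} r p⊑q = ≡.trans (≡.sym (Subset.∪-assoc p q r)) (≡.cong (_∪ r) p⊑q)

⊑-∪ʳ : ∀ {p r : Subset n} q → p ⊑ r → p ⊑ q ∪ r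
⊑-∪ʳ {p = p} {r} q p⊑r = ≡.subst (p ⊑_) (Subset.∪-comm r q) (⊑-∪ˡ q p⊑r)

∣p∪q∣≤∣p∣+∣q∣ : ∀ (p q : Subset n) → ∣ p ∪ q ∣ ℕ.≤ ∣ p ∣ ℕ.+ ∣ q ∣
∣p∪q∣≤∣p∣+∣q∣ [] [] = ℕ.z≤n
∣p∪q∣≤∣p∣+∣q∣ (inside ∷ p) (inside ∷ q) =
  ℕ.s≤s (ℕ.≤-trans (∣p∪q∣≤∣p∣+∣q∣ p q) (ℕ.+-monoʳ-≤ ∣ p ∣ (ℕ.n≤1+n _)))
∣p∪q∣≤∣p∣+∣q∣ (inside ∷ p) (outside ∷ q) = ℕ.s≤s (∣p∪q∣≤∣p∣+∣q∣ p q)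
∣p∪q∣≤∣p∣+∣q∣ (outside ∷ p) (inside ∷ q) =
  ≡.subst (suc ∣ p ∪ q ∣ ℕ.≤_) (≡.sym (ℕ.+-suc ∣ p ∣ ∣ q ∣)) (ℕ.s≤s (∣p∪q∣≤∣p∣+∣q∣ p q))
∣p∪q∣≤∣p∣+∣q∣ (outside ∷ p) (outside ∷ q) = ∣p∪q∣≤∣p∣+∣q∣ p q

setOf : List (Fin n) → Subset n
setOf xs = ⋃ (List.map ⁅_⁆ xs)

∈-setOf⁺ : ∀ {x : Fin n} {xs} → x ∈ xs → x ∈ₛ setOf xs
∈-setOf⁺ (here ≡.refl) = Subset.x∈p∪q⁺ (inj₁ (Subset.x∈⁅x⁆ _))
∈-setOf⁺ (there x∈)  = Subset.x∈p∪q⁺ (inj₂ (∈-setOf⁺ x∈))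

∈-setOf⁻ : ∀ {x : Fin n} xs → x ∈ₛ setOf xs → x ∈ xs
∈-setOf⁻ []       x∈ = contradiction x∈ Subset.∉⊥
∈-setOf⁻ (y ∷ xs) x∈ with Subset.x∈p∪q⁻ ⁅ y ⁆ (setOf xs) x∈
... | inj₁ x∈y = here (Subset.x∈⁅y⁆⇒x≡y y x∈y)
... | inj₂ x∈  = there (∈-setOf⁻ xs x∈)

items-⊥ : ∀ (b : Vec (Fin n) m) → items ⊥ b ≡ ⊥
items-⊥ []      = ≡.refl
items-⊥ (x ∷ b) = items-⊥ b

items-⁅⁆ : ∀ (b : Vec (Fin n) m) i → items ⁅ i ⁆ b ≡ ⁅ lookup b i ⁆
items-⁅⁆ (x ∷ b) zero    = ≡.trans (≡.cong (⁅ x ⁆ ∪_) (items-⊥ b)) (Subset.∪-identityʳ ⁅ x ⁆)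
items-⁅⁆ (x ∷ b) (suc i) = items-⁅⁆ b i

items-∪ : ∀ p q (b : Vec (Fin n) m) → items (p ∪ q) b ≡ items p b ∪ items q b
items-∪ [] [] [] = ≡.sym (Subset.∪-identityʳ ⊥)
items-∪ (inside ∷ p) (inside ∷ q) (x ∷ b) = ≡.trans (≡.cong (⁅ x ⁆ ∪_) (items-∪ p q b)) (lemma ⁅ x ⁆ _ _)
  where
  open Algebra.Solver.IdempotentCommutativeMonoid (Subset.∪-idempotentCommutativeMonoid _)
  lemma : ∀ a b c → a ∪ (b ∪ c) ≡ (a ∪ b) ∪ (a ∪ c)
  lemma = solve 3 (λ a b c → (a ⊕ (b ⊕ c)) ⊜ ((a ⊕ b) ⊕ (a ⊕ c))) ≡.refl
items-∪ (inside ∷ p) (outside ∷ q) (x ∷ b) =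
  ≡.trans (≡.cong (⁅ x ⁆ ∪_) (items-∪ p q b)) (≡.sym (Subset.∪-assoc ⁅ x ⁆ _ _))
items-∪ (outside ∷ p) (inside ∷ q) (x ∷ b) = ≡.trans (≡.cong (⁅ x ⁆ ∪_) (items-∪ p q b)) (lemma ⁅ x ⁆ _ _)
  where
  open Algebra.Solver.IdempotentCommutativeMonoid (Subset.∪-idempotentCommutativeMonoid _)
  lemma : ∀ a b c → a ∪ (b ∪ c) ≡ b ∪ (a ∪ c)
  lemma = solve 3 (λ a b c → (a ⊕ (b ⊕ c)) ⊜ (b ⊕ (a ⊕ c))) ≡.refl
items-∪ (outside ∷ p) (outside ∷ q) (x ∷ b) = items-∪ p q b

select-∪ : ∀ p (q r : Subset m) → select p (q ∪ r) ≡ select p q ∪ select p r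
select-∪ [] [] [] = ≡.refl
select-∪ (inside ∷ p)  (x ∷ q) (y ∷ r) = ≡.cong ((x ∨ y) ∷_) (select-∪ p q r)
select-∪ (outside ∷ p) (x ∷ q) (y ∷ r) = select-∪ p q r

∣select∣≤ : ∀ p (q : Subset m) → ∣ select p q ∣ ℕ.≤ ∣ q ∣
∣select∣≤ [] [] = ℕ.z≤n
∣select∣≤ (inside ∷ p)  (inside ∷ q)  = ℕ.s≤s (∣select∣≤ p q)
∣select∣≤ (inside ∷ p)  (outside ∷ q) = ∣select∣≤ p q
∣select∣≤ (outside ∷ p) (inside ∷ q)  = ℕ.m≤n⇒m≤1+n (∣select∣≤ p q)
∣select∣≤ (outside ∷ p) (outside ∷ q) = ∣select∣≤ p q

toList-select-select : ∀ p q (b : Vec A m) → q ⊑ p →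
  Vec.toList (select (select p q) (select p b)) ≡ Vec.toList (select q b)
toList-select-select [] [] [] _ = ≡.refl
toList-select-select (inside ∷ p) (inside ∷ q) (x ∷ b) q⊑p =
  ≡.cong (x ∷_) (toList-select-select p q b (Vec.∷-injectiveʳ q⊑p))
toList-select-select (inside ∷ p) (outside ∷ q) (x ∷ b) q⊑p = toList-select-select p q b (Vec.∷-injectiveʳ q⊑p)
toList-select-select (outside ∷ p) (inside ∷ q) (x ∷ b) q⊑p with () ← Vec.∷-injectiveˡ q⊑p
toList-select-select (outside ∷ p) (outside ∷ q) (x ∷ b) q⊑p = toList-select-select p q b (Vec.∷-injectiveʳ q⊑p)

items-select : ∀ p q (b : Vec (Fin n) m) → q ⊑ p → items (select p q) (select p b) ≡ items q b
items-select p q b q⊑p = ≡.cong setOf (toList-select-select p q b q⊑p)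

toList-select-⊤ : ∀ (b : Vec A m) → Vec.toList (select ⊤ b) ≡ Vec.toList b
toList-select-⊤ []      = ≡.refl
toList-select-⊤ (x ∷ b) = ≡.cong (x ∷_) (toList-select-⊤ b)

select-map : ∀ (g : A → B) p (b : Vec A m) → Vec.toList (select p (Vec.map g b)) ≡ List.map g (Vec.toList (select p b))
select-map g [] [] = ≡.refl
select-map g (inside ∷ p)  (x ∷ b) = ≡.cong (g x ∷_) (select-map g p b)
select-map g (outside ∷ p) (x ∷ b) = select-map g p b

toList-select⊆ : ∀ p (b : Vec A m) {y} → y ∈ Vec.toList (select p b) → y ∈ Vec.toList b
toList-select⊆ []            []      ()
toList-select⊆ (inside ∷ p)  (x ∷ b) (here eq)  = here eq
toList-select⊆ (inside ∷ p)  (x ∷ b) (there y∈) = there (toList-select⊆ p b y∈)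
toList-select⊆ (outside ∷ p) (x ∷ b) y∈         = there (toList-select⊆ p b y∈)

-- When the stored items are distinct, a compacted buffer is determined by a set of items, so it can
-- be described without slots.
toList-select-filter : ∀ p (b : Vec (Fin n) m) → Unique (Vec.toList b) →
  Vec.toList (select p b) ≡ filter (_∈? items p b) (Vec.toList b)
toList-select-filter [] [] _ = ≡.refl
toList-select-filter (inside ∷ p) (x ∷ b) (x∉b ∷ b-unique) = ≡.trans
  (≡.cong (x ∷_) (≡.trans (toList-select-filter p b b-unique)
    (filter-cong (_∈? items p b) (_∈? (⁅ x ⁆ ∪ items p b)) (Vec.toList b)
      (λ _ y∈ → Subset.x∈p∪q⁺ (inj₂ y∈))
      (λ y∈b y∈ → [ (λ y∈x → contradiction (≡.sym (Subset.x∈⁅y⁆⇒x≡y x y∈x)) (All.lookup x∉b y∈b)) , id ]′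
                    (Subset.x∈p∪q⁻ ⁅ x ⁆ _ y∈)))))
  (≡.sym (List.filter-accept (_∈? (⁅ x ⁆ ∪ items p b)) (Subset.x∈p∪q⁺ (inj₁ (Subset.x∈⁅x⁆ x)))))
toList-select-filter (outside ∷ p) (x ∷ b) (x∉b ∷ b-unique) =
  ≡.trans (toList-select-filter p b b-unique)
    (≡.sym (List.filter-reject (_∈? items p b)
      (λ x∈ → All.lookup x∉b (toList-select⊆ p b (∈-setOf⁻ _ x∈)) ≡.refl)))

-- Level ℓ + 1 during a window: `prev` is L_ℓ from the start of the window and `base ∪ cand` is the
-- current L_(ℓ+1). At first `base` is the old L_(ℓ+1) and `cand` is empty; a winner x turns them
-- into `prev` and x. As `prev` and `base` contain only items stored before the window, `cand` alone
-- claims new memory.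
record Level (m : ℕ) : Set where
  constructor level
  field
    prev base cand : Subset m

  best : Subset m
  best = base ∪ cand

  trial : Subset m → Subset m
  trial x = prev ∪ x

open Level

mapLevel : (Subset m → Subset n) → Level m → Level n
mapLevel h l = level (h (prev l)) (h (base l)) (h (cand l))

Levels : ℕ → ℕ → Set
Levels μ m = Vec (Level m) μ

mapLevels : (Subset m → Subset n) → Levels j m → Levels j n
mapLevels h = Vec.map (mapLevel h)

cands : Levels j m → Subset m
cands []       = ⊥
cands (l ∷ ls) = cand l ∪ cands ls

levels : Vec (Subset m) (suc j) → Levels j m
levels os = tabulate λ ℓ → level (lookup os (inject₁ ℓ)) (lookup os (suc ℓ)) ⊥

results : Subset m → Levels j m → Vec (Subset m) (suc j)
results s ls = s ∷ Vec.map best ls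

-- After the last window of a group every level restarts from the top one.
restart : Bool → Vec (Subset m) (suc j) → Vec (Subset m) (suc j)
restart {j = j} r os = if r then Vec.replicate (suc j) (lookup os (Fin.fromℕ j)) else os

-- Reading slots as items, compacting the buffer and making room for an arrival all preserve unions.
-- Levels are assembled by unions, so one naturality argument carries each step of the algorithm
-- from slots to items.
IsUnionHom : (Subset m → Subset n) → Set
IsUnionHom h = ∀ p q → h (p ∪ q) ≡ h p ∪ h q

cands-hom : ∀ {h : Subset m → Subset n} → h ⊥ ≡ ⊥ → IsUnionHom h →
  (ls : Levels j m) → h (cands ls) ≡ cands (mapLevels h ls)
cands-hom h⊥ h∪ []       = h⊥
cands-hom h⊥ h∪ (l ∷ ls) = ≡.trans (h∪ _ _) (≡.cong (_ ∪_) (cands-hom h⊥ h∪ ls))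

levels-hom : ∀ {h : Subset m → Subset n} → h ⊥ ≡ ⊥ →
  (os : Vec (Subset m) (suc j)) → mapLevels h (levels os) ≡ levels (Vec.map h os)
levels-hom {h = h} h⊥ os = ≡.trans (≡.sym (Vec.tabulate-∘ (mapLevel h) _)) (Vec.tabulate-cong λ ℓ →
  ≡.trans (≡.cong₂ (λ p b → level p b (h ⊥)) (≡.sym (Vec.lookup-map (inject₁ ℓ) h os)) (≡.sym (Vec.lookup-map (suc ℓ) h os)))
        (≡.cong (level _ _) h⊥))

results-hom : ∀ {h : Subset m → Subset n} → IsUnionHom h →
  ∀ s (ls : Levels j m) → Vec.map h (results s ls) ≡ results (h s) (mapLevels h ls)
results-hom {h = h} h∪ s ls = ≡.cong (h s ∷_)
  (≡.trans (≡.sym (Vec.map-∘ h best ls)) (≡.trans (Vec.map-cong (λ l → h∪ _ _) ls) (Vec.map-∘ best (mapLevel h) ls)))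

restart-hom : ∀ (h : Subset m → Subset n) r (os : Vec (Subset m) (suc j)) →
  Vec.map h (restart r os) ≡ restart r (Vec.map h os)
restart-hom {j = j} h true  os = ≡.trans (Vec.map-replicate h _ (suc j)) (≡.cong (Vec.replicate (suc j)) (≡.sym (Vec.lookup-map (Fin.fromℕ j) h os)))
restart-hom h false os = ≡.refl

cand⊑cands : ∀ (ls : Levels j m) ℓ → cand (lookup ls ℓ) ⊑ cands ls
cand⊑cands (l ∷ ls) zero    = ⊑-∪ˡ (cands ls) (Subset.∪-idem (cand l))
cand⊑cands (l ∷ ls) (suc ℓ) = ⊑-∪ʳ (cand l) (cand⊑cands ls ℓ)

-- Competition between candidate solutions.

module Updating (ℛ : Reals) where
  open OrderedField ℛ using (Carrier; _≤?_; _≤_)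

  -- Takes two values in place of `f`, because the strategy has only the oracle's answers to
  -- compare.
  choose : Carrier → Carrier → Subset m → Level m → Level m
  choose u v x l = if does (v ≤? u) then l else level (prev l) (prev l) x

  update : (Subset m → Carrier) → Subset m → Level m → Level m
  update f x l = choose (f (best l)) (f (trial l x)) x l

  updates : (Subset m → Carrier) → List (Subset m) → Levels j m → Levels j m
  updates f []       ls = ls
  updates f (x ∷ xs) ls = updates f xs (Vec.map (update f x) ls)

  update-hom : ∀ {h : Subset m → Subset n} → IsUnionHom h → ∀ f x l →
    mapLevel h (update (f ∘ h) x l) ≡ update f (h x) (mapLevel h l)
  update-hom {h = h} h∪ f x l = ≡.trans (push (f (h (best l))) (f (h (trial l x))))
    (≡.cong₂ (λ u v → choose (f u) (f v) (h x) (mapLevel h l)) (h∪ _ _) (h∪ _ _))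
    where
    push : ∀ u v → mapLevel h (choose u v x l) ≡ choose u v (h x) (mapLevel h l)
    push u v with does (v ≤? u)
    ... | true  = ≡.refl
    ... | false = ≡.refl

  map-update-hom : ∀ {h : Subset m → Subset n} → IsUnionHom h → ∀ f x (ls : Levels j m) →
    mapLevels h (Vec.map (update (f ∘ h) x) ls) ≡ Vec.map (update f (h x)) (mapLevels h ls)
  map-update-hom {h = h} h∪ f x ls = ≡.trans (≡.sym (Vec.map-∘ (mapLevel h) _ ls))
    (≡.trans (Vec.map-cong (update-hom h∪ f x) ls) (Vec.map-∘ _ (mapLevel h) ls))

  updates-hom : ∀ {h : Subset m → Subset n} → IsUnionHom h → ∀ f xs (ls : Levels j m) →
    mapLevels h (updates (f ∘ h) xs ls) ≡ updates f (List.map h xs) (mapLevels h ls)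
  updates-hom h∪ f []       ls = ≡.refl
  updates-hom {h = h} h∪ f (x ∷ xs) ls =
    ≡.trans (updates-hom h∪ f xs _) (≡.cong (updates f (List.map h xs)) (map-update-hom h∪ f x ls))

  ∈-cands-update : ∀ f x (ls : Levels j m) {y} → y ∈ₛ cands (Vec.map (update f x) ls) → y ∈ₛ cands ls ⊎ y ∈ₛ x
  ∈-cands-update f x []       y∈ = inj₁ y∈
  ∈-cands-update f x (l ∷ ls) y∈ with does (f (trial l x) ≤? f (best l)) | Subset.x∈p∪q⁻ (cand (update f x l)) _ y∈
  ... | true  | inj₁ y∈l = inj₁ (Subset.x∈p∪q⁺ (inj₁ y∈l))
  ... | false | inj₁ y∈x = inj₂ y∈x
  ... | _     | inj₂ y∈ls with ∈-cands-update f x ls y∈ls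
  ... | inj₁ y∈ = inj₁ (Subset.x∈p∪q⁺ (inj₂ y∈))
  ... | inj₂ y∈ = inj₂ y∈

  ∈-cands-updates : ∀ f xs (ls : Levels j m) {y S} → All (_⊆ S) xs → y ∈ₛ cands (updates f xs ls) → y ∈ₛ cands ls ⊎ y ∈ₛ S
  ∈-cands-updates f []       ls []         y∈ = inj₁ y∈
  ∈-cands-updates f (x ∷ xs) ls (x⊆ ∷ xs⊆) y∈ with ∈-cands-updates f xs _ xs⊆ y∈
  ... | inj₂ y∈S = inj₂ y∈S
  ... | inj₁ y∈′ with ∈-cands-update f x ls y∈′
  ... | inj₁ y∈ls = inj₁ y∈ls
  ... | inj₂ y∈x  = inj₂ (x⊆ y∈x)

  -- Containment in `hs` guarantees that compaction to `hs` and the candidates loses no solution.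
  -- The cardinalities bound the memory by one candidate per level and the solution at level ℓ by ℓ
  -- additions.
  record WellFormed (hs : Subset m) (a : ℕ) (l : Level m) : Set where
    constructor wf
    field
      prev⊑hs : prev l ⊑ hs
      base⊑hs : base l ⊑ hs
      ∣cand∣≤ : ∣ cand l ∣ ℕ.≤ 1
      ∣prev∣≤ : ∣ prev l ∣ ℕ.≤ a
      ∣best∣≤ : ∣ best l ∣ ℕ.≤ suc a

  WellFormedLevels : Subset m → ℕ → Levels j m → Set
  WellFormedLevels hs a ls = ∀ ℓ → WellFormed hs (a ℕ.+ toℕ ℓ) (lookup ls ℓ)

  update-wf : ∀ {hs : Subset m} {a l} f x → ∣ x ∣ ℕ.≤ 1 → WellFormed hs a l → WellFormed hs a (update f x l)
  update-wf {l = l} f x ∣x∣≤1 w@(wf p _ _ a _) with does (f (trial l x) ≤? f (best l))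
  ... | true  = w
  ... | false = wf p p ∣x∣≤1 a (ℕ.≤-trans (∣p∪q∣≤∣p∣+∣q∣ (prev l) x)
                  (ℕ.≤-trans (ℕ.+-mono-≤ a ∣x∣≤1) (ℕ.≤-reflexive (ℕ.+-comm _ 1))))

  updates-wf : ∀ {hs : Subset m} {a} f xs (ls : Levels j m) → All (λ x → ∣ x ∣ ℕ.≤ 1) xs →
    WellFormedLevels hs a ls → WellFormedLevels hs a (updates f xs ls)
  updates-wf f []       ls []         w = w
  updates-wf f (x ∷ xs) ls (x≤ ∷ xs≤) w = updates-wf f xs _ xs≤ λ ℓ →
    ≡.subst (WellFormed _ _) (≡.sym (Vec.lookup-map ℓ (update f x) ls)) (update-wf f x x≤ (w ℓ))

  mapLevels-wf : ∀ {φ : Subset m → Subset n} → IsUnionHom φ → (∀ q → ∣ φ q ∣ ℕ.≤ ∣ q ∣) →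
    ∀ {hs a} (ls : Levels j m) → WellFormedLevels hs a ls → WellFormedLevels (φ hs) a (mapLevels φ ls)
  mapLevels-wf {φ = φ} φ∪ φ≤ ls w ℓ rewrite Vec.lookup-map ℓ (mapLevel φ) ls with w ℓ
  ... | wf p b c a d = wf (≡.trans (≡.sym (φ∪ _ _)) (≡.cong φ p)) (≡.trans (≡.sym (φ∪ _ _)) (≡.cong φ b))
    (ℕ.≤-trans (φ≤ _) c) (ℕ.≤-trans (φ≤ _) a)
    (ℕ.≤-trans (ℕ.≤-reflexive (≡.cong ∣_∣ (≡.sym (φ∪ _ _)))) (ℕ.≤-trans (φ≤ _) d))

  ∣cands∣≤ : ∀ {hs : Subset m} {a : ℕ → ℕ} (ls : Levels j m) → (∀ ℓ → WellFormed hs (a (toℕ ℓ)) (lookup ls ℓ)) → ∣ cands ls ∣ ℕ.≤ j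
  ∣cands∣≤ {m = m} [] w = ℕ.≤-reflexive (Subset.∣⊥∣≡0 m)
  ∣cands∣≤ {a = a} (l ∷ ls) w = ℕ.≤-trans (∣p∪q∣≤∣p∣+∣q∣ (cand l) _)
    (ℕ.+-mono-≤ (WellFormed.∣cand∣≤ (w zero)) (∣cands∣≤ {a = a ∘ suc} ls (w ∘ suc)))

-- The streaming strategy and its simulation in terms of items.

numCloses : Schedule t → ℕ
numCloses done       = 0
numCloses (item sc)  = numCloses sc
numCloses (close sc) = suc (numCloses sc)

numCloses-insertItem : ∀ l (sc : Schedule t) → numCloses (insertItem l sc) ≡ numCloses sc
numCloses-insertItem zero    sc         = ≡.refl
numCloses-insertItem (suc l) done       = ≡.refl
numCloses-insertItem (suc l) (item sc)  = numCloses-insertItem (suc l) sc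
numCloses-insertItem (suc l) (close sc) = ≡.cong suc (numCloses-insertItem l sc)

numCloses-schedule : ∀ {W} (s : Vec (Fin W) n) → numCloses (schedule s) ≡ W
numCloses-schedule {W = W} [] = go W
  where
  go : ∀ W → numCloses (closes W) ≡ W
  go zero    = ≡.refl
  go (suc W) = ≡.cong suc (go W)
numCloses-schedule (l ∷ s) = ≡.trans (numCloses-insertItem (toℕ l) (schedule s)) (numCloses-schedule s)

elements : Subset m → List (Fin m)
elements p = Vec.toList (select p (Vec.allFin _))

-- The algorithm keeps one candidate solution for each of the levels 0, …, μ;
-- `ends i` says that window i is the last one of its group.
module Greedy (ℛ : Reals) (η k μ : ℕ) (ends : ℕ → Bool) where
  open Streaming ℛ using (Strategy; query; keep; receive; output; run)
  open OrderedField ℛ using (Carrier)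
  open Updating ℛ

  -- Bounds the size of the solution from which the group of window i starts; only completed groups
  -- count.
  spent : ℕ → ℕ
  spent zero    = 0
  spent (suc i) = if ends i then spent i ℕ.+ μ else spent i

  module Strategies (0<η : 0 ℕ.< η) where
    -- Ends legally from any situation, with empty output and no queries. It fills the branches that
    -- the simulation invariants exclude, and it is the whole algorithm when k is below the
    -- threshold.
    dump : Strategy η k t m
    dump {zero}  {m} = output ⊥ (≡.subst (ℕ._≤ k) (≡.sym (Subset.∣⊥∣≡0 m)) ℕ.z≤n)
    dump {suc t} {m} = keep ⊥ (receive (≡.subst (ℕ._< η) (≡.sym (Subset.∣⊥∣≡0 m)) 0<η) dump)

    -- Continuation-passing, because the resulting levels depend on oracle answers that exist only
    -- further down the decision tree.
    consider : Subset m → Levels j m → (Levels j m → Strategy η k t m) → Strategy η k t m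
    consider x []       K = K []
    consider x (l ∷ ls) K = query (best l) λ u → query (trial l x) λ v →
      consider x ls λ ls′ → K (choose u v x l ∷ ls′)

    considerAll : List (Subset m) → Levels j m → (Levels j m → Strategy η k t m) → Strategy η k t m
    considerAll []       ls K = K ls
    considerAll (x ∷ xs) ls K = consider x ls λ ls′ → considerAll xs ls′ K

    newResults : ℕ → (p : Subset m) → Subset m → Levels μ m → Vec (Subset ∣ p ∣) (suc μ)
    newResults i p s₀ ls = restart (ends i) (results (select p s₀) (mapLevels (select p) ls))

    strategy : Schedule t → ℕ → Subset m → Subset m → Levels μ m → Strategy η k t m
    strategy done i hs s₀ ls with ∣ s₀ ∣ ℕ.≤? k
    ... | yes ∣s₀∣≤k = output s₀ ∣s₀∣≤k
    ... | no _       = dump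
    strategy {m = m} (item sc) i hs s₀ ls with m ℕ.<? η
    ... | no _    = dump
    ... | yes m<η = receive m<η (consider ⁅ zero ⁆ (mapLevels (outside ∷_) ls) λ ls′ →
          -- All but the stored items and the current candidates is discarded after every arrival,
          -- so an open window occupies at most μ further slots.
          let p = (outside ∷ hs) ∪ cands ls′ in
          keep p (strategy sc i (select p (outside ∷ hs)) (select p (outside ∷ s₀)) (mapLevels (select p) ls′)))
    -- The candidate `⊥` lets L_ℓ itself compete for L_(ℓ+1), so that no level ends below the
    -- preceding one as it stood at the start of the window.
    strategy (close sc) i hs s₀ ls = considerAll (⊥ ∷ List.map ⁅_⁆ (elements hs)) ls λ ls′ →
      let p = hs ∪ cands ls′ ; os = newResults i p s₀ ls′ in
      -- Whatever survives the close counts as stored from now on, hence `⊤`.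
      keep p (strategy sc (suc i) ⊤ (Vec.head os) (levels os))

    module _ (f : Subset n → Carrier) where
      at : Vec (Fin n) m → Subset m → Carrier
      at b p = f (items p b)

      run-consider : ∀ x (ls : Levels j m) (K : Levels j m → Strategy η k t m) xs b →
        run f (consider x ls K) xs b ≡ map₂ (2 ℕ.* j ℕ.+_) (run f (K (Vec.map (update (at b) x) ls)) xs b)
      run-consider x [] K xs b = ≡.refl
      run-consider {j = suc j} x (l ∷ ls) K xs b = ≡.trans
        (≡.cong (map₂ (λ q → suc (suc q))) (run-consider x ls _ xs b))
        (≡.cong (λ c → proj₁ R , c ℕ.+ proj₂ R) (≡.sym (ℕ.*-suc 2 j)))
        where R = run f (K (Vec.map (update (at b) x) (l ∷ ls))) xs b

      run-considerAll : ∀ ys (ls : Levels j m) (K : Levels j m → Strategy η k t m) xs b →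
        run f (considerAll ys ls K) xs b ≡ map₂ (length ys ℕ.* (2 ℕ.* j) ℕ.+_) (run f (K (updates (at b) ys ls)) xs b)
      run-considerAll [] ls K xs b = ≡.refl
      run-considerAll {j = j} (y ∷ ys) ls K xs b = ≡.trans (run-consider y ls _ xs b)
        (≡.trans (≡.cong (map₂ (2 ℕ.* j ℕ.+_)) (run-considerAll ys _ K xs b))
               (≡.cong (proj₁ R ,_) (≡.sym (ℕ.+-assoc (2 ℕ.* j) _ _))))
        where R = run f (K (updates (at b) (y ∷ ys) ls)) xs b

  -- The behaviour of the algorithm in terms of items: `stored` lists the buffer
  -- at the start of the window, `seen` the items of the window, latest first.
  module Semantics (f : Subset n → Carrier) where
    closeLevels : List (Fin n) → Levels μ n → Levels μ n
    closeLevels stored = updates f (⊥ ∷ List.map ⁅_⁆ stored)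

    stays : List (Fin n) → Levels μ n → Subset n
    stays stored ls = setOf stored ∪ cands ls

    closeStored : List (Fin n) → Levels μ n → List (Fin n) → List (Fin n)
    closeStored stored ls seen = filter (_∈? stays stored ls) (seen ++ stored)

    closeResults : ℕ → Subset n → Levels μ n → Vec (Subset n) (suc μ)
    closeResults i s₀ ls = restart (ends i) (results s₀ ls)

    semantics : Schedule t → ℕ → List (Fin n) → Subset n → Levels μ n → List (Fin n) → Vec (Fin n) t → Subset n
    semantics done       i stored s₀ ls seen []       = s₀
    semantics (item sc)  i stored s₀ ls seen (x ∷ xs) =
      semantics sc i stored s₀ (Vec.map (update f ⁅ x ⁆) ls) (x ∷ seen) xs
    semantics (close sc) i stored s₀ ls seen xs =
      let ls′ = closeLevels stored ls ; os = closeResults i s₀ ls′ in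
      semantics sc (suc i) (closeStored stored ls′ seen) (Vec.head os) (levels os) [] xs

  module Simulation (f : Subset n → Carrier) (0<η : 0 ℕ.< η) (W : ℕ) (buffer-size : W ℕ.* μ ℕ.+ μ ℕ.< η) (affordable : spent W ℕ.≤ k) where
    open Strategies 0<η
    open Semantics f

    -- `buffer≡` recovers the buffer, in its order, from the past items and a set of items; the
    -- distinctness fields make this possible. The size fields rule out the `dump` branches of the
    -- strategy.
    record Simulates (i : ℕ) (hs s₀ : Subset m) (ls : Levels μ m) (b : Vec (Fin n) m) (xs : Vec (Fin n) t)
                     (stored : List (Fin n)) (s₀′ : Subset n) (ls′ : Levels μ n) (seen : List (Fin n)) : Set where
      field
        stored≡  : stored ≡ Vec.toList (select hs b)
        s₀≡      : items s₀ b ≡ s₀′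
        ls≡      : mapLevels (λ p → items p b) ls ≡ ls′
        buffer≡  : Vec.toList b ≡ filter (_∈? stays stored ls′) (seen ++ stored)
        past!    : Unique (seen ++ stored)
        future!  : Unique (Vec.toList xs)
        disjoint : ∀ {y} → y ∈ seen ++ stored → y ∉ Vec.toList xs
        s₀⊑hs    : s₀ ⊑ hs
        levels-wf : WellFormedLevels hs (spent i) ls
        ∣s₀∣≤    : ∣ s₀ ∣ ℕ.≤ spent i
        ∣hs∣≤    : ∣ hs ∣ ℕ.≤ i ℕ.* μ
        m≤       : m ℕ.≤ i ℕ.* μ ℕ.+ μ

    -- A candidate costs two queries on each of the μ levels. An arrival brings one candidate, a
    -- close brings `⊥` and at most W μ stored items.
    budget : ℕ → ℕ → ℕ
    budget t c = t ℕ.* (2 ℕ.* μ) ℕ.+ c ℕ.* ((1 ℕ.+ W ℕ.* μ) ℕ.* (2 ℕ.* μ))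

    map-update-wf : ∀ {hs : Subset m} {a} g x (ls : Levels j m) → ∣ x ∣ ℕ.≤ 1 → WellFormedLevels hs a ls →
      WellFormedLevels hs a (Vec.map (update g x) ls)
    map-update-wf g x ls x≤1 = updates-wf g (x ∷ []) ls (x≤1 ∷ [])

    module Keep (hs : Subset m) (ls : Levels μ m) (b : Vec (Fin n) m) (a : ℕ) (ls-wf : WellFormedLevels hs a ls) where
      p : Subset m
      p = hs ∪ cands ls

      hs⊑p : hs ⊑ p
      hs⊑p = ⊑-∪ˡ (cands ls) (Subset.∪-idem hs)

      ∣p∣≤ : ∣ p ∣ ℕ.≤ ∣ hs ∣ ℕ.+ μ
      ∣p∣≤ = ℕ.≤-trans (∣p∪q∣≤∣p∣+∣q∣ hs (cands ls)) (ℕ.+-monoʳ-≤ ∣ hs ∣ (∣cands∣≤ {a = a ℕ.+_} ls ls-wf))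

      mapLevels-kept : mapLevels (λ q → items q (select p b)) (mapLevels (select p) ls) ≡ mapLevels (λ q → items q b) ls
      mapLevels-kept = ≡.trans (≡.sym (Vec.map-∘ _ _ ls)) (lookup-ext _ _ λ ℓ →
        ≡.trans (Vec.lookup-map ℓ _ ls) (≡.trans (kept ℓ) (≡.sym (Vec.lookup-map ℓ _ ls))))
        where
        kept : ∀ ℓ → mapLevel (λ q → items q (select p b)) (mapLevel (select p) (lookup ls ℓ))
                     ≡ mapLevel (λ q → items q b) (lookup ls ℓ)
        kept ℓ = ≡.trans
          (≡.cong₂ (λ x y → level x y (items (select p (cand (lookup ls ℓ))) (select p b))) (items-select p _ b (⊑-∪ˡ _ (WellFormed.prev⊑hs (ls-wf ℓ))))
                                       (items-select p _ b (⊑-∪ˡ _ (WellFormed.base⊑hs (ls-wf ℓ)))))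
          (≡.cong (level _ _) (items-select p _ b (⊑-∪ʳ hs (cand⊑cands ls ℓ))))

      kept-wf : WellFormedLevels (select p hs) a (mapLevels (select p) ls)
      kept-wf = mapLevels-wf (select-∪ p) (∣select∣≤ p) ls ls-wf

      kept-buffer : ∀ stored ls′ → items hs b ≡ setOf stored → mapLevels (λ q → items q b) ls ≡ ls′ → Unique (Vec.toList b) →
        Vec.toList (select p b) ≡ filter (_∈? stays stored ls′) (Vec.toList b)
      kept-buffer stored ls′ hs≡ ls≡ b! = ≡.trans (toList-select-filter p b b!)
        (≡.cong (λ S → filter (_∈? S) (Vec.toList b))
          (≡.trans (items-∪ hs (cands ls) b)
            (≡.cong₂ _∪_ hs≡ (≡.trans (cands-hom (items-⊥ b) (λ q r → items-∪ q r b) ls) (≡.cong cands ls≡)))))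

    ∣results∣≤ : ∀ {s₀ hs : Subset m} {a} (ls : Levels j m) → ∣ s₀ ∣ ℕ.≤ a → WellFormedLevels hs a ls →
      ∀ ℓ → ∣ lookup (results s₀ ls) ℓ ∣ ℕ.≤ a ℕ.+ toℕ ℓ
    ∣results∣≤ ls s₀≤ w zero    = ℕ.≤-trans s₀≤ (ℕ.m≤m+n _ 0)
    ∣results∣≤ {a = a} ls s₀≤ w (suc ℓ) = ℕ.≤-trans (ℕ.≤-reflexive (≡.cong ∣_∣ (Vec.lookup-map ℓ best ls)))
      (ℕ.≤-trans (WellFormed.∣best∣≤ (w ℓ)) (ℕ.≤-reflexive (≡.sym (ℕ.+-suc a (toℕ ℓ)))))

    ∣restart∣≤ : ∀ i (os : Vec (Subset m) (suc μ)) → (∀ ℓ → ∣ lookup os ℓ ∣ ℕ.≤ spent i ℕ.+ toℕ ℓ) →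
      ∀ ℓ → ∣ lookup (restart (ends i) os) ℓ ∣ ℕ.≤ spent (suc i) ℕ.+ toℕ ℓ
    ∣restart∣≤ i os os≤ ℓ with ends i
    ... | false = os≤ ℓ
    ... | true  = ℕ.≤-trans (ℕ.≤-reflexive (≡.cong ∣_∣ (Vec.lookup-replicate ℓ (lookup os (Fin.fromℕ μ)))))
      (ℕ.≤-trans (os≤ (Fin.fromℕ μ)) (ℕ.≤-trans (ℕ.≤-reflexive (≡.cong (spent i ℕ.+_) (Fin.toℕ-fromℕ μ))) (ℕ.m≤m+n _ (toℕ ℓ))))

    levels-wf⁺ : ∀ {a} (os : Vec (Subset m) (suc j)) → (∀ ℓ → ∣ lookup os ℓ ∣ ℕ.≤ a ℕ.+ toℕ ℓ) → WellFormedLevels ⊤ a (levels os)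
    levels-wf⁺ {m = m} {a = a} os os≤ ℓ rewrite Vec.lookup∘tabulate (λ ℓ → level (lookup os (inject₁ ℓ)) (lookup os (suc ℓ)) ⊥) ℓ =
      wf (Subset.∪-zeroʳ _) (Subset.∪-zeroʳ _) (ℕ.≤-trans (ℕ.≤-reflexive (Subset.∣⊥∣≡0 m)) ℕ.z≤n)
        (≡.subst (λ i → ∣ lookup os (inject₁ ℓ) ∣ ℕ.≤ a ℕ.+ i) (Fin.toℕ-inject₁ ℓ) (os≤ (inject₁ ℓ)))
        (ℕ.≤-trans (ℕ.≤-reflexive (≡.cong ∣_∣ (Subset.∪-identityʳ (lookup os (suc ℓ)))))
          (ℕ.≤-trans (os≤ (suc ℓ)) (ℕ.≤-reflexive (ℕ.+-suc a (toℕ ℓ)))))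

    head≤ : ∀ {a} (os : Vec (Subset m) (suc j)) → (∀ ℓ → ∣ lookup os ℓ ∣ ℕ.≤ a ℕ.+ toℕ ℓ) → ∣ Vec.head os ∣ ℕ.≤ a
    head≤ {a = a} (o ∷ os) os≤ = ℕ.≤-trans (os≤ zero) (ℕ.≤-reflexive (ℕ.+-identityʳ a))

    head-map : ∀ (g : A → B) (os : Vec A (suc j)) → g (Vec.head os) ≡ Vec.head (Vec.map g os)
    head-map g (o ∷ os) = ≡.refl

    filter-∷-filter : ∀ {P Q : A → Set} (P? : ∀ x → Dec (P x)) (Q? : ∀ x → Dec (Q x)) x xs →
      (∀ {y} → y ∈ xs → P y → Q y) → filter P? (x ∷ filter Q? xs) ≡ filter P? (x ∷ xs)
    filter-∷-filter P? Q? x xs P⇒Q with P? x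
    ... | yes _ = ≡.cong (x ∷_) (filter-filter P? Q? xs P⇒Q)
    ... | no _  = filter-filter P? Q? xs P⇒Q

    module _ {hs s₀ : Subset m} {b : Vec (Fin n) m} {xs : Vec (Fin n) t} {i} {ls : Levels μ m} {stored s₀′ ls′ seen}
             (sim : Simulates i hs s₀ ls b xs stored s₀′ ls′ seen) where
      open Simulates sim

      hs-items : items hs b ≡ setOf stored
      hs-items = ≡.cong setOf (≡.sym stored≡)

      buffer! : Unique (Vec.toList b)
      buffer! = ≡.subst Unique (≡.sym buffer≡) (Unique.filter⁺ (_∈? stays stored ls′) past!)

    simulates-item : ∀ {hs s₀ : Subset m} {b x} {xs : Vec (Fin n) t} {i ls stored s₀′ ls′ seen} →
      Simulates i hs s₀ ls b (x ∷ xs) stored s₀′ ls′ seen →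
      let ls₁ = Vec.map (update (at f (x ∷ b)) ⁅ zero ⁆) (mapLevels (outside ∷_) ls)
          p = (outside ∷ hs) ∪ cands ls₁ in
      Simulates i (select p (outside ∷ hs)) (select p (outside ∷ s₀)) (mapLevels (select p) ls₁) (select p (x ∷ b)) xs
        stored s₀′ (Vec.map (update f ⁅ x ⁆) ls′) (x ∷ seen)
    simulates-item {m = m} {hs = hs} {s₀} {b} {x} {xs} {i} {ls} {stored} {s₀′} {ls′} {seen} sim = record
      { stored≡ = ≡.trans stored≡ (≡.sym (toList-select-select p (outside ∷ hs) (x ∷ b) hs⊑p))
      ; s₀≡ = ≡.trans (items-select p (outside ∷ s₀) (x ∷ b) (⊑-∪ˡ (cands ls₁) s₀⊑)) s₀≡
      ; ls≡ = ≡.trans mapLevels-kept ls₁≡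
      ; buffer≡ = ≡.trans (kept-buffer stored ls₁′ (hs-items sim) ls₁≡ (x∉b ∷ buffer! sim))
          (≡.trans (≡.cong (λ ys → filter (_∈? stays stored ls₁′) (x ∷ ys)) buffer≡)
                 (filter-∷-filter (_∈? stays stored ls₁′) (_∈? stays stored ls′) x (seen ++ stored) still))
      ; past! = All.¬Any⇒All¬ _ x∉past ∷ past!
      ; future! = tail future!
      ; disjoint = λ { (here ≡.refl) x∈ → All.lookup (head future!) x∈ ≡.refl
                     ; (there y∈) y∈xs → disjoint y∈ (there y∈xs) }
      ; s₀⊑hs = ≡.trans (≡.sym (select-∪ p _ _)) (≡.cong (select p) s₀⊑)
      ; levels-wf = kept-wf
      ; ∣s₀∣≤ = ℕ.≤-trans (∣select∣≤ p (outside ∷ s₀)) ∣s₀∣≤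
      ; ∣hs∣≤ = ℕ.≤-trans (∣select∣≤ p (outside ∷ hs)) ∣hs∣≤
      ; m≤ = ℕ.≤-trans ∣p∣≤ (ℕ.+-monoˡ-≤ μ ∣hs∣≤)
      }
      where
      open Simulates sim
      open AllPairs using (head; tail)
      h = λ q → items q (x ∷ b)
      ls₁ = Vec.map (update (at f (x ∷ b)) ⁅ zero ⁆) (mapLevels (outside ∷_) ls)
      ls₁′ = Vec.map (update f ⁅ x ⁆) ls′
      s₀⊑ : (outside ∷ s₀) ⊑ (outside ∷ hs)
      s₀⊑ = ≡.cong (outside ∷_) s₀⊑hs
      ls₁-wf : WellFormedLevels (outside ∷ hs) (spent i) ls₁
      ls₁-wf = map-update-wf (at f (x ∷ b)) ⁅ zero ⁆ (mapLevels (outside ∷_) ls) (ℕ.≤-reflexive (Subset.∣⁅x⁆∣≡1 {suc m} zero))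
        (mapLevels-wf {φ = outside ∷_} (λ _ _ → ≡.refl) (λ _ → ℕ.≤-refl) ls levels-wf)
      open Keep (outside ∷ hs) ls₁ (x ∷ b) (spent i) ls₁-wf
      ls₁≡ : mapLevels h ls₁ ≡ ls₁′
      ls₁≡ = ≡.trans (map-update-hom (λ q r → items-∪ q r (x ∷ b)) f ⁅ zero ⁆ _)
        (≡.cong₂ (λ y l → Vec.map (update f y) l) (items-⁅⁆ (x ∷ b) zero) (≡.trans (≡.sym (Vec.map-∘ _ _ ls)) ls≡))
      x∉past : x ∉ seen ++ stored
      x∉past x∈ = disjoint x∈ (here ≡.refl)
      x∉b : All (x ≢_) (Vec.toList b)
      x∉b = All.¬Any⇒All¬ _ λ x∈b → x∉past (proj₁ (∈-filter⁻ (_∈? stays stored ls′) (≡.subst (x ∈_) buffer≡ x∈b)))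
      -- Only x can enter the candidates, so a past item that stays now stayed before as well.
      -- Discarding is therefore final, and filtering the old buffer gives the same list as
      -- filtering the whole past.
      still : ∀ {y} → y ∈ seen ++ stored → y ∈ₛ stays stored ls₁′ → y ∈ₛ stays stored ls′
      still y∈ y∈′ with Subset.x∈p∪q⁻ (setOf stored) _ y∈′
      ... | inj₁ y∈S = Subset.x∈p∪q⁺ (inj₁ y∈S)
      ... | inj₂ y∈c with ∈-cands-update f ⁅ x ⁆ ls′ y∈c
      ... | inj₁ y∈c′ = Subset.x∈p∪q⁺ (inj₂ y∈c′)
      ... | inj₂ y∈x = contradiction (≡.subst (_∈ seen ++ stored) (Subset.x∈⁅y⁆⇒x≡y x y∈x) y∈) x∉past

    simulates-close : ∀ {hs s₀ : Subset m} {b} {xs : Vec (Fin n) t} {i ls stored s₀′ ls′ seen} →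
      Simulates i hs s₀ ls b xs stored s₀′ ls′ seen →
      let ls₁ = updates (at f b) (⊥ ∷ List.map ⁅_⁆ (elements hs)) ls
          p = hs ∪ cands ls₁
          os = newResults i p s₀ ls₁
          ls₁′ = closeLevels stored ls′
          os′ = closeResults i s₀′ ls₁′ in
      Simulates (suc i) ⊤ (Vec.head os) (levels os) (select p b) xs
        (closeStored stored ls₁′ seen) (Vec.head os′) (levels os′) []
    simulates-close {m = m} {hs = hs} {s₀} {b} {xs} {i} {ls} {stored} {s₀′} {ls′} {seen} sim = record
      { stored≡ = ≡.sym (≡.trans (toList-select-⊤ (select p b)) b′≡)
      ; s₀≡ = ≡.trans (head-map h′ os) (≡.cong Vec.head os≡)
      ; ls≡ = ≡.trans (levels-hom (items-⊥ (select p b)) os) (≡.cong levels os≡)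
      ; buffer≡ = ≡.trans b′≡ (≡.sym (List.filter-all (_∈? stays stored₁ (levels os′))
          (All.tabulate (λ y∈ → Subset.x∈p∪q⁺ (inj₁ (∈-setOf⁺ y∈))))))
      ; past! = Unique.filter⁺ (_∈? stays stored ls₁′) past!
      ; future! = future!
      ; disjoint = λ y∈ → disjoint (proj₁ (∈-filter⁻ (_∈? stays stored ls₁′) y∈))
      ; s₀⊑hs = Subset.∪-zeroʳ _
      ; levels-wf = levels-wf⁺ os os≤
      ; ∣s₀∣≤ = head≤ os os≤
      ; ∣hs∣≤ = ℕ.≤-trans (ℕ.≤-reflexive (Subset.∣⊤∣≡n ∣ p ∣)) ∣p∣≤′
      ; m≤ = ℕ.≤-trans ∣p∣≤′ (ℕ.m≤m+n _ μ)
      }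
      where
      open Simulates sim
      h  = λ q → items q b
      cs = ⊥ ∷ List.map ⁅_⁆ (elements hs)
      ls₁  = updates (at f b) cs ls
      ls₁′ = closeLevels stored ls′
      os′ = closeResults i s₀′ ls₁′
      stored₁ = closeStored stored ls₁′ seen
      cs≤ : All (λ c → ∣ c ∣ ℕ.≤ 1) cs
      cs≤ = ℕ.≤-trans (ℕ.≤-reflexive (Subset.∣⊥∣≡0 m)) ℕ.z≤n
        ∷ All.map⁺ (All.tabulate (λ {y} _ → ℕ.≤-reflexive (Subset.∣⁅x⁆∣≡1 y)))
      ls₁-wf : WellFormedLevels hs (spent i) ls₁
      ls₁-wf = updates-wf (at f b) cs ls cs≤ levels-wf
      open Keep hs ls₁ b (spent i) ls₁-wf
      h′ = λ q → items q (select p b)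
      os = newResults i p s₀ ls₁
      cs≡ : List.map h cs ≡ ⊥ ∷ List.map ⁅_⁆ stored
      cs≡ = ≡.cong₂ _∷_ (items-⊥ b) (≡.trans (≡.sym (List.map-∘ (elements hs)))
        (≡.trans (List.map-cong (items-⁅⁆ b) (elements hs))
        (≡.trans (List.map-∘ (elements hs))
        (≡.cong (List.map ⁅_⁆) (≡.trans (≡.sym (select-map (lookup b) hs (Vec.allFin m)))
          (≡.trans (≡.cong (λ v → Vec.toList (select hs v)) (Vec.map-lookup-allFin b)) (≡.sym stored≡)))))))
      ls₁≡ : mapLevels h ls₁ ≡ ls₁′
      ls₁≡ = ≡.trans (updates-hom (λ q r → items-∪ q r b) f cs ls) (≡.cong₂ (updates f) cs≡ ls≡)
      os≡ : Vec.map h′ os ≡ os′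
      os≡ = ≡.trans (restart-hom h′ (ends i) (results (select p s₀) (mapLevels (select p) ls₁)))
        (≡.cong (restart (ends i)) (≡.trans (results-hom (λ q r → items-∪ q r (select p b)) (select p s₀) (mapLevels (select p) ls₁))
          (≡.cong₂ results (≡.trans (items-select p s₀ b (⊑-∪ˡ _ s₀⊑hs)) s₀≡) (≡.trans mapLevels-kept ls₁≡))))
      cs⊆ : All (_⊆ setOf stored) (⊥ ∷ List.map ⁅_⁆ stored)
      cs⊆ = Subset.⊆-min (setOf stored) ∷ All.map⁺ (All.tabulate λ {y} y∈ z∈ →
        ≡.subst (_∈ₛ setOf stored) (≡.sym (Subset.x∈⁅y⁆⇒x≡y y z∈)) (∈-setOf⁺ y∈))
      still : ∀ {y} → y ∈ seen ++ stored → y ∈ₛ stays stored ls₁′ → y ∈ₛ stays stored ls′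
      still y∈ y∈′ with Subset.x∈p∪q⁻ (setOf stored) _ y∈′
      ... | inj₁ y∈S = Subset.x∈p∪q⁺ (inj₁ y∈S)
      ... | inj₂ y∈c with ∈-cands-updates f _ ls′ cs⊆ y∈c
      ... | inj₁ y∈c′ = Subset.x∈p∪q⁺ (inj₂ y∈c′)
      ... | inj₂ y∈S  = Subset.x∈p∪q⁺ (inj₁ y∈S)
      b′≡ : Vec.toList (select p b) ≡ stored₁
      b′≡ = ≡.trans (kept-buffer stored ls₁′ (hs-items sim) ls₁≡ (buffer! sim))
        (≡.trans (≡.cong (filter (_∈? stays stored ls₁′)) buffer≡)
               (filter-filter (_∈? stays stored ls₁′) (_∈? stays stored ls′) (seen ++ stored) still))
      os≤ : ∀ ℓ → ∣ lookup os ℓ ∣ ℕ.≤ spent (suc i) ℕ.+ toℕ ℓ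
      os≤ = ∣restart∣≤ i _ (∣results∣≤ _ (ℕ.≤-trans (∣select∣≤ p s₀) ∣s₀∣≤) kept-wf)
      ∣p∣≤′ : ∣ p ∣ ℕ.≤ suc i ℕ.* μ
      ∣p∣≤′ = ℕ.≤-trans ∣p∣≤ (ℕ.≤-trans (ℕ.+-monoˡ-≤ μ ∣hs∣≤) (ℕ.≤-reflexive (ℕ.+-comm (i ℕ.* μ) μ)))

    elements-length : ∀ (hs : Subset m) → length (elements hs) ≡ ∣ hs ∣
    elements-length hs = Vec.length-toList (select hs (Vec.allFin _))

    simulation : ∀ (sc : Schedule t) {hs s₀ : Subset m} {b} {xs : Vec (Fin n) t} {i ls stored s₀′ ls′ seen} →
      Simulates i hs s₀ ls b xs stored s₀′ ls′ seen → i ℕ.+ numCloses sc ≡ W →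
      let S , q = run f (strategy sc i hs s₀ ls) xs b in
      S ≡ semantics sc i stored s₀′ ls′ seen xs × q ℕ.≤ budget t (numCloses sc)
    simulation done {s₀ = s₀} {xs = []} {i = i} sim i≡W with ∣ s₀ ∣ ℕ.≤? k
    ... | yes _ = Simulates.s₀≡ sim , ℕ.z≤n
    ... | no ¬≤ = contradiction (ℕ.≤-trans (Simulates.∣s₀∣≤ sim)
      (≡.subst (λ w → spent w ℕ.≤ k) (≡.trans (≡.sym i≡W) (ℕ.+-identityʳ i)) affordable)) ¬≤
    simulation {t = suc t} {m = m} (item sc) {hs} {s₀} {b} {xs = x ∷ xs} {i} {ls} sim i≡W with m ℕ.<? η
    ... | no m≮η = contradiction (ℕ.≤-<-trans (ℕ.≤-trans (Simulates.m≤ sim)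
      (ℕ.+-monoˡ-≤ μ (ℕ.*-monoˡ-≤ μ (≡.subst (i ℕ.≤_) i≡W (ℕ.m≤m+n i _))))) buffer-size) m≮η
    ... | yes m<η rewrite run-consider f ⁅ zero ⁆ (mapLevels (outside ∷_) ls)
             (λ ls′ → let p = (outside ∷ hs) ∪ cands ls′ in
               keep p (strategy sc i (select p (outside ∷ hs)) (select p (outside ∷ s₀)) (mapLevels (select p) ls′)))
             xs (x ∷ b) =
      let S≡ , q≤ = simulation sc (simulates-item sim) i≡W in
      S≡ , ℕ.≤-trans (ℕ.+-monoʳ-≤ (2 ℕ.* μ) q≤) (ℕ.≤-reflexive (≡.sym (ℕ.+-assoc (2 ℕ.* μ) _ _)))
    simulation {t = t} {m = m} (close sc) {hs} {s₀} {b} {xs} {i} {ls} sim i≡W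
      rewrite run-considerAll f (⊥ ∷ List.map ⁅_⁆ (elements hs)) ls
             (λ ls′ → let p = hs ∪ cands ls′ ; os = newResults i p s₀ ls′ in
               keep p (strategy sc (suc i) ⊤ (Vec.head os) (levels os))) xs b =
      let S≡ , q≤ = simulation sc (simulates-close sim) (≡.trans (≡.sym (ℕ.+-suc i _)) i≡W) in
      S≡ , ℕ.≤-trans (ℕ.+-mono-≤ cost q≤) (ℕ.≤-reflexive (lemma ((1 ℕ.+ W ℕ.* μ) ℕ.* (2 ℕ.* μ)) (t ℕ.* (2 ℕ.* μ)) (numCloses sc ℕ.* ((1 ℕ.+ W ℕ.* μ) ℕ.* (2 ℕ.* μ)))))
      where
      open +-*-Solver
      lemma : ∀ a b c → a ℕ.+ (b ℕ.+ c) ≡ b ℕ.+ (a ℕ.+ c)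
      lemma = solve 3 (λ a b c → a :+ (b :+ c) := b :+ (a :+ c)) ≡.refl
      cost : length (⊥ ∷ List.map ⁅_⁆ (elements hs)) ℕ.* (2 ℕ.* μ) ℕ.≤ (1 ℕ.+ W ℕ.* μ) ℕ.* (2 ℕ.* μ)
      cost = ℕ.*-monoˡ-≤ (2 ℕ.* μ) (ℕ.s≤s (ℕ.≤-trans
        (ℕ.≤-reflexive (≡.trans (List.length-map ⁅_⁆ (elements hs)) (elements-length hs)))
        (ℕ.≤-trans (Simulates.∣hs∣≤ sim) (ℕ.*-monoˡ-≤ μ (≡.subst (i ℕ.≤_) i≡W (ℕ.m≤m+n i _))))))

    simulates-start : ∀ {xs : Vec (Fin n) t} → Unique (Vec.toList xs) →
      Simulates 0 ⊥ ⊥ (levels (Vec.replicate (suc μ) ⊥)) [] xs [] ⊥ (levels (Vec.replicate (suc μ) ⊥)) []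
    simulates-start xs! = record
      { stored≡ = ≡.refl ; s₀≡ = ≡.refl
      ; ls≡ = ≡.trans (levels-hom ≡.refl (Vec.replicate (suc μ) ⊥)) (≡.cong levels (Vec.map-replicate (λ p → items p []) ⊥ (suc μ)))
      ; buffer≡ = ≡.refl ; past! = [] ; future! = xs! ; disjoint = λ ()
      ; s₀⊑hs = ≡.refl
      ; levels-wf = levels-wf⁺ (Vec.replicate (suc μ) ⊥)
          (λ ℓ → ℕ.≤-trans (ℕ.≤-reflexive (≡.cong ∣_∣ (Vec.lookup-replicate ℓ (⊥ {0})))) ℕ.z≤n)
      ; ∣s₀∣≤ = ℕ.z≤n ; ∣hs∣≤ = ℕ.z≤n ; m≤ = ℕ.z≤n }

-- Windows as functions of the labels, and removal of an item from them.

data Deletion {A : Set} (x : A) : List A → List A → Set where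
  []   : Deletion x [] []
  _∷_  : ∀ y {w w′} → Deletion x w w′ → Deletion x (y ∷ w) (y ∷ w′)
  drop : ∀ {w w′} → Deletion x w w′ → Deletion x (x ∷ w) w′

deletion-refl : ∀ {x : A} w → Deletion x w w
deletion-refl []      = []
deletion-refl (y ∷ w) = y ∷ deletion-refl w

deletion-ʳ++ : ∀ {x : A} {w w′ v v′} → Deletion x w w′ → Deletion x v v′ → Deletion x (w ʳ++ v) (w′ ʳ++ v′)
deletion-ʳ++ []       e = e
deletion-ʳ++ (y ∷ d)  e = deletion-ʳ++ d (y ∷ e)
deletion-ʳ++ (drop d) e = deletion-ʳ++ d (drop e)

deletion-++ : ∀ {x : A} {w w′} v → Deletion x w w′ → Deletion x (w ++ v) (w′ ++ v)
deletion-++ v []       = deletion-refl v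
deletion-++ v (y ∷ d)  = y ∷ deletion-++ v d
deletion-++ v (drop d) = drop (deletion-++ v d)

deletion-filter : ∀ {P : A → Set} (P? : ∀ y → Dec (P y)) {x w w′} → ¬ P x → Deletion x w w′ → filter P? w ≡ filter P? w′
deletion-filter P? ¬Px [] = ≡.refl
deletion-filter P? ¬Px (y ∷ d) with P? y
... | yes _ = ≡.cong (y ∷_) (deletion-filter P? ¬Px d)
... | no _  = deletion-filter P? ¬Px d
deletion-filter P? ¬Px (drop d) = ≡.trans (List.filter-reject P? ¬Px) (deletion-filter P? ¬Px d)

deletion-∈ : ∀ {x : A} {w w′} → Deletion x w w′ → w ≡ w′ ⊎ x ∈ w
deletion-∈ []       = inj₁ ≡.refl
deletion-∈ (y ∷ d)  with deletion-∈ d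
... | inj₁ ≡.refl = inj₁ ≡.refl
... | inj₂ x∈w  = inj₂ (there x∈w)
deletion-∈ (drop d) = inj₂ (here ≡.refl)

window : ∀ {W} → Vec (Fin W) n → Vec A n → ℕ → List A
window []      []       i = []
window (l ∷ s) (x ∷ xs) i = if does (toℕ l ℕ.≟ i) then x ∷ window s xs i else window s xs i

Agrees : (ℕ → List A) → ℕ → List (List A) → Set
Agrees b i []       = Unit
Agrees b i (w ∷ ws) = b i ≡ w × Agrees b (suc i) ws

agrees-cong : ∀ {b b′ : ℕ → List A} {i} ws → (∀ j → i ℕ.≤ j → b j ≡ b′ j) → Agrees b i ws → Agrees b′ i ws
agrees-cong []       eq _         = tt
agrees-cong (w ∷ ws) eq (bi , bs) =
  ≡.trans (≡.sym (eq _ ℕ.≤-refl)) bi , agrees-cong ws (λ j i<j → eq j (ℕ.<⇒≤ i<j)) bs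

if-≡ : ∀ {a b} {x y : A} → a ≡ b → (if does (a ℕ.≟ b) then x else y) ≡ x
if-≡ {a = a} {b} {x} {y} a≡b = ≡.cong (λ t → if t then x else y) (dec-true (a ℕ.≟ b) a≡b)

if-≢ : ∀ {a b} {x y : A} → a ≢ b → (if does (a ℕ.≟ b) then x else y) ≡ y
if-≢ {a = a} {b} {x} {y} a≢b = ≡.cong (λ t → if t then x else y) (dec-false (a ℕ.≟ b) a≢b)

agrees-addAt : ∀ l (x : A) b i ws → Agrees b i ws →
  Agrees (λ j → if does (l ℕ.+ i ℕ.≟ j) then x ∷ b j else b j) i (addAt l x ws)
agrees-addAt l       x b i []       _         = tt
agrees-addAt zero    x b i (w ∷ ws) (≡.refl , bs) =
  if-≡ {a = i} ≡.refl , agrees-cong ws (λ j i<j → ≡.sym (if-≢ (ℕ.<⇒≢ i<j))) bs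
agrees-addAt (suc l) x b i (w ∷ ws) (bi , bs) =
  ≡.trans (if-≢ (λ eq → ℕ.<⇒≢ (ℕ.s≤s (ℕ.m≤n+m i l)) (≡.sym eq))) bi ,
  agrees-cong (addAt l x ws) (λ j _ → ≡.cong (λ a → if does (a ℕ.≟ j) then x ∷ b j else b j) (ℕ.+-suc l i))
    (agrees-addAt l x b (suc i) ws bs)

window-agrees : ∀ {W} (s : Vec (Fin W) n) (xs : Vec A n) → Agrees (window s xs) 0 (bins s xs)
window-agrees {A = A} {W = W} [] [] = go 0 W
  where
  go : ∀ i W → Agrees {A} (λ _ → []) i (List.replicate W [])
  go i zero    = tt
  go i (suc W) = ≡.refl , go (suc i) W
window-agrees (l ∷ s) (x ∷ xs) = agrees-cong (addAt (toℕ l) x (bins s xs))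
  (λ j _ → ≡.cong (λ a → if does (a ℕ.≟ j) then x ∷ window s xs j else window s xs j) (ℕ.+-identityʳ (toℕ l)))
  (agrees-addAt (toℕ l) x (window s xs) 0 (bins s xs) (window-agrees s xs))

length-bins : ∀ {W} (s : Vec (Fin W) n) (xs : Vec A n) → length (bins s xs) ≡ W
length-bins {W = W} []      []       = List.length-replicate W
length-bins         (l ∷ s) (x ∷ xs) = ≡.trans (go (toℕ l) (bins s xs)) (length-bins s xs)
  where
  go : ∀ l ws → length (addAt l x ws) ≡ length ws
  go l       []       = ≡.refl
  go zero    (w ∷ ws) = ≡.refl
  go (suc l) (w ∷ ws) = ≡.cong suc (go l ws)

-- Only the window that held position j loses its item, the others stay as they are; `Deletion`
-- permits zero removals in order to cover both cases.
window-relabel : ∀ {W} (s : Vec (Fin W) n) (xs : Vec A n) j l {i} → toℕ l ≢ i →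
  Deletion (lookup xs j) (window s xs i) (window (s [ j ]≔ l) xs i)
window-relabel (l₀ ∷ s) (x ∷ xs) zero l {i} l≢i rewrite dec-false (toℕ l ℕ.≟ i) l≢i with does (toℕ l₀ ℕ.≟ i)
... | true  = drop (deletion-refl _)
... | false = deletion-refl _
window-relabel (l₀ ∷ s) (x ∷ xs) (suc j) l {i} l≢i with does (toℕ l₀ ℕ.≟ i)
... | true  = x ∷ window-relabel s xs j l l≢i
... | false = window-relabel s xs j l l≢i

∈-window : ∀ {W} (s : Vec (Fin W) n) (xs : Vec A n) j → lookup xs j ∈ window s xs (toℕ (lookup s j))
∈-window (l ∷ s) (x ∷ xs) zero = ≡.subst (x ∈_) (≡.sym (if-≡ {a = toℕ l} ≡.refl)) (here ≡.refl)
∈-window (l ∷ s) (x ∷ xs) (suc j) with does (toℕ l ℕ.≟ toℕ (lookup s j))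
... | true  = there (∈-window s xs j)
... | false = ∈-window s xs j

-- States between windows and their insensitivity to discarded items.

module Windows (ℛ : Reals) (η k μ : ℕ) (ends : ℕ → Bool) {n : ℕ} (f : Subset n → Reals.Carrier ℛ) where
  open OrderedField ℛ using (Carrier; _≤_; _≤?_; ≤-refl; ≤-trans; total; ≤-reflexive)
  module F = OrderedField ℛ
  open Updating ℛ
  open Greedy ℛ η k μ ends
  open Semantics f

  updateLevel : List (Subset n) → Level n → Level n
  updateLevel []       l = l
  updateLevel (x ∷ xs) l = updateLevel xs (update f x l)

  lookup-updates : ∀ xs (ls : Levels j n) ℓ → lookup (updates f xs ls) ℓ ≡ updateLevel xs (lookup ls ℓ)
  lookup-updates []       ls ℓ = ≡.refl
  lookup-updates (x ∷ xs) ls ℓ = ≡.trans (lookup-updates xs _ ℓ) (≡.cong (updateLevel xs) (Vec.lookup-map ℓ (update f x) ls))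

  updates-++ : ∀ xs ys (ls : Levels j n) → updates f (xs ++ ys) ls ≡ updates f ys (updates f xs ls)
  updates-++ []       ys ls = ≡.refl
  updates-++ (x ∷ xs) ys ls = updates-++ xs ys _

  prev-update : ∀ x l → prev (update f x l) ≡ prev l
  prev-update x l with does (f (trial l x) ≤? f (best l))
  ... | true  = ≡.refl
  ... | false = ≡.refl

  ≰⇒≥ : ∀ {x y} → ¬ x ≤ y → y ≤ x
  ≰⇒≥ {x} {y} x≰y = [ (λ x≤y → contradiction x≤y x≰y) , id ]′ (total x y)

  best≤update : ∀ x l → f (best l) ≤ f (best (update f x l))
  best≤update x l with f (trial l x) ≤? f (best l)
  ... | yes _ = ≤-refl
  ... | no ≰  = ≰⇒≥ ≰

  trial≤update : ∀ x l → f (trial l x) ≤ f (best (update f x l))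
  trial≤update x l with f (trial l x) ≤? f (best l)
  ... | yes v≤u = v≤u
  ... | no _  = ≤-refl

  best≤updateLevel : ∀ xs l → f (best l) ≤ f (best (updateLevel xs l))
  best≤updateLevel []       l = ≤-refl
  best≤updateLevel (x ∷ xs) l = ≤-trans (best≤update x l) (best≤updateLevel xs _)

  trial≤updateLevel : ∀ {x xs} l → x ∈ xs → f (trial l x) ≤ f (best (updateLevel xs l))
  trial≤updateLevel {x} {_ ∷ xs} l (here ≡.refl) = ≤-trans (trial≤update x l) (best≤updateLevel xs _)
  trial≤updateLevel {x} {y ∷ xs} l (there x∈)  = ≤-trans
    (≤-reflexive (F.reflexive (≡.cong (λ p → f (p ∪ x)) (≡.sym (prev-update y l))))) (trial≤updateLevel (update f y l) x∈)

  record State : Set where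
    constructor state
    field
      stored  : List (Fin n)
      solutions : Vec (Subset n) (suc μ)

  open State

  windowLevels : State → List (Fin n) → Levels μ n
  windowLevels T w = closeLevels (stored T) (updates f (List.map ⁅_⁆ w) (levels (solutions T)))

  newSolutions : State → List (Fin n) → Vec (Subset n) (suc μ)
  newSolutions T w = results (Vec.head (solutions T)) (windowLevels T w)

  step : ℕ → State → List (Fin n) → State
  step i T w = state (closeStored (stored T) (windowLevels T w) (w ʳ++ [])) (restart (ends i) (newSolutions T w))

  initial : State
  initial = state [] (Vec.replicate (suc μ) ⊥)

  stateAt : ℕ → (ℕ → List (Fin n)) → State
  stateAt zero    b = initial
  stateAt (suc i) b = step i (stateAt i b) (b i)

  runFrom : ℕ → State → List (List (Fin n)) → Subset n
  runFrom i T []       = Vec.head (solutions T)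
  runFrom i T (w ∷ ws) = runFrom (suc i) (step i T w) ws

  -- The run taken up in the middle of a window, `seen` being the part already processed. Induction
  -- over a schedule passes through such points, since single arrivals and closes are separate
  -- constructors.
  resume : ℕ → List (Fin n) → Subset n → Levels μ n → List (Fin n) → List (List (Fin n)) → Subset n
  resume i stored s₀ ls seen []       = s₀
  resume i stored s₀ ls seen (w ∷ ws) =
    let ls′ = closeLevels stored (updates f (List.map ⁅_⁆ w) ls) in
    runFrom (suc i) (state (closeStored stored ls′ (w ʳ++ seen)) (closeResults i s₀ ls′)) ws

  resume-fresh : ∀ i T ws → resume i (stored T) (Vec.head (solutions T)) (levels (solutions T)) [] ws ≡ runFrom i T ws
  resume-fresh i T []       = ≡.refl
  resume-fresh i T (w ∷ ws) = ≡.refl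

  semantics≡resume : ∀ (sc : Schedule t) i stored s₀ ls seen xs →
    semantics sc i stored s₀ ls seen xs ≡ resume i stored s₀ ls seen (windows sc xs)
  semantics≡resume done       i stored s₀ ls seen []       = ≡.refl
  semantics≡resume (item sc)  i stored s₀ ls seen (x ∷ xs)
    rewrite semantics≡resume sc i stored s₀ (Vec.map (update f ⁅ x ⁆) ls) (x ∷ seen) xs with windows sc xs
  ... | []     = ≡.refl
  ... | w ∷ ws = ≡.refl
  semantics≡resume (close sc) i stored s₀ ls seen xs =
    ≡.trans (semantics≡resume sc (suc i) _ _ _ [] xs) (resume-fresh (suc i) (state _ _) (windows sc xs))

  runFrom≡stateAt : ∀ b i ws → Agrees b i ws → runFrom i (stateAt i b) ws ≡ Vec.head (solutions (stateAt (length ws ℕ.+ i) b))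
  runFrom≡stateAt b i []       _           = ≡.refl
  runFrom≡stateAt b i (w ∷ ws) (≡.refl , bs) = ≡.trans (runFrom≡stateAt b (suc i) ws bs)
    (≡.cong (λ j → Vec.head (solutions (stateAt j b))) (ℕ.+-suc (length ws) i))

  semantics-schedule : ∀ {W} (s : Vec (Fin W) t) (xs : Vec (Fin n) t) →
    semantics (schedule s) 0 [] ⊥ (levels (Vec.replicate (suc μ) ⊥)) [] (arrange s xs)
      ≡ Vec.head (solutions (stateAt W (window s xs)))
  semantics-schedule {W = W} s xs = begin
    semantics (schedule s) 0 [] ⊥ _ [] (arrange s xs)  ≡⟨ semantics≡resume (schedule s) 0 [] ⊥ _ [] (arrange s xs) ⟩
    resume 0 [] ⊥ _ [] (windows (schedule s) (arrange s xs)) ≡⟨ resume-fresh 0 initial (windows (schedule s) (arrange s xs)) ⟩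
    runFrom 0 initial (windows (schedule s) (arrange s xs)) ≡⟨ ≡.cong (runFrom 0 initial) (windows-schedule s xs) ⟩
    runFrom 0 initial (bins s xs) ≡⟨ runFrom≡stateAt (window s xs) 0 (bins s xs) (window-agrees s xs) ⟩
    Vec.head (solutions (stateAt (length (bins s xs) ℕ.+ 0) (window s xs)))
      ≡⟨ ≡.cong (λ j → Vec.head (solutions (stateAt j (window s xs)))) (≡.trans (ℕ.+-identityʳ _) (length-bins s xs)) ⟩
    Vec.head (solutions (stateAt W (window s xs))) ∎
    where open ≡-Reasoning

  -- Either deleting x has not changed the level, or x is the current candidate
  -- and dominates what the level would hold without it.
  Shadowed : Fin n → Level n → Level n → Set
  Shadowed x l l′ = l ≡ l′ ⊎ (cand l ≡ ⁅ x ⁆ × prev l ≡ prev l′ × f (best l′) ≤ f (best l))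

  shadowed-≤ : ∀ {x l l′} → Shadowed x l l′ → f (best l′) ≤ f (best l)
  shadowed-≤ (inj₁ ≡.refl)        = ≤-refl
  shadowed-≤ (inj₂ (_ , _ , l′≤l)) = l′≤l

  shadowed-prev : ∀ {x l l′} → Shadowed x l l′ → prev l ≡ prev l′
  shadowed-prev (inj₁ ≡.refl)        = ≡.refl
  shadowed-prev (inj₂ (_ , p≡ , _)) = p≡

  -- A competitor that beats the better level also beats the worse one, and then both levels become
  -- equal. Otherwise the level holding x stays, and the other ends below it whether or not it
  -- accepts the competitor.
  shadowed-update : ∀ {x l l′} c → Shadowed x l l′ → Shadowed x (update f c l) (update f c l′)
  shadowed-update c (inj₁ ≡.refl) = inj₁ ≡.refl
  shadowed-update {x} {level p b ._} {level .p b′ c′} c (inj₂ (≡.refl , ≡.refl , l′≤l))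
    with f (p ∪ c) ≤? f (b ∪ ⁅ x ⁆) | f (p ∪ c) ≤? f (b′ ∪ c′)
  ... | yes _ | yes _  = inj₂ (≡.refl , ≡.refl , l′≤l)
  ... | yes v≤u | no _ = inj₂ (≡.refl , ≡.refl , v≤u)
  ... | no ≰  | yes v≤u′ = contradiction (≤-trans v≤u′ l′≤l) ≰
  ... | no _  | no _   = inj₁ ≡.refl

  shadowed-drop : ∀ {x l l′} → Shadowed x l l′ → Shadowed x (update f ⁅ x ⁆ l) l′
  shadowed-drop {x} {l} {l′} sh with f (trial l ⁅ x ⁆) ≤? f (best l)
  ... | yes _ = sh
  ... | no ≰  = inj₂ (≡.refl , shadowed-prev sh , ≤-trans (shadowed-≤ sh) (≰⇒≥ ≰))

  shadowed-updateLevel : ∀ {x l l′} xs → Shadowed x l l′ → Shadowed x (updateLevel xs l) (updateLevel xs l′)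
  shadowed-updateLevel []       sh = sh
  shadowed-updateLevel (c ∷ xs) sh = shadowed-updateLevel xs (shadowed-update c sh)

  shadowed-deletion : ∀ {x l l′ w w′} → Deletion x w w′ → Shadowed x l l′ →
    Shadowed x (updateLevel (List.map ⁅_⁆ w) l) (updateLevel (List.map ⁅_⁆ w′) l′)
  shadowed-deletion []       sh = sh
  shadowed-deletion (y ∷ d)  sh = shadowed-deletion d (shadowed-update ⁅ y ⁆ sh)
  shadowed-deletion (drop d) sh = shadowed-deletion d (shadowed-drop sh)

  candidateSets : State → List (Fin n) → List (Subset n)
  candidateSets T w = List.map ⁅_⁆ w ++ ⊥ ∷ List.map ⁅_⁆ (stored T)

  lookup-windowLevels : ∀ T w ℓ → lookup (windowLevels T w) ℓ ≡ updateLevel (candidateSets T w) (lookup (levels (solutions T)) ℓ)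
  lookup-windowLevels T w ℓ = ≡.trans (≡.cong (λ ls → lookup ls ℓ) (≡.sym (updates-++ (List.map ⁅_⁆ w) _ _)))
    (lookup-updates (candidateSets T w) (levels (solutions T)) ℓ)

  updateLevel-++ : ∀ xs ys l → updateLevel (xs ++ ys) l ≡ updateLevel ys (updateLevel xs l)
  updateLevel-++ []       ys l = ≡.refl
  updateLevel-++ (x ∷ xs) ys l = updateLevel-++ xs ys _

  shadowed-windowLevels : ∀ T {x w w′} → Deletion x w w′ → ∀ ℓ → Shadowed x (lookup (windowLevels T w) ℓ) (lookup (windowLevels T w′) ℓ)
  shadowed-windowLevels T {x} {w} {w′} d ℓ = ≡.subst₂ (Shadowed x)
    (≡.sym (≡.trans (lookup-windowLevels T w ℓ) (updateLevel-++ (List.map ⁅_⁆ w) _ _)))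
    (≡.sym (≡.trans (lookup-windowLevels T w′ ℓ) (updateLevel-++ (List.map ⁅_⁆ w′) _ _)))
    (shadowed-updateLevel (⊥ ∷ List.map ⁅_⁆ (stored T)) (shadowed-deletion d (inj₁ ≡.refl)))

  ∈-cands : ∀ {x} (ls : Levels j n) ℓ → x ∈ₛ cand (lookup ls ℓ) → x ∈ₛ cands ls
  ∈-cands (l ∷ ls) zero    x∈ = Subset.x∈p∪q⁺ (inj₁ x∈)
  ∈-cands (l ∷ ls) (suc ℓ) x∈ = Subset.x∈p∪q⁺ (inj₂ (∈-cands ls ℓ x∈))

  stored-step : ∀ i T w {x} → x ∈ stored T → x ∈ stored (step i T w)
  stored-step i T w x∈ = ∈-filter⁺ (_∈? stays (stored T) (windowLevels T w)) (∈-++⁺ʳ (w ʳ++ []) x∈)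
    (Subset.x∈p∪q⁺ (inj₁ (∈-setOf⁺ x∈)))

  ∈-ʳ++ : ∀ {x : Fin n} w v → x ∈ w ⊎ x ∈ v → x ∈ w ʳ++ v
  ∈-ʳ++ []      v (inj₂ x∈v)         = x∈v
  ∈-ʳ++ (y ∷ w) v (inj₁ (here x≡y))  = ∈-ʳ++ w (y ∷ v) (inj₂ (here x≡y))
  ∈-ʳ++ (y ∷ w) v (inj₁ (there x∈w)) = ∈-ʳ++ w (y ∷ v) (inj₁ x∈w)
  ∈-ʳ++ (y ∷ w) v (inj₂ x∈v)         = ∈-ʳ++ w (y ∷ v) (inj₂ (there x∈v))

  -- An item that is not stored after the close is no level's candidate there, which leaves only
  -- equality in `Shadowed`. The stored lists agree as well, because the filter removes x anyway.
  step-deletion : ∀ i T {x w w′} → Deletion x w w′ → x ∉ stored (step i T w) → step i T w′ ≡ step i T w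
  step-deletion i T {x} {w} {w′} d x∉ with deletion-∈ d
  ... | inj₁ ≡.refl = ≡.refl
  ... | inj₂ x∈w = ≡.cong₂ state
    (≡.trans (≡.cong (λ ls → closeStored (stored T) ls (w′ ʳ++ [])) (≡.sym ls≡))
           (≡.sym (deletion-filter (_∈? stays (stored T) (windowLevels T w)) x∉stays
             (deletion-++ (stored T) (deletion-ʳ++ d [])))))
    (≡.cong (λ ls → restart (ends i) (results (Vec.head (solutions T)) ls)) (≡.sym ls≡))
    where
    x∉stays : x ∉ₛ stays (stored T) (windowLevels T w)
    x∉stays x∈ = x∉ (∈-filter⁺ (_∈? stays (stored T) (windowLevels T w)) (∈-++⁺ˡ (∈-ʳ++ w [] (inj₁ x∈w))) x∈)
    ls≡ : windowLevels T w ≡ windowLevels T w′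
    ls≡ = lookup-ext _ _ λ ℓ → [ id , (λ (c≡ , _) → contradiction
      (Subset.x∈p∪q⁺ (inj₂ (∈-cands (windowLevels T w) ℓ (≡.subst (x ∈ₛ_) (≡.sym c≡) (Subset.x∈⁅x⁆ x))))) x∉stays) ]′
      (shadowed-windowLevels T d ℓ)

  -- Stored items stay stored, so an item absent before window i was absent after every earlier
  -- window and `step-deletion` applies to each of them.
  stateAt-deletion : ∀ i {x b b′} → (∀ j → j ℕ.< i → Deletion x (b j) (b′ j)) → x ∉ stored (stateAt i b) →
    stateAt i b′ ≡ stateAt i b
  stateAt-deletion zero    d x∉ = ≡.refl
  stateAt-deletion (suc i) {x} {b} {b′} d x∉ = ≡.trans
    (≡.cong (λ T → step i T (b′ i)) (stateAt-deletion i (λ j j<i → d j (ℕ.m<n⇒m<1+n j<i)) (x∉ ∘ stored-step i (stateAt i b) (b i))))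
    (step-deletion i (stateAt i b) (d i ℕ.≤-refl) x∉)

  newSolutions-improve : ∀ T w ℓ → f (lookup (solutions T) (suc ℓ)) ≤ f (lookup (newSolutions T w) (suc ℓ))
  newSolutions-improve T w ℓ = ≡.subst₂ (λ p q → f p ≤ f q)
    (≡.trans (≡.cong best (Vec.lookup∘tabulate _ ℓ)) (Subset.∪-identityʳ _))
    (≡.sym (≡.trans (Vec.lookup-map ℓ best (windowLevels T w)) (≡.cong best (lookup-windowLevels T w ℓ))))
    (best≤updateLevel (candidateSets T w) (lookup (levels (solutions T)) ℓ))

  newSolutions-trial : ∀ T w ℓ {c} → c ∈ candidateSets T w →
    f (lookup (solutions T) (inject₁ ℓ) ∪ c) ≤ f (lookup (newSolutions T w) (suc ℓ))
  newSolutions-trial T w ℓ {c} c∈ = ≡.subst₂ (λ p q → f p ≤ f q)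
    (≡.cong (λ l → trial l c) (Vec.lookup∘tabulate _ ℓ))
    (≡.sym (≡.trans (Vec.lookup-map ℓ best (windowLevels T w)) (≡.cong best (lookup-windowLevels T w ℓ))))
    (trial≤updateLevel (lookup (levels (solutions T)) ℓ) c∈)

-- Uniform labels and resampling.

labelings : ∀ W n → List (Vec (Fin W) n)
labelings W zero    = [] ∷ []
labelings W (suc n) = concatMap (λ l → List.map (l ∷_) (labelings W n)) (allFin W)

module Labelings (ℛ : Reals) where
  open OrderedField ℛ
  open Sums ℛ
  open import Relation.Binary.Reasoning.Setoid setoid

  ∑-allFin-suc : ∀ W (F : Fin (suc W) → Carrier) → ∑ (allFin (suc W)) F ≈ F zero + ∑ (allFin W) (F ∘ suc)
  ∑-allFin-suc W F = +-congˡ (trans (reflexive (≡.cong (λ xs → ∑ xs F) (≡.sym (List.map-tabulate id suc))))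
    (∑-map F suc (allFin W)))

  ∑-allFin-single : ∀ {W} (i : Fin W) (R : Fin W → Carrier) →
    ∑ (allFin W) (λ l → if does (l Fin.≟ i) then R l else 0#) ≈ R i
  ∑-allFin-single {suc W} zero R = trans (∑-allFin-suc W _)
    (trans (+-congˡ (∑-zero (allFin W))) (+-identityʳ _))
  ∑-allFin-single {suc W} (suc i) R = trans (∑-allFin-suc W _)
    (trans (+-identityˡ _) (∑-allFin-single i (R ∘ suc)))

  ∑-labelings-suc : ∀ {W} (F : Vec (Fin W) (suc n) → Carrier) →
    ∑ (labelings W (suc n)) F ≈ ∑ (allFin W) (λ l → ∑ (labelings W n) (λ s → F (l ∷ s)))
  ∑-labelings-suc {n = n} {W} F = trans (∑-concatMap F _ (allFin W))
    (∑-cong (allFin W) (λ l → ∑-map F (l ∷_) (labelings W n)))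

  ∑-if : ∀ b (F : A → Carrier) xs → ∑ xs (λ x → if b then F x else 0#) ≈ (if b then ∑ xs F else 0#)
  ∑-if true  F xs = refl
  ∑-if false F xs = ∑-zero xs

  -- Overwriting label j by i maps exactly W labelings onto each labeling that has i at j;
  -- conditioning on the label and overwriting it have the same effect.
  ∑-relabel : ∀ {W} (Ψ : Vec (Fin W) n → Carrier) j i →
    fromℕ W * ∑ (labelings W n) (λ s → if does (lookup s j Fin.≟ i) then Ψ s else 0#) ≈ ∑ (labelings W n) (λ s → Ψ (s [ j ]≔ i))
  ∑-relabel {n = suc n} {W} Ψ zero i = begin
    fromℕ W * ∑ (labelings W (suc n)) _
      ≈⟨ *-congˡ (∑-labelings-suc (λ s → if does (lookup s zero Fin.≟ i) then Ψ s else 0#)) ⟩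
    fromℕ W * ∑ (allFin W) (λ l → ∑ (labelings W n) (λ s → if does (l Fin.≟ i) then Ψ (l ∷ s) else 0#))
      ≈⟨ *-congˡ (∑-cong (allFin W) (λ l → ∑-if (does (l Fin.≟ i)) (λ s → Ψ (l ∷ s)) (labelings W n))) ⟩
    fromℕ W * ∑ (allFin W) (λ l → if does (l Fin.≟ i) then ∑ (labelings W n) (λ s → Ψ (l ∷ s)) else 0#)
      ≈⟨ *-congˡ (∑-allFin-single i _) ⟩
    fromℕ W * ∑ (labelings W n) (λ s → Ψ (i ∷ s))
      ≈⟨ *-congʳ (reflexive (≡.cong fromℕ (List.length-tabulate {n = W} id))) ⟨
    fromℕ (length (allFin W)) * ∑ (labelings W n) (λ s → Ψ (i ∷ s))
      ≈⟨ ∑-const _ (allFin W) ⟨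
    ∑ (allFin W) (λ l → ∑ (labelings W n) (λ s → Ψ (i ∷ s)))
      ≈⟨ ∑-labelings-suc (λ s → Ψ (s [ zero ]≔ i)) ⟨
    ∑ (labelings W (suc n)) (λ s → Ψ (s [ zero ]≔ i)) ∎
  ∑-relabel {n = suc n} {W} Ψ (suc j) i = begin
    fromℕ W * ∑ (labelings W (suc n)) _
      ≈⟨ *-congˡ (∑-labelings-suc (λ s → if does (lookup s (suc j) Fin.≟ i) then Ψ s else 0#)) ⟩
    fromℕ W * ∑ (allFin W) (λ l → ∑ (labelings W n) (λ s → if does (lookup s j Fin.≟ i) then Ψ (l ∷ s) else 0#))
      ≈⟨ ∑-*ˡ (fromℕ W) _ (allFin W) ⟨
    ∑ (allFin W) (λ l → fromℕ W * ∑ (labelings W n) (λ s → if does (lookup s j Fin.≟ i) then Ψ (l ∷ s) else 0#))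
      ≈⟨ ∑-cong (allFin W) (λ l → ∑-relabel (λ s → Ψ (l ∷ s)) j i) ⟩
    ∑ (allFin W) (λ l → ∑ (labelings W n) (λ s → Ψ (l ∷ (s [ j ]≔ i))))
      ≈⟨ ∑-labelings-suc (λ s → Ψ (s [ (suc j) ]≔ i)) ⟨
    ∑ (labelings W (suc n)) (λ s → Ψ (s [ suc j ]≔ i)) ∎

  module Resampling (W n : ℕ) (q : Carrier) (q-inverse : fromℕ W * q ≈ 1#) (0≤q : 0# ≤ q) (q≤1 : q ≤ 1#) where
    ∑ₛ : (Vec (Fin W) n → Carrier) → Carrier
    ∑ₛ = ∑ (labelings W n)

    -- Outside `In` nothing changes when position j is moved to window i, so there
    -- the label of j is conditionally uniform over a set of windows containing i.
    resample : ∀ j i {In : Vec (Fin W) n → Set} (In? : ∀ s → Dec (In s)) (X₀ X₁ : Vec (Fin W) n → Carrier) →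
      (∀ s → X₀ s ≤ X₁ s) →
      (∀ s → ¬ In s → ¬ In (s [ j ]≔ i) × X₀ (s [ j ]≔ i) ≈ X₀ s × X₁ (s [ j ]≔ i) ≈ X₁ s) →
      q * ∑ₛ X₁ + (1# - q) * ∑ₛ X₀ ≤ ∑ₛ (λ s → if does (In? s) ∨ does (lookup s j Fin.≟ i) then X₁ s else X₀ s)
    resample j i {In} In? X₀ X₁ X₀≤X₁ stable = ≤-trans (≤-reflexive lhs) (≤-trans middle (≤-trans (≤-reflexive rhs) (∑-mono (labelings W n) available)))
      where
      -- The increment from X₀ to X₁ is split along `In`: `gained` is certain, `missed` needs the
      -- label of j to be i, and `hit` is the part of `missed` obtained in this way.
      D gained missed hit : Vec (Fin W) n → Carrier
      D s = X₁ s - X₀ s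
      0≤D : ∀ s → 0# ≤ D s
      0≤D s = x≤y⇒0≤y-x (X₀≤X₁ s)
      gained s = if does (In? s) then D s else 0#
      missed s = if does (In? s) then 0# else D s
      hit s = if does (lookup s j Fin.≟ i) then missed s else 0#

      0≤gained : ∀ s → 0# ≤ gained s
      0≤gained s with does (In? s)
      ... | true  = 0≤D s
      ... | false = ≤-refl

      -- Inside `In` the left side is 0; outside, stability keeps both the membership and the
      -- increment.
      missed-mono : ∀ s → missed s ≤ missed (s [ j ]≔ i)
      missed-mono s with In? s
      ... | yes _ = 0≤missed (s [ j ]≔ i)
        where
        0≤missed : ∀ s → 0# ≤ missed s
        0≤missed s with does (In? s)
        ... | true  = ≤-refl
        ... | false = 0≤D s
      ... | no ¬In with stable s ¬In
      ... | ¬In′ , X₀≈ , X₁≈ with In? (s [ j ]≔ i)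
      ... | yes In′ = contradiction In′ ¬In′
      ... | no _    = ≤-reflexive (+-cong (sym X₁≈) (-‿cong (sym X₀≈)))

      X₁-split : ∀ s → X₁ s ≈ X₀ s + (gained s + missed s)
      X₁-split s with does (In? s)
      ... | true  = solve 2 (λ x y → y := x :+ ((y :- x) :+ con (ℤ.+ 0))) refl (X₀ s) (X₁ s)
      ... | false = solve 2 (λ x y → y := x :+ (con (ℤ.+ 0) :+ (y :- x))) refl (X₀ s) (X₁ s)

      lhs : q * ∑ₛ X₁ + (1# - q) * ∑ₛ X₀ ≈ ∑ₛ X₀ + (q * ∑ₛ gained + q * ∑ₛ missed)
      lhs = trans (+-congʳ (*-congˡ (trans (∑-cong (labelings W n) X₁-split)
        (trans (∑-+ X₀ _ (labelings W n)) (+-congˡ (∑-+ gained missed (labelings W n)))))))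
        (solve 4 (λ q x a b → q :* (x :+ (a :+ b)) :+ (𝟙 :- q) :* x := x :+ (q :* a :+ q :* b)) refl q _ _ _)

      -- The certain part is merely relaxed by q ≤ 1. For the other, `missed` is first replaced by
      -- its value after relabelling, and then `∑-relabel` turns q times that sum into the sum of
      -- `hit`.
      middle : ∑ₛ X₀ + (q * ∑ₛ gained + q * ∑ₛ missed) ≤ ∑ₛ X₀ + (∑ₛ gained + ∑ₛ hit)
      middle = +-monoʳ-≤ _ (+-mono
        (≤-respʳ-≈ (*-identityˡ _) (*-monoʳ (≤-respˡ-≈ (∑-zero (labelings W n)) (∑-mono (labelings W n) 0≤gained)) q≤1))
        (≤-trans (*-monoˡ 0≤q (∑-mono (labelings W n) missed-mono))
          (≤-reflexive (trans (*-congˡ (sym (∑-relabel missed j i)))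
            (trans (solve 3 (λ q w x → q :* (w :* x) := (w :* q) :* x) refl q (fromℕ W) _)
              (trans (*-congʳ q-inverse) (*-identityˡ _)))))))

      rhs : ∑ₛ X₀ + (∑ₛ gained + ∑ₛ hit) ≈ ∑ₛ (λ s → X₀ s + (gained s + hit s))
      rhs = sym (trans (∑-+ X₀ _ (labelings W n)) (+-congˡ (∑-+ gained hit (labelings W n))))

      available : ∀ s → X₀ s + (gained s + hit s) ≤ (if does (In? s) ∨ does (lookup s j Fin.≟ i) then X₁ s else X₀ s)
      available s with does (In? s) | does (lookup s j Fin.≟ i)
      ... | true  | true  = ≤-reflexive (solve 2 (λ x y → x :+ ((y :- x) :+ con (ℤ.+ 0)) := y) refl (X₀ s) (X₁ s))
      ... | true  | false = ≤-reflexive (solve 2 (λ x y → x :+ ((y :- x) :+ con (ℤ.+ 0)) := y) refl (X₀ s) (X₁ s))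
      ... | false | true  = ≤-reflexive (solve 2 (λ x y → x :+ (con (ℤ.+ 0) :+ (y :- x)) := y) refl (X₀ s) (X₁ s))
      ... | false | false = ≤-reflexive (trans (+-congˡ (+-identityˡ 0#)) (+-identityʳ _))

-- Expected progress per window and per group.

module Progress (ℛ : Reals) (η k μ : ℕ) (ends : ℕ → Bool) {n : ℕ} (f : Subset n → Reals.Carrier ℛ)
                (f-good : Streaming.MonotoneSubmodular ℛ f) (σ : Vec (Fin n) n) (W : ℕ) where
  open OrderedField ℛ
  open Sums ℛ
  open Labelings ℛ
  open Streaming.MonotoneSubmodular f-good
  open Windows ℛ η k μ ends f
  open State

  -- The marginal value of a set is at most the sum of the marginal values of its members. One step
  -- applies submodularity to P with x added and P with the rest added, whose intersection contains
  -- P.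
  submodular-sum : ∀ P (xs : List (Fin n)) →
    fromℕ (length xs) * f P + f (P ∪ setOf xs) - f P ≤ ∑ xs (λ x → f (P ∪ ⁅ x ⁆))
  submodular-sum P [] = ≤-reflexive (trans (+-congˡ (-‿cong (reflexive (≡.cong f (≡.sym (Subset.∪-identityʳ P))))))
    (solve 2 (λ x y → con (ℤ.+ 0) :* x :+ y :- y := con (ℤ.+ 0)) refl (f P) (f (P ∪ ⊥))))
  submodular-sum P (x ∷ xs) = ≤-trans
    (≤-via (f (P ∪ ⁅ x ⁆) + f (P ∪ setOf xs) - (f (P ∪ (⁅ x ⁆ ∪ setOf xs)) + f P)) (x≤y⇒0≤y-x step′)
      (solve 5 (λ l p a b c → a :+ (l :* p :+ b :- p) := ((𝟙 :+ l) :* p :+ c :- p) :+ (a :+ b :- (c :+ p))) refl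
         (fromℕ (length xs)) (f P) (f (P ∪ ⁅ x ⁆)) (f (P ∪ setOf xs)) (f (P ∪ (⁅ x ⁆ ∪ setOf xs)))))
    (+-monoʳ-≤ _ (submodular-sum P xs))
    where
    union : (P ∪ ⁅ x ⁆) ∪ (P ∪ setOf xs) ≡ P ∪ (⁅ x ⁆ ∪ setOf xs)
    union = lemma P ⁅ x ⁆ (setOf xs)
      where
      open Algebra.Solver.IdempotentCommutativeMonoid (Subset.∪-idempotentCommutativeMonoid n)
        using (_⊕_; _⊜_) renaming (solve to solve∪)
      lemma : ∀ a b c → (a ∪ b) ∪ (a ∪ c) ≡ a ∪ (b ∪ c)
      lemma = solve∪ 3 (λ a b c → ((a ⊕ b) ⊕ (a ⊕ c)) ⊜ (a ⊕ (b ⊕ c))) ≡.refl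
    step′ : f (P ∪ (⁅ x ⁆ ∪ setOf xs)) + f P ≤ f (P ∪ ⁅ x ⁆) + f (P ∪ setOf xs)
    step′ = ≤-trans (+-mono (≤-reflexive (reflexive (≡.cong f (≡.sym union))))
        (monotone (λ y∈ → Subset.x∈p∩q⁺ (Subset.x∈p∪q⁺ (inj₁ y∈) , Subset.x∈p∪q⁺ (inj₁ y∈)))))
      (submodular (P ∪ ⁅ x ⁆) (P ∪ setOf xs))

  module Window (i : Fin W) (h : Fin n → State → Carrier) where
    T : Vec (Fin W) n → State
    T s = stateAt (toℕ i) (window s σ)

    Stored : Fin n → State → Set
    Stored j T = lookup σ j ∈ stored T

    stored? : ∀ j T → Dec (Stored j T)
    stored? j T = mem? Fin._≟_ (lookup σ j) (stored T)

    T-relabel : ∀ s j → ¬ Stored j (T s) → T (s [ j ]≔ i) ≡ T s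
    T-relabel s j = stateAt-deletion (toℕ i) (λ a a<i → window-relabel s σ j i (ℕ.<⇒≢ a<i ∘ ≡.sym))

    -- The maximum of x and the values of those positions of J that are stored or labelled i. The
    -- accumulator lets `resample` act on the head of J while the other positions stay inside its
    -- two branches.
    available : State → Vec (Fin W) n → List (Fin n) → Carrier → Carrier
    available T s []       x = x
    available T s (j ∷ J) x =
      if does (stored? j T) ∨ does (lookup s j Fin.≟ i) then available T s J (x ⊔ h j T) else available T s J x

    available-mono : ∀ T s J {x y} → x ≤ y → available T s J x ≤ available T s J y
    available-mono T s []       x≤y = x≤y
    available-mono T s (j ∷ J) x≤y with does (stored? j T) ∨ does (lookup s j Fin.≟ i)
    ... | true  = available-mono T s J (⊔-monoˡ-≤ (h j T) x≤y)
    ... | false = available-mono T s J x≤y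

    available-≤ : ∀ T s J {x y} → x ≤ y → (∀ j → Stored j T ⊎ lookup s j ≡ i → h j T ≤ y) → available T s J x ≤ y
    available-≤ T s []       x≤y h≤y = x≤y
    available-≤ T s (j ∷ J) x≤y h≤y with stored? j T | lookup s j Fin.≟ i
    ... | yes p | _     = available-≤ T s J (⊔-lub x≤y (h≤y j (inj₁ p))) h≤y
    ... | no _  | yes p = available-≤ T s J (⊔-lub x≤y (h≤y j (inj₂ p))) h≤y
    ... | no _  | no _  = available-≤ T s J x≤y h≤y

    available-relabel : ∀ T s J j {x} → All (j ≢_) J → available T (s [ j ]≔ i) J x ≡ available T s J x
    available-relabel T s []        j []            = ≡.refl
    available-relabel T s (j′ ∷ J) j (j≢j′ ∷ j∉J)
      rewrite Vec.lookup∘updateAt′ j′ j {λ _ → i} (j≢j′ ∘ ≡.sym) s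
      with does (stored? j′ T) ∨ does (lookup s j′ Fin.≟ i)
    ... | true  = available-relabel T s J j j∉J
    ... | false = available-relabel T s J j j∉J

    module _ (q : Carrier) (q-inverse : fromℕ W * q ≈ 1#) (0≤q : 0# ≤ q) (q≤1 : q ≤ 1#) where
      open Resampling W n q q-inverse 0≤q q≤1

      -- The expectation of `available` if every position were available
      -- independently with probability q.
      independent : State → List (Fin n) → Carrier → Carrier
      independent T []       x = x
      independent T (j ∷ J) x = q * independent T J (x ⊔ h j T) + (1# - q) * independent T J x

      -- Positions are resampled one at a time. Moving j to window i, when j is not stored, changes
      -- neither the state nor the labels of the other members of J, so both branches are stable.
      -- The starting value β may depend on the state only, and so does its successor with the value
      -- of j included.
      independent≤available : ∀ {J} → Unique J → ∀ (β : State → Carrier) →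
        ∑ₛ (λ s → independent (T s) J (β (T s))) ≤ ∑ₛ (λ s → available (T s) s J (β (T s)))
      independent≤available [] β = ≤-refl
      independent≤available {j ∷ J} (j∉J ∷ J!) β = ≤-trans
        (≤-reflexive (trans (∑-+ _ _ (labelings W n)) (+-cong (∑-*ˡ q _ (labelings W n)) (∑-*ˡ (1# - q) _ (labelings W n)))))
        (≤-trans (+-mono (*-monoˡ 0≤q (independent≤available J! (λ T → β T ⊔ h j T)))
                         (*-monoˡ (x≤y⇒0≤y-x q≤1) (independent≤available J! β)))
          (resample j i (λ s → stored? j (T s)) _ _
            (λ s → available-mono (T s) s J (x≤x⊔y (β (T s)) (h j (T s))))
            (λ s ∉ → (λ ∈′ → ∉ (≡.subst (Stored j) (T-relabel s j ∉) ∈′)) ,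
               reflexive (≡.trans (≡.cong (λ T → available T (s [ j ]≔ i) J (β T)) (T-relabel s j ∉))
                                  (available-relabel (T s) s J j j∉J)) ,
               reflexive (≡.trans (≡.cong (λ T → available T (s [ j ]≔ i) J (β T ⊔ h j T)) (T-relabel s j ∉))
                                  (available-relabel (T s) s J j j∉J)))))

      gain : State → List (Fin n) → Carrier → Carrier
      gain T J x = ∑ J (λ j → (x ⊔ h j T) - x)

      gain-nonneg : ∀ T J x → 0# ≤ gain T J x
      gain-nonneg T []       x = ≤-refl
      gain-nonneg T (j ∷ J) x = +-nonneg (x≤y⇒0≤y-x (x≤x⊔y x (h j T))) (gain-nonneg T J x)

      coefficient : List (Fin n) → Carrier
      coefficient J = q * (1# - q) ^ length J

      0≤coefficient : ∀ J → 0# ≤ coefficient J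
      0≤coefficient J = *-nonneg 0≤q (^-nonneg (length J) (x≤y⇒0≤y-x q≤1))

      -- The maximum is at least the value at the first available position of J, and each position
      -- is the first one with probability at least q (1 - q)^|J|.
      independent-≥ : ∀ T J x → x + coefficient J * gain T J x ≤ independent T J x
      independent-≥ T []       x = ≤-reflexive (trans (+-congˡ (zeroʳ _)) (+-identityʳ x))
      independent-≥ T (j ∷ J) x = ≤-trans
        (≤-via (q * (1# - (1# - q) ^ suc (length J)) * ((x ⊔ h j T) - x))
          (*-nonneg (*-nonneg 0≤q (x≤y⇒0≤y-x (^-≤1 (suc (length J)) (x≤y⇒0≤y-x q≤1)
              (≤-via q 0≤q (solve 1 (λ q → 𝟙 := (𝟙 :- q) :+ q) refl q)))))
            (x≤y⇒0≤y-x (x≤x⊔y x (h j T))))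
          (solve 5 (λ q x y p g → q :* y :+ (𝟙 :- q) :* (x :+ (q :* p) :* g)
             := (x :+ (q :* ((𝟙 :- q) :* p)) :* ((y :- x) :+ g)) :+ q :* (𝟙 :- (𝟙 :- q) :* p) :* (y :- x))
            refl q x (x ⊔ h j T) ((1# - q) ^ length J) (gain T J x)))
        (+-mono (*-monoˡ 0≤q (≤-trans (x≤x+ _ (*-nonneg (0≤coefficient J) (gain-nonneg T J _))) (independent-≥ T J (x ⊔ h j T))))
                (*-monoˡ (x≤y⇒0≤y-x q≤1) (independent-≥ T J x)))

  module _ (O : Subset n) (J : List (Fin n)) (J! : Unique J) (∣J∣≤k : length J ℕ.≤ k) (O⊆J : O ⊆ setOf (List.map (lookup σ) J))
           (q r : Carrier) (q-inverse : fromℕ W * q ≈ 1#) (0≤q : 0# ≤ q) (q≤1 : q ≤ 1#)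
           (0≤r : 0# ≤ r) (r≤ : r ≤ q * (1# - q) ^ length J) (kr≤1 : fromℕ k * r ≤ 1#) where
    open Resampling W n q q-inverse 0≤q q≤1

    loss : Subset n → Carrier
    loss S = f O - f S

    -- The greedy step, with success probability p = k r: members of O are tried on top of L_ℓ, and
    -- by submodularity an average one closes a 1/k fraction of the gap. The comparison starts from
    -- the larger of L_(ℓ+1) and L_ℓ, which makes every gain nonnegative.
    window-progress : ∀ (i : Fin W) ℓ →
      ∑ₛ (λ s → loss (lookup (newSolutions (stateAt (toℕ i) (window s σ)) (window s σ (toℕ i))) (suc ℓ))) ≤
      (1# - fromℕ k * r) * ∑ₛ (λ s → loss (lookup (solutions (stateAt (toℕ i) (window s σ))) (suc ℓ))) +
      (fromℕ k * r - r) * ∑ₛ (λ s → loss (lookup (solutions (stateAt (toℕ i) (window s σ))) (inject₁ ℓ)))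
    window-progress i ℓ = ≤-trans
      (≤-respˡ-≈ (sym (∑-loss _)) (≤-respʳ-≈ (sym (∑-loss _))
        (+-monoʳ-≤ _ (neg-antitone (≤-trans (∑-mono (labelings W n) (λ s → lower (T s)))
          (≤-trans (independent≤available q q-inverse 0≤q q≤1 J! β) (∑-mono (labelings W n) upper)))))))
      (≤-reflexive (trans (∑-cong (labelings W n) (λ s → solve 5 (λ kr r o a b →
            o :- ((𝟙 :- kr) :* a :+ (kr :- r) :* b :+ r :* o) := (𝟙 :- kr) :* (o :- a) :+ (kr :- r) :* (o :- b))
            refl (fromℕ k * r) r (f O) (f (lookup (solutions (T s)) (suc ℓ))) (f (lookup (solutions (T s)) (inject₁ ℓ)))))
          (trans (∑-+ _ _ (labelings W n)) (+-cong (∑-*ˡ _ _ (labelings W n)) (∑-*ˡ _ _ (labelings W n))))))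
      where
      old above : State → Carrier
      old T = f (lookup (solutions T) (inject₁ ℓ))
      above T = f (lookup (solutions T) (suc ℓ))
      h : Fin n → State → Carrier
      h j T = f (lookup (solutions T) (inject₁ ℓ) ∪ ⁅ lookup σ j ⁆)
      open Window i h
      β goal : State → Carrier
      β T = above T ⊔ old T
      goal T = (1# - fromℕ k * r) * above T + (fromℕ k * r - r) * old T + r * f O
      new : Vec (Fin W) n → Carrier
      new s = f (lookup (newSolutions (T s) (window s σ (toℕ i))) (suc ℓ))

      ∑-loss : ∀ (X : Vec (Fin W) n → Carrier) → ∑ₛ (λ s → f O - X s) ≈ ∑ₛ (λ _ → f O) - ∑ₛ X
      ∑-loss X = trans (∑-+ _ _ (labelings W n)) (+-congˡ (neg (labelings W n)))
        where
        neg : ∀ xs → ∑ xs (λ s → - X s) ≈ - ∑ xs X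
        neg []       = solve 0 (con (ℤ.+ 0) := :- con (ℤ.+ 0)) refl
        neg (s ∷ xs) = trans (+-congˡ (neg xs)) (solve 2 (λ a b → :- a :- b := :- (a :+ b)) refl _ _)

      gain-≥ : ∀ T → fromℕ (length J) * old T + f O - old T - fromℕ (length J) * β T ≤ gain q q-inverse 0≤q q≤1 T J (β T)
      gain-≥ T = ≤-trans
        (≤-trans (+-mono (≤-trans
            (+-mono (+-monoʳ-≤ _ (monotone (λ x∈ → Subset.x∈p∪q⁺ (inj₂ (O⊆J x∈))))) ≤-refl)
            (≤-respˡ-≈ (+-congʳ (+-congʳ (*-congʳ (reflexive (≡.cong fromℕ (List.length-map (lookup σ) J))))))
              (submodular-sum (lookup (solutions T) (inject₁ ℓ)) (List.map (lookup σ) J)))) ≤-refl)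
          (≤-reflexive (trans (+-cong (∑-map _ (lookup σ) J) (-‿cong (sym (∑-const (β T) J)))) (sym (neg J)))))
        (∑-mono J (λ j → +-mono (x≤y⊔x (β T) (h j T)) ≤-refl))
        where
        neg : ∀ J → ∑ J (λ j → h j T - β T) ≈ ∑ J (λ j → h j T) - ∑ J (λ _ → β T)
        neg []       = solve 0 (con (ℤ.+ 0) := con (ℤ.+ 0) :- con (ℤ.+ 0)) refl
        neg (j ∷ J) = trans (+-congˡ (neg J))
          (solve 4 (λ a b c d → (a :- b) :+ (c :- d) := (a :+ c) :- (b :+ d)) refl _ _ _ _)

      lower : ∀ T → goal T ≤ independent q q-inverse 0≤q q≤1 T J (β T)
      lower T = ≤-trans
        -- The bound obtained from the gain is affine in β with slope 1 - |J| r. Passing from |J| to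
        -- k uses that β is at least `old`, and passing from β to `above` uses k r ≤ 1.
        (≤-via ((1# - fromℕ k * r) * (β T - above T) + r * ((fromℕ k - fromℕ (length J)) * (β T - old T)))
          (+-nonneg (*-nonneg (x≤y⇒0≤y-x kr≤1) (x≤y⇒0≤y-x (x≤x⊔y (above T) (old T))))
             (*-nonneg 0≤r (*-nonneg (x≤y⇒0≤y-x (fromℕ-mono ∣J∣≤k)) (x≤y⇒0≤y-x (x≤y⊔x (above T) (old T))))))
          (solve 7 (λ k r l o a v b →
             b :+ r :* (l :* v :+ o :- v :- l :* b)
             := ((𝟙 :- k :* r) :* a :+ (k :* r :- r) :* v :+ r :* o) :+ ((𝟙 :- k :* r) :* (b :- a) :+ r :* ((k :- l) :* (b :- v))))
            refl (fromℕ k) r (fromℕ (length J)) (f O) (above T) (old T) (β T)))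
        (≤-trans (+-monoʳ-≤ (β T) (≤-trans (*-monoˡ 0≤r (gain-≥ T)) (*-monoʳ (gain-nonneg q q-inverse 0≤q q≤1 T J (β T)) r≤)))
          (independent-≥ q q-inverse 0≤q q≤1 T J (β T)))

      upper : ∀ s → available (T s) s J (β (T s)) ≤ new s
      upper s = available-≤ (T s) s J
        (⊔-lub (newSolutions-improve (T s) w ℓ)
          (≤-respˡ-≈ (reflexive (≡.cong f (Subset.∪-identityʳ (lookup (solutions (T s)) (inject₁ ℓ)))))
            (newSolutions-trial (T s) w ℓ (∈-++⁺ʳ (List.map ⁅_⁆ w) (here ≡.refl)))))
        (λ j → [ (λ j∈ → newSolutions-trial (T s) w ℓ (∈-++⁺ʳ (List.map ⁅_⁆ w) (there (∈-map⁺ ⁅_⁆ j∈))))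
               , (λ sj≡i → newSolutions-trial (T s) w ℓ (∈-++⁺ˡ (∈-map⁺ ⁅_⁆
                   (≡.subst (λ a → lookup σ j ∈ window s σ (toℕ a)) sj≡i (∈-window s σ j))))) ]′)
        where w = window s σ (toℕ i)

    lossAt lossNew : ℕ → Fin (suc μ) → Carrier
    lossAt i ℓ = ∑ₛ (λ s → loss (lookup (solutions (stateAt i (window s σ))) ℓ))
    lossNew i ℓ = ∑ₛ (λ s → loss (lookup (newSolutions (stateAt i (window s σ)) (window s σ i)) ℓ))

    lossNew-suc : ∀ {i} → i ℕ.< W → ∀ ℓ →
      lossNew i (suc ℓ) ≤ (1# - fromℕ k * r) * lossAt i (suc ℓ) + (fromℕ k * r - r) * lossAt i (inject₁ ℓ)
    lossNew-suc i<W ℓ = ≡.subst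
      (λ i → lossNew i (suc ℓ) ≤ (1# - fromℕ k * r) * lossAt i (suc ℓ) + (fromℕ k * r - r) * lossAt i (inject₁ ℓ))
      (Fin.toℕ-fromℕ< i<W) (window-progress (Fin.fromℕ< i<W) ℓ)

    lossNew-zero : ∀ i → lossNew i zero ≈ lossAt i zero
    lossNew-zero i = ∑-cong (labelings W n) (λ s → reflexive (≡.cong loss (head≡ (solutions (stateAt i (window s σ))))))
      where
      head≡ : ∀ (os : Vec (Subset n) (suc μ)) → Vec.head os ≡ lookup os zero
      head≡ (o ∷ os) = ≡.refl

    lossAt-inner : ∀ i ℓ → ends i ≡ false → lossAt (suc i) ℓ ≈ lossNew i ℓ
    lossAt-inner i ℓ e = ∑-cong (labelings W n) (λ s → reflexive
      (≡.cong (λ r → loss (lookup (restart r (newSolutions (stateAt i (window s σ)) (window s σ i))) ℓ)) e))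

    lossAt-last : ∀ i ℓ → ends i ≡ true → lossAt (suc i) ℓ ≈ lossNew i (Fin.fromℕ μ)
    lossAt-last i ℓ e = ∑-cong (labelings W n) (λ s → reflexive (≡.trans
      (≡.cong (λ r → loss (lookup (restart r (newSolutions (stateAt i (window s σ)) (window s σ i))) ℓ)) e)
      (≡.cong loss (Vec.lookup-replicate ℓ (lookup (newSolutions (stateAt i (window s σ)) (window s σ i)) (Fin.fromℕ μ))))))

    module Groups (G′ N : ℕ) (W≡ : W ≡ N ℕ.* suc G′)
      (ends-inner : ∀ g j → suc j ℕ.< suc G′ → ends (g ℕ.* suc G′ ℕ.+ j) ≡ false)
      (ends-last : ∀ g → ends (g ℕ.* suc G′ ℕ.+ G′) ≡ true)
      (c κ γ : Carrier) (0≤c : 0# ≤ c) (0≤κ : 0# ≤ κ) (κ≤1 : κ ≤ 1#) (0≤γ : 0# ≤ γ)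
      (γ-inverse : γ * ((1# + 1#) * c) ≈ 1#) (κ-inverse : fromℕ k * κ ≈ 1#)
      (μ≈ : fromℕ μ ≈ c * c - c) (Gp≈μ : fromℕ (suc G′) * (fromℕ k * r) ≈ fromℕ μ) where

      G : ℕ
      G = suc G′

      open Potential ℛ

      ρ : Carrier
      ρ = 1# - (fromℕ μ - c) * κ + fromℕ μ * fromℕ μ * (κ * κ)

      p : Carrier
      p = fromℕ k * r

      0≤p : 0# ≤ p
      0≤p = *-nonneg (fromℕ-nonneg k) 0≤r

      pκ≈r : p * κ ≈ r
      pκ≈r = trans (solve 3 (λ k r κ → k :* r :* κ := (k :* κ) :* r) refl _ _ _) (trans (*-congʳ κ-inverse) (*-identityˡ r))

      -- A single Δ for all levels suffices at the start, because a restart makes all of them equal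
      -- to the previous top level; for the same reason the conclusion holds at every ℓ.
      group : ∀ g → g ℕ.< N → ∀ {Δ} → 0# ≤ Δ → (∀ ℓ → lossAt (g ℕ.* G) ℓ ≤ Δ) → ∀ ℓ → lossAt (suc g ℕ.* G) ℓ ≤ Δ * ρ
      group g g<N {Δ} 0≤Δ start ℓ = ≤-trans (≤-reflexive finish) (≤-trans
        (potential c (fromℕ μ) κ γ p Δ 0≤c 0≤κ κ≤1 0≤γ 0≤p kr≤1 (fromℕ-nonneg μ) 0≤Δ γ-inverse
          G δ start δ-bottom δ-step ≤-refl G (Fin.fromℕ μ) ℕ.≤-refl)
        (*-monoˡ 0≤Δ (≡.subst (λ b → C c (fromℕ μ) κ γ p Δ 0≤c 0≤κ κ≤1 0≤γ 0≤p kr≤1 (fromℕ-nonneg μ) 0≤Δ γ-inverse (fromℕ G) (fromℕ b) ≤ ρ)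
          (≡.sym (Fin.toℕ-fromℕ μ)) (C-final c (fromℕ μ) κ γ p Δ 0≤c 0≤κ κ≤1 0≤γ 0≤p kr≤1 (fromℕ-nonneg μ) 0≤Δ γ-inverse Gp≈μ μ≈))))
        where
        -- Losses after a window are taken before a possible restart. Inside the group this makes no
        -- difference, and after its last window the individual levels would otherwise be
        -- overwritten.
        δ : ℕ → Fin (suc μ) → Carrier
        δ zero    ℓ = lossAt (g ℕ.* G) ℓ
        δ (suc j) ℓ = lossNew (g ℕ.* G ℕ.+ j) ℓ

        δ≈ : ∀ j ℓ → j ℕ.< G → lossAt (g ℕ.* G ℕ.+ j) ℓ ≈ δ j ℓ
        δ≈ zero    ℓ _   = reflexive (≡.cong (λ i → lossAt i ℓ) (ℕ.+-identityʳ (g ℕ.* G)))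
        δ≈ (suc j) ℓ j<G = trans (reflexive (≡.cong (λ i → lossAt i ℓ) (ℕ.+-suc (g ℕ.* G) j)))
          (lossAt-inner (g ℕ.* G ℕ.+ j) ℓ (ends-inner g j j<G))

        δ-bottom : ∀ j → j ℕ.< G → δ (suc j) zero ≤ δ j zero
        δ-bottom j j<G = ≤-reflexive (trans (lossNew-zero (g ℕ.* G ℕ.+ j)) (δ≈ j zero j<G))

        inW : ∀ {j} → j ℕ.< G → g ℕ.* G ℕ.+ j ℕ.< W
        inW {j} j<G = ℕ.<-≤-trans (ℕ.+-monoʳ-< (g ℕ.* G) j<G)
          (ℕ.≤-trans (ℕ.≤-reflexive (ℕ.+-comm (g ℕ.* G) G)) (ℕ.≤-trans (ℕ.*-monoˡ-≤ G g<N) (ℕ.≤-reflexive (≡.sym W≡))))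

        δ-step : ∀ j ℓ → j ℕ.< G → δ (suc j) (suc ℓ) ≤ (1# - p) * δ j (suc ℓ) + (p - p * κ) * δ j (inject₁ ℓ)
        δ-step j ℓ j<G = ≤-trans (lossNew-suc (inW j<G) ℓ) (≤-reflexive
          (+-cong (*-congˡ (δ≈ j (suc ℓ) j<G)) (*-cong (+-congˡ (-‿cong (sym pκ≈r))) (δ≈ j (inject₁ ℓ) j<G))))

        finish : lossAt (suc g ℕ.* G) ℓ ≈ lossNew (g ℕ.* G ℕ.+ G′) (Fin.fromℕ μ)
        finish = trans (reflexive (≡.cong (λ i → lossAt (suc i) ℓ) (ℕ.+-comm G′ (g ℕ.* G))))
          (lossAt-last (g ℕ.* G ℕ.+ G′) ℓ (ends-last g))

      groups : 0# ≤ ρ → ∀ g → g ℕ.≤ N → ∀ ℓ → lossAt (g ℕ.* G) ℓ ≤ fromℕ (length (labelings W n)) * f O * ρ ^ g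
      groups 0≤ρ zero    _   ℓ = ≤-trans
        (∑-mono (labelings W n) (λ s → ≤-via (f (lookup (Vec.replicate (suc μ) ⊥) ℓ))
          (≤-respʳ-≈ (reflexive (≡.cong f (≡.sym (Vec.lookup-replicate ℓ ⊥)))) nonneg)
          (solve 2 (λ o x → o := (o :- x) :+ x) refl (f O) _)))
        (≤-reflexive (trans (∑-const (f O) (labelings W n)) (sym (*-identityʳ _))))
      groups 0≤ρ (suc g) g<N ℓ = ≤-trans
        (group g g<N (*-nonneg (*-nonneg (fromℕ-nonneg (length (labelings W n))) (≤-trans nonneg (monotone (Subset.⊆-min O)))) (^-nonneg g 0≤ρ))
          (groups 0≤ρ g (ℕ.<⇒≤ g<N)) ℓ)
        (≤-reflexive (trans (*-assoc _ _ _) (*-congˡ (*-comm _ _))))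

-- Numerical inequalities between the parameters.

module Parameters (ℛ : Reals) where
  open OrderedField ℛ
  open Exponential ℛ
  open Euler ℛ using (e)
  open import Relation.Binary.Reasoning.Setoid setoid

  1-nx≤[1-x]^n : ∀ n {x} → 0# ≤ x → x ≤ 1# → 1# - fromℕ n * x ≤ (1# - x) ^ n
  1-nx≤[1-x]^n zero {x} 0≤x x≤1 = ≤-reflexive (solve 1 (λ x → 𝟙 :- con (ℤ.+ 0) :* x := 𝟙) refl x)
  1-nx≤[1-x]^n (suc n) {x} 0≤x x≤1 = ≤-trans
    (≤-via (fromℕ n * (x * x)) (*-nonneg (fromℕ-nonneg n) (sq-nonneg x))
      (solve 2 (λ n x → (𝟙 :- x) :* (𝟙 :- n :* x) := (𝟙 :- (𝟙 :+ n) :* x) :+ n :* (x :* x)) refl (fromℕ n) x))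
    (*-monoˡ (x≤y⇒0≤y-x x≤1) (1-nx≤[1-x]^n n 0≤x x≤1))

  -- K, κ stand for k, 1/k; g for 1/G and q for 1/(NG), where G = 2c³; M = c².
  module _ (c K κ g q N : Carrier) (0≤c : 0# ≤ c) (1≤c : 1# ≤ c) (0≤κ : 0# ≤ κ) (0≤g : 0# ≤ g) (0≤q : 0# ≤ q)
    (Kκ≈1 : K * κ ≈ 1#) (Gg≈1 : (1# + 1#) * (c * c * c) * g ≈ 1#) (Wq≈1 : N * ((1# + 1#) * (c * c * c)) * q ≈ 1#)
    (NM≤K : N * (c * c) ≤ K) (K≤2NM : K ≤ (1# + 1#) * (N * (c * c))) where

    private
      M = c * c
      -- Here a = 1/(2c), and z is the expected number of members of a k-set in one window. The two
      -- bounds on K give a ≤ z ≤ 2a. Since (c² - c)/G = a (1 - 2a), the inequality `rate` amounts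
      -- to z (1 - z) ≥ a (1 - 2a); this is the reason for G = 2c³.
      a = M * g
      z = K * q

      a≈ : a ≈ M * N * q
      a≈ = begin
        M * g ≈⟨ *-identityʳ _ ⟨
        M * g * 1# ≈⟨ *-congˡ Wq≈1 ⟨
        M * g * (N * ((1# + 1#) * (c * c * c)) * q)
          ≈⟨ solve 4 (λ c g n q → c :* c :* g :* (n :* (𝟚 :* (c :* c :* c)) :* q)
                := 𝟚 :* (c :* c :* c) :* g :* (c :* c :* n :* q)) refl c g N q ⟩
        (1# + 1#) * (c * c * c) * g * (M * N * q) ≈⟨ *-congʳ Gg≈1 ⟩
        1# * (M * N * q) ≈⟨ *-identityˡ _ ⟩
        M * N * q ∎

      0≤z-a : 0# ≤ z - a
      0≤z-a = ≤-respʳ-≈ (trans (solve 4 (λ k n m q → (k :- n :* m) :* q := k :* q :- m :* n :* q) refl K N M q)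
          (+-congˡ (-‿cong (sym a≈))))
        (*-nonneg (x≤y⇒0≤y-x NM≤K) 0≤q)

      0≤2a-z : 0# ≤ (1# + 1#) * a - z
      0≤2a-z = ≤-respʳ-≈ (trans (solve 4 (λ k n m q → (𝟚 :* (n :* m) :- k) :* q := 𝟚 :* (m :* n :* q) :- k :* q) refl K N M q)
          (+-congʳ (*-congˡ (sym a≈))))
        (*-nonneg (x≤y⇒0≤y-x K≤2NM) 0≤q)

      0≤a : 0# ≤ a
      0≤a = *-nonneg (sq-nonneg c) 0≤g

      0≤1-2a : 0# ≤ 1# - (1# + 1#) * a
      0≤1-2a = ≤-respʳ-≈ (trans (solve 2 (λ c g → 𝟚 :* (c :* c :* g) :* (c :- 𝟙) := 𝟚 :* (c :* c :* c) :* g :- 𝟚 :* (c :* c :* g)) refl c g)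
          (+-congʳ Gg≈1))
        (*-nonneg (*-nonneg (+-nonneg 0≤1 0≤1) 0≤a) (x≤y⇒0≤y-x 1≤c))

      0≤1-z : 0# ≤ 1# - z
      0≤1-z = ≤-respʳ-≈ (solve 2 (λ a z → (𝟙 :- 𝟚 :* a) :+ (𝟚 :* a :- z) := 𝟙 :- z) refl a z) (+-nonneg 0≤1-2a 0≤2a-z)

    kq≤1 : K * q ≤ 1#
    kq≤1 = 0≤y-x⇒x≤y 0≤1-z

    -- This reads μ/(Gk) ≤ q (1 - kq) with μ = c² - c.
    rate : (c * c - c) * g * κ ≤ q * (1# - K * q)
    rate = ≤-respʳ-≈ (trans (solve 3 (λ k κ q → (k :* q) :* (𝟙 :- k :* q) :* κ := (k :* κ) :* (q :* (𝟙 :- k :* q))) refl K κ q)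
          (trans (*-congʳ Kκ≈1) (*-identityˡ _)))
      (*-monoʳ 0≤κ (≤-by ((z - a) * (1# - z) + a * ((1# + 1#) * a - z))
        (((1# + 1#) * (c * c * c) * g - 1#) * (- (c * g)))
        (+-nonneg (*-nonneg 0≤z-a 0≤1-z) (*-nonneg 0≤a 0≤2a-z))
        (trans (*-congʳ (trans (+-congʳ Gg≈1) (-‿inverseʳ 1#))) (zeroˡ _))
        (solve 3 (λ c g z → z :* (𝟙 :- z) := (c :* c :- c) :* g
             :+ ((z :- c :* c :* g) :* (𝟙 :- z) :+ c :* c :* g :* (𝟚 :* (c :* c :* g) :- z))
             :+ (𝟚 :* (c :* c :* c) :* g :- 𝟙) :* (:- (c :* g)))
          refl c g z)))

  -- κ stands for 1/k and i for 1/c.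
  module _ (c κ i : Carrier) (k N : ℕ) (3≤c : 1# + (1# + 1#) ≤ c) (0≤κ : 0# ≤ κ) (0≤i : 0# ≤ i) (ci≈1 : c * i ≈ 1#)
    (kκ≈1 : fromℕ k * κ ≈ 1#) (NM≤k : fromℕ N * (c * c) ≤ fromℕ k) (k≤[1+N]M : fromℕ k ≤ fromℕ (suc N) * (c * c))
    (M≤k : c * c ≤ fromℕ k) (μ²≤k : (c * c - c) * (c * c - c) ≤ fromℕ k) where

    private
      M = c * c
      μ = c * c - c
      x = M * κ
      -- The factor per group is 1 - x + drift, where x is the ideal gain of c² additions and the
      -- drift collects the cost of the random spread, the gap between μ and c², and the
      -- second-order term.
      drift = (1# + 1#) * (c * κ) + μ * μ * (κ * κ)

      3≥ : 0# ≤ 1# + (1# + 1#)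
      3≥ = +-nonneg 0≤1 (+-nonneg 0≤1 0≤1)

      0≤c : 0# ≤ c
      0≤c = ≤-trans 3≥ 3≤c

      0≤c-3 : 0# ≤ c - (1# + (1# + 1#))
      0≤c-3 = x≤y⇒0≤y-x 3≤c

      0≤x : 0# ≤ x
      0≤x = *-nonneg (sq-nonneg c) 0≤κ

      scale : ∀ {y} → y ≤ fromℕ k → y * κ ≤ 1#
      scale y≤k = ≤-respʳ-≈ kκ≈1 (*-monoʳ 0≤κ y≤k)

      x≤1 : x ≤ 1#
      x≤1 = scale M≤k

      0≤μ : 0# ≤ μ
      0≤μ = ≤-respʳ-≈ (solve 1 (λ c → c :* (c :- (𝟙 :+ 𝟚)) :+ (c :+ c) := c :* c :- c) refl c)
        (+-nonneg (*-nonneg 0≤c 0≤c-3) (+-nonneg 0≤c 0≤c))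

      0≤drift : 0# ≤ drift
      0≤drift = +-nonneg (*-nonneg (+-nonneg 0≤1 0≤1) (*-nonneg 0≤c 0≤κ)) (*-nonneg (sq-nonneg μ) (sq-nonneg κ))

      -- The gain exceeds the drift because c² - 2c - 1 ≥ 0 for c ≥ 3 and because μ² κ ≤ 1.
      1-x+drift≤1 : (1# - x) + drift ≤ 1#
      1-x+drift≤1 = ≤-via (κ * ((c - (1# + (1# + 1#))) * (c + 1#) + (1# + 1#)) + κ * (1# - μ * μ * κ))
        (+-nonneg (*-nonneg 0≤κ (+-nonneg (*-nonneg 0≤c-3 (+-nonneg 0≤c 0≤1)) (+-nonneg 0≤1 0≤1)))
          (*-nonneg 0≤κ (x≤y⇒0≤y-x (scale μ²≤k))))
        (solve 3 (λ c κ μ → 𝟙 := ((𝟙 :- c :* c :* κ) :+ (𝟚 :* (c :* κ) :+ μ :* μ :* (κ :* κ)))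
             :+ (κ :* ((c :- (𝟙 :+ 𝟚)) :* (c :+ 𝟙) :+ 𝟚) :+ κ :* (𝟙 :- μ :* μ :* κ)))
          refl c κ μ)

      -- As N is rounded down, only (N + 1) x ≥ 1 is available; the missing factor 1 - x costs at
      -- most x.
      shrink : (1# - x) ^ N ≤ e ⁻¹ + x
      shrink = ≤-trans
        (≤-via (x * (1# - (1# - x) ^ N)) (*-nonneg 0≤x (x≤y⇒0≤y-x (^-≤1 N 0≤1-x 1-x≤1)))
          (solve 2 (λ x p → (𝟙 :- x) :* p :+ x := p :+ x :* (𝟙 :- p)) refl x ((1# - x) ^ N)))
        (+-mono (geometric≤e⁻¹ (suc N) 0≤x x≤1
          (≤-respˡ-≈ kκ≈1 (≤-respʳ-≈ (*-assoc _ _ _) (*-monoʳ 0≤κ k≤[1+N]M)))) ≤-refl)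
        where
        0≤1-x = x≤y⇒0≤y-x x≤1
        1-x≤1 : 1# - x ≤ 1#
        1-x≤1 = ≤-via x 0≤x (solve 1 (λ x → 𝟙 := (𝟙 :- x) :+ x) refl x)

      Nx≤1 : fromℕ N * x ≤ 1#
      Nx≤1 = ≤-respˡ-≈ (*-assoc _ _ _) (scale NM≤k)

      -- Both parts use N x ≤ 1: N 2cκ is 2 N x / c, and N μ² κ² is at most N x times x because μ ≤
      -- M.
      Ndrift≤ : fromℕ N * drift ≤ (1# + 1#) * i + x
      Ndrift≤ = ≤-by
        ((1# + 1#) * i * (1# - fromℕ N * x) + x * (1# - fromℕ N * x) + fromℕ N * (κ * κ) * (c * (M + μ)))
        ((c * i - 1#) * ((1# + 1#) * (fromℕ N * (c * κ))))
        (+-nonneg (+-nonneg (*-nonneg (*-nonneg (+-nonneg 0≤1 0≤1) 0≤i) (x≤y⇒0≤y-x Nx≤1)) (*-nonneg 0≤x (x≤y⇒0≤y-x Nx≤1)))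
          (*-nonneg (*-nonneg (fromℕ-nonneg N) (sq-nonneg κ)) (*-nonneg 0≤c (+-nonneg (sq-nonneg c) 0≤μ))))
        (trans (*-congʳ (trans (+-congʳ ci≈1) (-‿inverseʳ 1#))) (zeroˡ _))
        (solve 4 (λ c κ i n → let m = c :* c ; μ = c :* c :- c ; x = m :* κ in
           𝟚 :* i :+ x := n :* (𝟚 :* (c :* κ) :+ μ :* μ :* (κ :* κ))
             :+ (𝟚 :* i :* (𝟙 :- n :* x) :+ x :* (𝟙 :- n :* x) :+ n :* (κ :* κ) :* (c :* (m :+ μ)))
             :+ (c :* i :- 𝟙) :* (𝟚 :* (n :* (c :* κ))))
          refl c κ i (fromℕ N))

    contraction : (1# - (μ - c) * κ + μ * μ * (κ * κ)) ^ N ≤ e ⁻¹ + ((1# + 1#) * i + (1# + 1#) * (M * κ))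
    contraction = ≤-respˡ-≈ (^-cong N (solve 3 (λ c κ μ² → (𝟙 :- c :* c :* κ) :+ (𝟚 :* (c :* κ) :+ μ² :* (κ :* κ))
          := 𝟙 :- (c :* c :- c :- c) :* κ :+ μ² :* (κ :* κ)) refl c κ (μ * μ)))
      (≤-trans (power-perturbation N (x≤y⇒0≤y-x x≤1) 0≤drift 1-x+drift≤1)
        (≤-trans (+-mono shrink Ndrift≤)
          (≤-reflexive (solve 3 (λ e i x → (e :+ x) :+ (𝟚 :* i :+ x) := e :+ (𝟚 :* i :+ 𝟚 :* x)) refl (e ⁻¹) i x))))

    0≤contraction : 0# ≤ 1# - (μ - c) * κ + μ * μ * (κ * κ)
    0≤contraction = ≤-respʳ-≈ (solve 3 (λ c κ μ² → (𝟙 :- c :* c :* κ) :+ (𝟚 :* (c :* κ) :+ μ² :* (κ :* κ))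
          := 𝟙 :- (c :* c :- c :- c) :* κ :+ μ² :* (κ :* κ)) refl c κ (μ * μ))
      (+-nonneg (x≤y⇒0≤y-x x≤1) 0≤drift)

-- Enumerations of orders, elements and labelings.

∈-permutations : ∀ (xs : Vec A n) → xs ∈ permutations xs
∈-permutations []       = here ≡.refl
∈-permutations (x ∷ xs) = ∈-concatMap⁺ (insertions x) (lose (∈-permutations xs) (head xs))
  where
  head : ∀ {n} (xs : Vec _ n) → (x ∷ xs) ∈ insertions x xs
  head []      = here ≡.refl
  head (_ ∷ _) = here ≡.refl

toList-allFin : ∀ n → Vec.toList (Vec.allFin n) ≡ allFin n
toList-allFin n = go n id
  where
  go : ∀ n (g : Fin n → A) → Vec.toList (Vec.tabulate g) ≡ List.tabulate g
  go zero    g = ≡.refl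
  go (suc n) g = ≡.cong (g zero ∷_) (go n (g ∘ suc))

orders-unique : ∀ {σ : Vec (Fin n) n} → σ ∈ orders n → Unique (Vec.toList σ)
orders-unique {n} σ∈ = ↭ₛ.Unique-resp-↭ (≡.setoid (Fin n)) (↭⇒↭ₛ (↭-sym (permutations-↭ (Vec.allFin n) σ∈)))
  (≡.subst Unique (≡.sym (toList-allFin n)) (Unique.allFin⁺ n))

orders-complete : ∀ {σ : Vec (Fin n) n} → σ ∈ orders n → ∀ x → x ∈ Vec.toList σ
orders-complete {n} σ∈ x = ∈-resp-↭ (↭-sym (permutations-↭ (Vec.allFin n) σ∈))
  (≡.subst (x ∈_) (≡.sym (toList-allFin n)) (∈-allFin x))

position : ∀ (σ : Vec A n) {x} → x ∈ Vec.toList σ → Σ[ j ∈ Fin n ] lookup σ j ≡ x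
position []      ()
position (y ∷ σ) (here x≡y) = zero , ≡.sym x≡y
position (y ∷ σ) (there x∈) = let j , eq = position σ x∈ in suc j , eq

select-unique : ∀ (p : Subset m) (b : Vec A m) → Unique (Vec.toList b) → Unique (Vec.toList (select p b))
select-unique []            []      b!        = b!
select-unique (inside ∷ p)  (x ∷ b) (x∉ ∷ b!) =
  All.tabulate (λ y∈ → All.lookup x∉ (toList-select⊆ p b y∈)) ∷ select-unique p b b!
select-unique (outside ∷ p) (x ∷ b) (x∉ ∷ b!) = select-unique p b b!

∈-select : ∀ (p : Subset m) (b : Vec A m) {i} → i ∈ₛ p → lookup b i ∈ Vec.toList (select p b)
∈-select (inside ∷ p)  (x ∷ b) {zero}  i∈           = here ≡.refl
∈-select (inside ∷ p)  (x ∷ b) {suc i} (Vec.there i∈) = there (∈-select p b i∈)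
∈-select (outside ∷ p) (x ∷ b) {suc i} (Vec.there i∈) = ∈-select p b i∈

elements-unique : ∀ (p : Subset m) → Unique (elements p)
elements-unique {m} p = select-unique p (Vec.allFin m) (≡.subst Unique (≡.sym (toList-allFin m)) (Unique.allFin⁺ m))

∈-elements : ∀ (p : Subset m) {i} → i ∈ₛ p → i ∈ elements p
∈-elements {m} p {i} i∈ = ≡.subst (_∈ elements p) (Vec.lookup∘tabulate id i) (∈-select p (Vec.allFin m) i∈)

∈-labelings : ∀ {W} n (l : Fin W) → Vec.replicate n l ∈ labelings W n
∈-labelings zero    l = here ≡.refl
∈-labelings (suc n) l = ∈-concatMap⁺ (λ l → List.map (l ∷_) (labelings _ n)) (lose (∈-allFin l) (∈-map⁺ (l ∷_) (∈-labelings n l)))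

∈⇒nonZero : ∀ {x : A} {xs} → x ∈ xs → NonZero (length xs)
∈⇒nonZero (here _)  = _
∈⇒nonZero (there _) = _

n<2^n : ∀ n → n ℕ.< 2 ℕ.^ n
n<2^n zero    = ℕ.s≤s ℕ.z≤n
n<2^n (suc n) = ℕ.≤-trans (ℕ.+-mono-≤ (ℕ.m^n>0 2 n) (n<2^n n)) (ℕ.≤-reflexive (≡.cong (2 ℕ.^ n ℕ.+_) (≡.sym (ℕ.+-identityʳ _))))

module _ where
  open +-*-Solver

  crossTerms : ∀ n u v k → (n ℕ.* u ℕ.+ k ℕ.* v) ℕ.+ (n ℕ.* v ℕ.+ k ℕ.* u) ≡ (u ℕ.+ v) ℕ.* (n ℕ.+ k)
  crossTerms = solve 4 (λ n u v k → (n :* u :+ k :* v) :+ (n :* v :+ k :* u) := (u :+ v) :* (n :+ k)) ≡.refl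

  closingCost : ∀ k g u v → k ℕ.* g ℕ.* ((k ℕ.+ k ℕ.* g ℕ.* u) ℕ.* v) ≡ k ℕ.^ 2 ℕ.* (g ℕ.* (1 ℕ.+ g ℕ.* u) ℕ.* v)
  closingCost = solve 4 (λ k g u v → k :* g :* ((k :+ k :* g :* u) :* v) := k :* (k :* con 1) :* (g :* (con 1 :+ g :* u) :* v)) ≡.refl

  memory : ∀ k c → k ℕ.* c ℕ.^ 5 ℕ.+ (k ℕ.* (2 ℕ.* (c ℕ.* c ℕ.* c)) ℕ.* (c ℕ.* c) ℕ.+ k ℕ.* (c ℕ.* c ℕ.* c ℕ.^ 3)) ≡ 4 ℕ.* c ℕ.^ 5 ℕ.* k
  memory = solve 2 (λ k c → k :* c :^ 5 :+ (k :* (con 2 :* (c :* c :* c)) :* (c :* c) :+ k :* (c :* c :* c :^ 3)) := con 4 :* c :^ 5 :* k) ≡.refl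

-- Averages over the sample space.

module Averages (ℛ : Reals) where
  open OrderedField ℛ
  open Sums ℛ
  open Streaming ℛ using (MonotoneSubmodular; OPT; Strategy; Algorithm; sampleSpace; value; average; run)
  open Data.List.Extrema totalOrder using (argmax-all)

  +-cancelʳ-≤ : ∀ {x y} z → x + z ≤ y + z → x ≤ y
  +-cancelʳ-≤ {x} {y} z p = 0≤y-x⇒x≤y (≤-respʳ-≈ (solve 3 (λ x y z → (y :+ z) :- (x :+ z) := y :- x) refl x y z) (x≤y⇒0≤y-x p))

  ≤-average : ∀ (F : A → Carrier) xs X {x} → x ∈ xs → ∑ xs (λ _ → X) ≤ ∑ xs F → X ≤ average (List.map F xs)
  ≤-average F xs X x∈ X≤ rewrite List.length-map F xs = ≤-trans
    (≤-reflexive (trans (sym (*-identityʳ X)) (trans (*-congˡ (sym (fromℕ-inverse (length xs))))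
      (trans (solve 3 (λ x l i → x :* (l :* i) := (l :* x) :* i) refl _ _ _) (*-congʳ (sym (∑-const X xs)))))))
    (*-monoʳ (fromℕ⁻¹-nonneg (length xs)) X≤)
    where instance _ = ∈⇒nonZero x∈

  -- `OPT` is attained by some admissible set, so the bound transfers for either sign of `a`; a
  -- nonpositive `a` occurs for small k.
  *-OPT-≤ : ∀ k (f : Subset n → Carrier) a X → (∀ S → ∣ S ∣ ℕ.≤ k → a * f S ≤ X) → a * OPT k f ≤ X
  *-OPT-≤ {n} k f a X bound = argmax-all id {P = λ v → a * v ≤ X} (bound ⊥ (≡.subst (ℕ._≤ k) (≡.sym (Subset.∣⊥∣≡0 n)) ℕ.z≤n))
    (All.map⁺ (All.tabulate λ {S} S∈ → bound S (proj₂ (∈-filter⁻ (λ S → ∣ S ∣ ℕ.≤? k) {xs = subsets n} S∈))))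

  module _ {η k n} (𝒜 : Algorithm η k n) (f : Subset n → Carrier) where
    open Algorithm 𝒜 using (seeds; nonZero)

    sampleSpace-inhabited : Σ[ ω ∈ Fin seeds × Vec (Fin n) n ] ω ∈ sampleSpace 𝒜
    sampleSpace-inhabited = go seeds {{nonZero}}
      where
      go : ∀ s → .{{NonZero s}} → Σ[ ω ∈ Fin s × Vec (Fin n) n ] ω ∈ List.cartesianProduct (allFin s) (orders n)
      go (suc s) = _ , ∈-cartesianProduct⁺ (∈-allFin zero) (∈-permutations (Vec.allFin n))

    ≤-expectedValue : ∀ X → ∑ (sampleSpace 𝒜) (λ _ → X) ≤ ∑ (sampleSpace 𝒜) (value 𝒜 f) → X ≤ Streaming.expectedValue ℛ 𝒜 f
    ≤-expectedValue X = ≤-average (value 𝒜 f) (sampleSpace 𝒜) X (proj₂ sampleSpace-inhabited)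

  ∑-lookup : ∀ (F : A → Carrier) xs → ∑ (allFin (length xs)) (λ i → F (List.lookup xs i)) ≈ ∑ xs F
  ∑-lookup F xs = trans (sym (∑-map F (List.lookup xs) (allFin (length xs))))
    (reflexive (≡.cong (λ ys → ∑ ys F) (≡.trans (List.map-tabulate id (List.lookup xs)) (List.tabulate-lookup xs))))

-- Choice of parameters, and the two ranges of k.

module Analysis (ℛ : Reals) (c′ : ℕ) (2≤c′ : 2 ℕ.≤ c′) where
  open OrderedField ℛ
  open Sums ℛ
  open UniformArrangement ℛ
  open Averages ℛ
  open Euler ℛ using (e)
  open Streaming ℛ using (MonotoneSubmodular; OPT; Strategy; Algorithm; sampleSpace; value; evaluations; expectedValue; average; run)

  -- The product c c′ is c² - c without natural subtraction. `A′` = 2c⁴ serves twice: as the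
  -- threshold for k it yields μ² ≤ k, and as the constant of the O(1/k) term it covers 2c².
  c μ M G A′ : ℕ
  c = suc c′
  μ = c ℕ.* c′
  M = c ℕ.* c
  G = 2 ℕ.* (c ℕ.* c ℕ.* c)
  A′ = 2 ℕ.* (M ℕ.* M)

  -- Each of at most k G windows stores at most μ items, another μ may be candidates of the open
  -- window, and one slot is left for the arrival.
  η : ℕ → ℕ
  η k = suc (k ℕ.* G ℕ.* μ ℕ.+ μ)

  0<η : ∀ k → 0 ℕ.< η k
  0<η k = ℕ.s≤s ℕ.z≤n

  B′ : ℕ
  B′ = 2 ℕ.* μ ℕ.+ G ℕ.* (1 ℕ.+ G ℕ.* μ) ℕ.* (2 ℕ.* μ)

  ends : ℕ → Bool
  ends i = does (suc i % G ℕ.≟ 0)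

  ends-inner : ∀ g j → suc j ℕ.< G → ends (g ℕ.* G ℕ.+ j) ≡ false
  ends-inner g j j<G = dec-false (suc (g ℕ.* G ℕ.+ j) % G ℕ.≟ 0) λ eq → ℕ.1+n≢0 (≡.trans (≡.sym
    (≡.trans (≡.cong (_% G) (≡.cong suc (ℕ.+-comm (g ℕ.* G) j))) (≡.trans ([m+kn]%n≡m%n (suc j) g G) (m<n⇒m%n≡m j<G)))) eq)

  ends-last : ∀ g → ends (g ℕ.* G ℕ.+ ℕ.pred G) ≡ true
  ends-last g = dec-true (suc (g ℕ.* G ℕ.+ ℕ.pred G) % G ℕ.≟ 0)
    (≡.trans (≡.cong (_% G) (≡.cong suc (ℕ.+-comm (g ℕ.* G) (ℕ.pred G)))) (m*n%n≡0 (suc g) G))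

  cᵣ : Carrier
  cᵣ = fromℕ c

  μ≈ : fromℕ μ ≈ cᵣ * cᵣ - cᵣ
  μ≈ = trans (fromℕ-* c c′) (solve 1 (λ c′ → (𝟙 :+ c′) :* c′ := (𝟙 :+ c′) :* (𝟙 :+ c′) :- (𝟙 :+ c′)) refl (fromℕ c′))

  M≈ : fromℕ M ≈ cᵣ * cᵣ
  M≈ = fromℕ-* c c

  fromℕ-2 : fromℕ 2 ≈ 1# + 1#
  fromℕ-2 = +-congˡ (+-identityʳ 1#)

  G≈ : fromℕ G ≈ (1# + 1#) * (cᵣ * cᵣ * cᵣ)
  G≈ = trans (fromℕ-* 2 (c ℕ.* c ℕ.* c)) (*-cong fromℕ-2 (trans (fromℕ-* (c ℕ.* c) c) (*-congʳ M≈)))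

  1≤cᵣ : 1# ≤ cᵣ
  1≤cᵣ = 1≤fromℕ c

  3≤cᵣ : 1# + (1# + 1#) ≤ cᵣ
  3≤cᵣ = +-monoʳ-≤ 1# (≤-respˡ-≈ fromℕ-2 (fromℕ-mono 2≤c′))

  module Large (k n : ℕ) .{{_ : NonZero k}} (A≤k : A′ ℕ.≤ k) where
    N W : ℕ
    N = k / M
    W = N ℕ.* G

    M≤A : M ℕ.≤ A′
    M≤A = ℕ.≤-trans (ℕ.m≤m*n M M) (ℕ.m≤n*m (M ℕ.* M) 2)

    M≤k : M ℕ.≤ k
    M≤k = ℕ.≤-trans M≤A A≤k

    1≤N : 1 ℕ.≤ N
    1≤N = m≥n⇒m/n>0 M≤k

    NM≤k : N ℕ.* M ℕ.≤ k
    NM≤k = m/n*n≤m k M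

    k≤[1+N]M : k ℕ.≤ suc N ℕ.* M
    k≤[1+N]M = ℕ.≤-trans (ℕ.≤-reflexive (m≡m%n+[m/n]*n k M)) (ℕ.+-monoˡ-≤ (N ℕ.* M) (ℕ.<⇒≤ (m%n<n k M)))

    k≤2NM : k ℕ.≤ 2 ℕ.* (N ℕ.* M)
    k≤2NM = ℕ.≤-trans k≤[1+N]M (ℕ.+-mono-≤ (ℕ.≤-trans (ℕ.≤-reflexive (≡.sym (ℕ.*-identityˡ M))) (ℕ.*-monoˡ-≤ M 1≤N))
      (ℕ.≤-reflexive (≡.sym (ℕ.+-identityʳ (N ℕ.* M)))))

    N≤k : N ℕ.≤ k
    N≤k = ℕ.≤-trans (ℕ.m≤m*n N M) NM≤k

    instance
      N≢0 : NonZero N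
      N≢0 = ℕ.>-nonZero 1≤N

      W≢0 : NonZero W
      W≢0 = ℕ.m*n≢0 N G

    W≤kG : W ℕ.≤ k ℕ.* G
    W≤kG = ℕ.*-monoˡ-≤ G N≤k

    module 𝒢 = Greedy ℛ (η k) k μ ends
    open 𝒢.Strategies (0<η k) using (strategy)

    spent-inner : ∀ g j → suc j ℕ.≤ G → 𝒢.spent (g ℕ.* G ℕ.+ j) ≡ 𝒢.spent (g ℕ.* G)
    spent-inner g zero    _   = ≡.cong 𝒢.spent (ℕ.+-identityʳ (g ℕ.* G))
    spent-inner g (suc j) j<G = ≡.trans (≡.cong 𝒢.spent (ℕ.+-suc (g ℕ.* G) j))
      (≡.trans (≡.cong (λ b → if b then 𝒢.spent (g ℕ.* G ℕ.+ j) ℕ.+ μ else 𝒢.spent (g ℕ.* G ℕ.+ j)) (ends-inner g j j<G))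
               (spent-inner g j (ℕ.<⇒≤ j<G)))

    spent-groups : ∀ g → 𝒢.spent (g ℕ.* G) ≡ g ℕ.* μ
    spent-groups zero    = ≡.refl
    spent-groups (suc g) = ≡.trans (≡.cong (λ i → 𝒢.spent (suc i)) (ℕ.+-comm (ℕ.pred G) (g ℕ.* G)))
      (≡.trans (≡.cong (λ b → if b then s ℕ.+ μ else s) (ends-last g))
      (≡.trans (≡.cong (ℕ._+ μ) (≡.trans (spent-inner g (ℕ.pred G) ℕ.≤-refl) (spent-groups g))) (ℕ.+-comm (g ℕ.* μ) μ)))
      where s = 𝒢.spent (g ℕ.* G ℕ.+ ℕ.pred G)

    μ≤M : μ ℕ.≤ M
    μ≤M = ℕ.*-monoʳ-≤ c (ℕ.n≤1+n c′)

    spent≤k : 𝒢.spent W ℕ.≤ k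
    spent≤k = ℕ.≤-trans (ℕ.≤-reflexive (spent-groups N)) (ℕ.≤-trans (ℕ.*-monoʳ-≤ N μ≤M) NM≤k)

    labels : List (Vec (Fin W) n)
    labels = labelings W n

    start : ∀ {m} → Vec (Subset m) (suc μ)
    start = Vec.replicate (suc μ) ⊥

    strategyFor : Vec (Fin W) n → Strategy (η k) k n 0
    strategyFor s = strategy (schedule s) 0 ⊥ ⊥ (levels start)

    labels-inhabited : NonZero (length labels)
    labels-inhabited = ∈⇒nonZero (∈-labelings n (Fin.fromℕ< (ℕ.>-nonZero⁻¹ W)))

    algorithm : Algorithm (η k) k n
    algorithm = record { seeds = length labels ; nonZero = labels-inhabited ; strategy = λ i → strategyFor (List.lookup labels i) }

    module _ (f : Subset n → Carrier) where
      open 𝒢.Simulation f (0<η k) W (ℕ.s≤s (ℕ.+-monoˡ-≤ μ (ℕ.*-monoˡ-≤ μ W≤kG))) spent≤k using (simulation; simulates-start; budget)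
      open 𝒢.Semantics f using (semantics)

      semanticsFor : Vec (Fin W) n → Vec (Fin n) n → Subset n
      semanticsFor s σ = semantics (schedule s) 0 [] ⊥ (levels start) [] σ

      simulated : ∀ s {σ} → σ ∈ orders n →
        proj₁ (run f (strategyFor s) σ []) ≡ semanticsFor s σ × proj₂ (run f (strategyFor s) σ []) ℕ.≤ budget n W
      simulated s {σ} σ∈ = let S≡ , q≤ = simulation (schedule s) (simulates-start (orders-unique σ∈)) (numCloses-schedule s) in
        S≡ , ≡.subst (λ w → proj₂ (run f (strategyFor s) σ []) ℕ.≤ budget n w) (numCloses-schedule s) q≤

      budget≤ : budget n W ℕ.≤ B′ ℕ.* (n ℕ.+ k ℕ.^ 2)
      budget≤ = ℕ.≤-trans (ℕ.+-monoʳ-≤ (n ℕ.* (2 ℕ.* μ)) closing)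
        (ℕ.≤-trans (ℕ.m≤m+n _ (n ℕ.* rest ℕ.+ k ℕ.^ 2 ℕ.* (2 ℕ.* μ)))
          (ℕ.≤-reflexive (crossTerms n (2 ℕ.* μ) rest (k ℕ.^ 2))))
        where
        rest = G ℕ.* (1 ℕ.+ G ℕ.* μ) ℕ.* (2 ℕ.* μ)
        closing : W ℕ.* ((1 ℕ.+ W ℕ.* μ) ℕ.* (2 ℕ.* μ)) ℕ.≤ k ℕ.^ 2 ℕ.* rest
        closing = ℕ.≤-trans (ℕ.*-mono-≤ W≤kG (ℕ.*-monoˡ-≤ (2 ℕ.* μ) (ℕ.+-mono-≤ (ℕ.>-nonZero⁻¹ k) (ℕ.*-monoˡ-≤ μ W≤kG))))
          (ℕ.≤-reflexive (closingCost k G μ (2 ℕ.* μ)))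

      evaluations≤ : All (λ ω → evaluations algorithm f ω ℕ.≤ B′ ℕ.* (n ℕ.+ k ℕ.^ 2)) (sampleSpace algorithm)
      evaluations≤ = All.tabulate λ {(i , σ)} ω∈ → ℕ.≤-trans
        (proj₂ (simulated (List.lookup labels i) (proj₂ (∈-cartesianProduct⁻ (allFin (length labels)) (orders n) ω∈)))) budget≤

      module _ (f-good : MonotoneSubmodular f) where
        open MonotoneSubmodular f-good
        open Windows ℛ (η k) k μ ends f using (State; stateAt; semantics-schedule)
        open State

        final : Vec (Fin W) n → Vec (Fin n) n → Subset n
        final s σ = Vec.head (solutions (stateAt W (window s σ)))

        κ g q r γ i : Carrier
        κ = fromℕ k ⁻¹
        g = fromℕ G ⁻¹
        q = fromℕ W ⁻¹
        -- Chosen so that k r = μ/G exactly, which places the mean of G trials at level μ; `rate`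
        -- and Bernoulli's inequality show in `r≤` that the true rate is no smaller.
        r = (cᵣ * cᵣ - cᵣ) * g * κ
        γ = fromℕ (2 ℕ.* c) ⁻¹
        i = cᵣ ⁻¹

        ⁻¹≤1 : ∀ m → .{{_ : NonZero m}} → fromℕ m ⁻¹ ≤ 1#
        ⁻¹≤1 m = ≤-respˡ-≈ (*-identityˡ _) (≤-respʳ-≈ (fromℕ-inverse m) (*-monoʳ (fromℕ⁻¹-nonneg m) (1≤fromℕ m)))

        0≤κ = fromℕ⁻¹-nonneg k
        0≤q = fromℕ⁻¹-nonneg W
        kκ≈1 = fromℕ-inverse k

        0≤μᵣ : 0# ≤ cᵣ * cᵣ - cᵣ
        0≤μᵣ = ≤-respʳ-≈ μ≈ (fromℕ-nonneg μ)

        0≤g = fromℕ⁻¹-nonneg G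

        0≤r : 0# ≤ r
        0≤r = *-nonneg (*-nonneg 0≤μᵣ 0≤g) 0≤κ

        NM≈ : fromℕ (N ℕ.* M) ≈ fromℕ N * (cᵣ * cᵣ)
        NM≈ = trans (fromℕ-* N M) (*-congˡ M≈)

        Gg≈1 : (1# + 1#) * (cᵣ * cᵣ * cᵣ) * g ≈ 1#
        Gg≈1 = trans (*-congʳ (sym G≈)) (fromℕ-inverse G)

        Wq≈1 : fromℕ N * ((1# + 1#) * (cᵣ * cᵣ * cᵣ)) * q ≈ 1#
        Wq≈1 = trans (*-congʳ (sym (trans (fromℕ-* N G) (*-congˡ G≈)))) (fromℕ-inverse W)

        NMᵣ≤k : fromℕ N * (cᵣ * cᵣ) ≤ fromℕ k
        NMᵣ≤k = ≤-respˡ-≈ NM≈ (fromℕ-mono NM≤k)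

        k≤2NMᵣ : fromℕ k ≤ (1# + 1#) * (fromℕ N * (cᵣ * cᵣ))
        k≤2NMᵣ = ≤-respʳ-≈ (trans (fromℕ-* 2 (N ℕ.* M)) (*-cong fromℕ-2 NM≈)) (fromℕ-mono k≤2NM)

        open Parameters ℛ

        0≤cᵣ = fromℕ-nonneg c

        rate′ : r ≤ q * (1# - fromℕ k * q)
        rate′ = rate cᵣ (fromℕ k) κ g q (fromℕ N) 0≤cᵣ 1≤cᵣ 0≤κ 0≤g 0≤q kκ≈1 Gg≈1 Wq≈1 NMᵣ≤k k≤2NMᵣ

        kq≤1′ : fromℕ k * q ≤ 1#
        kq≤1′ = kq≤1 cᵣ (fromℕ k) κ g q (fromℕ N) 0≤cᵣ 1≤cᵣ 0≤κ 0≤g 0≤q kκ≈1 Gg≈1 Wq≈1 NMᵣ≤k k≤2NMᵣ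

        r≤q : r ≤ q
        r≤q = ≤-trans rate′ (≤-via (q * (fromℕ k * q)) (*-nonneg 0≤q (*-nonneg (fromℕ-nonneg k) 0≤q))
          (solve 2 (λ q z → q := q :* (𝟙 :- z) :+ q :* z) refl q (fromℕ k * q)))

        kr≤1 : fromℕ k * r ≤ 1#
        kr≤1 = ≤-trans (*-monoˡ (fromℕ-nonneg k) r≤q) kq≤1′

        r≤ : ∀ j → j ℕ.≤ k → r ≤ q * (1# - q) ^ j
        r≤ j j≤k = ≤-trans rate′ (*-monoˡ 0≤q (≤-trans
          (+-monoʳ-≤ 1# (neg-antitone (*-monoʳ 0≤q (fromℕ-mono j≤k)))) (1-nx≤[1-x]^n j 0≤q (⁻¹≤1 W))))

        Gp≈μ : fromℕ G * (fromℕ k * r) ≈ fromℕ μ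
        Gp≈μ = trans (solve 5 (λ G k m g κ → G :* (k :* (m :* g :* κ)) := (G :* g) :* (k :* κ) :* m) refl _ _ _ _ _)
          (trans (*-cong (trans (*-cong (fromℕ-inverse G) kκ≈1) (*-identityˡ 1#)) (sym μ≈)) (*-identityˡ _))

        γ-inverse : γ * ((1# + 1#) * cᵣ) ≈ 1#
        γ-inverse = trans (*-congˡ (sym (trans (fromℕ-* 2 c) (*-congʳ fromℕ-2)))) (trans (*-comm _ _) (fromℕ-inverse (2 ℕ.* c)))

        μ²≤k : fromℕ μ * fromℕ μ ≤ fromℕ k
        μ²≤k = ≤-respˡ-≈ (fromℕ-* μ μ) (fromℕ-mono (ℕ.≤-trans (ℕ.*-mono-≤ μ≤M μ≤M) (ℕ.≤-trans (ℕ.m≤n*m (M ℕ.* M) 2) A≤k)))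

        ρ ρ′ : Carrier
        ρ = 1# - (fromℕ μ - cᵣ) * κ + fromℕ μ * fromℕ μ * (κ * κ)
        ρ′ = 1# - ((cᵣ * cᵣ - cᵣ) - cᵣ) * κ + (cᵣ * cᵣ - cᵣ) * (cᵣ * cᵣ - cᵣ) * (κ * κ)

        ρ≈ρ′ : ρ ≈ ρ′
        ρ≈ρ′ = +-cong (+-congˡ (-‿cong (*-congʳ (+-congʳ μ≈)))) (*-congʳ (*-cong μ≈ μ≈))

        0≤ρ : 0# ≤ ρ
        0≤ρ = ≤-respʳ-≈ (sym ρ≈ρ′) (0≤contraction cᵣ κ i k N 3≤cᵣ 0≤κ (fromℕ⁻¹-nonneg c) (fromℕ-inverse c) kκ≈1 NMᵣ≤k
          (≤-respʳ-≈ (trans (fromℕ-* (suc N) M) (*-congˡ M≈)) (fromℕ-mono k≤[1+N]M)) (≤-respˡ-≈ M≈ (fromℕ-mono M≤k))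
          (≤-respˡ-≈ (*-cong μ≈ μ≈) μ²≤k))

        ρ^N≤ : ρ ^ N ≤ e ⁻¹ + ((1# + 1#) * i + (1# + 1#) * (cᵣ * cᵣ * κ))
        ρ^N≤ = ≤-respˡ-≈ (Exponential.^-cong ℛ N (sym ρ≈ρ′))
          (contraction cᵣ κ i k N 3≤cᵣ 0≤κ (fromℕ⁻¹-nonneg c) (fromℕ-inverse c) kκ≈1 NMᵣ≤k
          (≤-respʳ-≈ (trans (fromℕ-* (suc N) M) (*-congˡ M≈)) (fromℕ-mono k≤[1+N]M)) (≤-respˡ-≈ M≈ (fromℕ-mono M≤k))
          (≤-respˡ-≈ (*-cong μ≈ μ≈) μ²≤k))

        module _ (O : Subset n) (∣O∣≤k : ∣ O ∣ ℕ.≤ k) where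
          X : Carrier
          X = f O * (1# - ρ ^ N)

          -- Only the labels are random here. Labels belong to positions, so O enters through the
          -- list J of its positions in σ.
          order-bound : ∀ σ → σ ∈ orders n → ∑ labels (λ _ → X) ≤ ∑ labels (λ s → f (final s σ))
          order-bound σ σ∈ = +-cancelʳ-≤ (∑ labels (λ s → f O - f (final s σ))) (≤-trans
            (+-monoʳ-≤ _ total-loss)
            (≤-reflexive (trans (sym (∑-+ _ _ labels)) (trans (∑-cong labels (λ s →
                solve 3 (λ o p x → o :* (𝟙 :- p) :+ o :* p := x :+ (o :- x)) refl (f O) (ρ ^ N) (f (final s σ))))
              (∑-+ _ _ labels)))))
            where
            pos : Fin n → Fin n
            pos x = proj₁ (position σ (orders-complete σ∈ x))
            lookup-pos : ∀ x → lookup σ (pos x) ≡ x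
            lookup-pos x = proj₂ (position σ (orders-complete σ∈ x))
            J : List (Fin n)
            J = List.map pos (elements O)
            J! : Unique J
            J! = Unique.map⁺ (λ {x} {y} eq → ≡.trans (≡.sym (lookup-pos x)) (≡.trans (≡.cong (lookup σ) eq) (lookup-pos y))) (elements-unique O)
            ∣J∣≤k : length J ℕ.≤ k
            ∣J∣≤k = ℕ.≤-trans (ℕ.≤-reflexive (≡.trans (List.length-map pos (elements O)) (Vec.length-toList (select O (Vec.allFin n))))) ∣O∣≤k
            O⊆J : O ⊆ setOf (List.map (lookup σ) J)
            O⊆J {x} x∈ = ∈-setOf⁺ (≡.subst (_∈ List.map (lookup σ) J) (lookup-pos x) (∈-map⁺ (lookup σ) (∈-map⁺ pos (∈-elements O x∈))))
            open Progress ℛ (η k) k μ ends f f-good σ W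
            open Groups O J J! ∣J∣≤k O⊆J q r (fromℕ-inverse W) 0≤q (⁻¹≤1 W) 0≤r (r≤ (length J) ∣J∣≤k) kr≤1
              (ℕ.pred G) N ≡.refl ends-inner ends-last cᵣ κ γ 0≤cᵣ 0≤κ (⁻¹≤1 k) (fromℕ⁻¹-nonneg (2 ℕ.* c)) γ-inverse kκ≈1 μ≈ Gp≈μ
              using (groups)
            head≡ : ∀ (os : Vec (Subset n) (suc μ)) → Vec.head os ≡ lookup os zero
            head≡ (o ∷ os) = ≡.refl
            total-loss : ∑ labels (λ s → f O - f (final s σ)) ≤ ∑ labels (λ _ → f O * ρ ^ N)
            total-loss = ≤-trans (≤-reflexive (∑-cong labels (λ s → +-congˡ (-‿cong (reflexive
                (≡.cong f (head≡ (solutions (stateAt W (window s σ))))))))))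
              (≤-trans (groups 0≤ρ N ℕ.≤-refl zero)
                (≤-reflexive (trans (*-assoc _ _ _) (sym (∑-const (f O * ρ ^ N) labels)))))

          -- For each seed the sum over all orders may be taken along `arrange s σ` instead of σ. On
          -- the arranged stream the run ends in `final s σ`, where `order-bound` applies.
          expected-bound : X ≤ expectedValue algorithm f
          expected-bound = ≤-expectedValue algorithm f X (≤-trans (≤-reflexive
              (trans (rearrange (λ _ _ → X)) (∑-swap (λ _ _ → X) labels (orders n))))
            (≤-trans (∑-mono∈ (orders n) order-bound) (≤-trans (≤-reflexive
              (trans (∑-swap (λ σ s → f (final s σ)) (orders n) labels)
                (∑-cong labels (λ s → trans
                  (∑-cong (orders n) (λ σ → reflexive (≡.cong f (≡.sym (semantics-schedule s σ)))))
                  (arrange-uniform s (Vec.allFin n) (λ σ → f (semanticsFor s σ)))))))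
            (≤-trans (∑-mono labels (λ s → ∑-mono∈ (orders n) (λ σ σ∈ →
                ≤-reflexive (reflexive (≡.cong f (≡.sym (proj₁ (simulated s σ∈))))))))
              (≤-reflexive (sym (rearrange (λ s σ → f (proj₁ (run f (strategyFor s) σ []))))))))))
            where
            rearrange : ∀ (F : Vec (Fin W) n → Vec (Fin n) n → Carrier) →
              ∑ (sampleSpace algorithm) (λ (a , σ) → F (List.lookup labels a) σ) ≈ ∑ labels (λ s → ∑ (orders n) (F s))
            rearrange F = trans (∑-cartesianProduct (λ (a , σ) → F (List.lookup labels a) σ) (allFin (length labels)) (orders n))
              (∑-lookup (λ s → ∑ (orders n) (F s)) labels)

  module Small (k n : ℕ) where
    trivial : Algorithm (η k) k n
    trivial = record { seeds = 1 ; strategy = λ _ → Greedy.Strategies.dump ℛ (η k) k μ ends (0<η k) }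

    evaluations≡0 : ∀ (f : Subset n → Carrier) ω → evaluations trivial f ω ≡ 0
    evaluations≡0 f (_ , σ) = go σ []
      where
      go : ∀ {t m} (xs : Vec (Fin n) t) (b : Vec (Fin n) m) → proj₂ (run f (Greedy.Strategies.dump ℛ (η k) k μ ends (0<η k)) xs b) ≡ 0
      go []       b = ≡.refl
      go (x ∷ xs) b = go xs _

    expected-nonneg : ∀ {f : Subset n → Carrier} → MonotoneSubmodular f → 0# ≤ expectedValue trivial f
    expected-nonneg {f} f-good = ≤-expectedValue trivial f 0# (∑-mono (sampleSpace trivial) (λ ω →
      ≤-trans nonneg (monotone (Subset.⊆-min _))))
      where open MonotoneSubmodular f-good

  amortized : ∀ q n k → .{{_ : NonZero n}} → q ℕ.≤ B′ ℕ.* (n ℕ.+ k ℕ.^ 2) →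
    fromℕ q * fromℕ n ⁻¹ ≤ fromℕ B′ * (1# + fromℕ (k ℕ.^ 2) * fromℕ n ⁻¹)
  amortized q n k q≤ = ≤-trans (*-monoʳ (fromℕ⁻¹-nonneg n) (fromℕ-mono q≤)) (≤-reflexive
    (trans (*-congʳ (trans (fromℕ-* B′ (n ℕ.+ k ℕ.^ 2)) (*-congˡ (fromℕ-+ n (k ℕ.^ 2)))))
      (trans (solve 4 (λ b n k i → b :* (n :+ k) :* i := b :* (n :* i :+ k :* i)) refl _ _ _ _)
        (*-congˡ (+-congʳ (fromℕ-inverse n))))))

  -- The buffer is in fact polynomial in c, at most 4 c⁵ k; the estimate c ≤ 2^c brings this into
  -- the required exponential form.
  η≤ : ∀ k → .{{_ : NonZero k}} → η k ℕ.≤ 4 ℕ.* 2 ℕ.^ (c ℕ.* 5) ℕ.* k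
  η≤ k = begin
    1 ℕ.+ (k ℕ.* G ℕ.* μ ℕ.+ μ)
      ≤⟨ ℕ.+-mono-≤ 1≤k (ℕ.+-mono-≤ (ℕ.≤-refl {k ℕ.* G ℕ.* μ}) (ℕ.m≤n*m μ k)) ⟩
    k ℕ.+ (k ℕ.* G ℕ.* μ ℕ.+ k ℕ.* μ)
      ≤⟨ ℕ.+-mono-≤ (ℕ.m≤m*n k (c ℕ.^ 5) {{ℕ.m^n≢0 c 5}})
           (ℕ.+-mono-≤ (ℕ.*-monoʳ-≤ (k ℕ.* G) μ≤) (ℕ.*-monoʳ-≤ k (ℕ.≤-trans μ≤ (ℕ.m≤m*n (c ℕ.* c) (c ℕ.^ 3) {{ℕ.m^n≢0 c 3}})))) ⟩
    k ℕ.* c ℕ.^ 5 ℕ.+ (k ℕ.* G ℕ.* (c ℕ.* c) ℕ.+ k ℕ.* (c ℕ.* c ℕ.* c ℕ.^ 3))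
      ≡⟨ memory k c ⟩
    4 ℕ.* c ℕ.^ 5 ℕ.* k
      ≤⟨ ℕ.*-monoˡ-≤ k (ℕ.*-monoʳ-≤ 4 (ℕ.≤-trans (ℕ.^-monoˡ-≤ 5 (ℕ.<⇒≤ (n<2^n c))) (ℕ.≤-reflexive (ℕ.^-*-assoc 2 c 5)))) ⟩
    4 ℕ.* 2 ℕ.^ (c ℕ.* 5) ℕ.* k ∎
    where
    open ℕ.≤-Reasoning
    1≤k : 1 ℕ.≤ k
    1≤k = ℕ.>-nonZero⁻¹ k
    μ≤ : μ ℕ.≤ c ℕ.* c
    μ≤ = ℕ.*-monoʳ-≤ c (ℕ.n≤1+n c′)

  A≥2M : (1# + 1#) * (cᵣ * cᵣ) ≤ fromℕ A′
  A≥2M = ≤-respˡ-≈ (trans (fromℕ-* 2 M) (*-cong fromℕ-2 M≈)) (fromℕ-mono (ℕ.*-monoʳ-≤ 2 (ℕ.m≤m*n M M)))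

  module Guarantee (ε : Carrier) (0≤ε : 0# ≤ ε) (2/c≤ε : (1# + 1#) * cᵣ ⁻¹ ≤ ε) where
    -- For k below `A′` the term A′/k exceeds 1, so the claimed factor is nonpositive and the empty
    -- output meets it. The query bound holds for every outcome, not only on average.
    guarantee : ∀ k n → .{{_ : NonZero k}} → .{{_ : NonZero n}} → Σ[ 𝒜 ∈ Algorithm (η k) k n ]
      ∀ (f : Subset n → Carrier) → MonotoneSubmodular f →
        (1# - e ⁻¹ - ε - fromℕ A′ * fromℕ k ⁻¹) * OPT k f ≤ expectedValue 𝒜 f ×
        All (λ ω → fromℕ (evaluations 𝒜 f ω) * fromℕ n ⁻¹ ≤ fromℕ B′ * (1# + fromℕ (k ℕ.^ 2) * fromℕ n ⁻¹)) (sampleSpace 𝒜)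
    guarantee k n with A′ ℕ.≤? k
    ... | yes A≤k = L.algorithm , λ f f-good →
      *-OPT-≤ k f _ _ (λ O ∣O∣≤k → ≤-trans (value-bound f f-good O) (L.expected-bound f f-good O ∣O∣≤k)) ,
      All.map (λ {ω} → amortized (evaluations L.algorithm f ω) n k) (L.evaluations≤ f)
      where
      module L = Large k n A≤k
      value-bound : ∀ f (f-good : MonotoneSubmodular f) O →
        (1# - e ⁻¹ - ε - fromℕ A′ * fromℕ k ⁻¹) * f O ≤ f O * (1# - L.ρ f f-good ^ L.N)
      value-bound f f-good O = ≤-respˡ-≈ (*-comm _ _) (*-monoˡ (≤-trans nonneg (monotone (Subset.⊆-min O)))
        (≤-via ((e ⁻¹ + ((1# + 1#) * cᵣ ⁻¹ + (1# + 1#) * (cᵣ * cᵣ * κ)) - L.ρ f f-good ^ L.N)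
                + (ε - (1# + 1#) * cᵣ ⁻¹) + (fromℕ A′ - (1# + 1#) * (cᵣ * cᵣ)) * κ)
          (+-nonneg (+-nonneg (x≤y⇒0≤y-x (L.ρ^N≤ f f-good)) (x≤y⇒0≤y-x 2/c≤ε))
            (*-nonneg (x≤y⇒0≤y-x A≥2M) (fromℕ⁻¹-nonneg k)))
          (solve 7 (λ p e ε a κ i m →
            𝟙 :- p := (𝟙 :- e :- ε :- a :* κ) :+ ((e :+ (𝟚 :* i :+ 𝟚 :* (m :* κ)) :- p) :+ (ε :- 𝟚 :* i) :+ (a :- 𝟚 :* m) :* κ))
            refl (L.ρ f f-good ^ L.N) (e ⁻¹) ε (fromℕ A′) κ (cᵣ ⁻¹) (cᵣ * cᵣ))))
        where
        open MonotoneSubmodular f-good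
        κ = fromℕ k ⁻¹
    ... | no A≰k = S.trivial , λ f f-good →
      *-OPT-≤ k f _ _ (λ O _ → ≤-trans (≤-via ((- (1# - e ⁻¹ - ε - fromℕ A′ * fromℕ k ⁻¹)) * f O)
          (*-nonneg nonpositive (≤-trans (MonotoneSubmodular.nonneg f-good) (MonotoneSubmodular.monotone f-good (Subset.⊆-min O))))
          (solve 2 (λ a x → con (ℤ.+ 0) := a :* x :+ (:- a) :* x) refl _ _)) (S.expected-nonneg f-good)) ,
      All.tabulate λ {ω} _ → amortized (evaluations S.trivial f ω) n k (≡.subst (ℕ._≤ _) (≡.sym (S.evaluations≡0 f ω)) ℕ.z≤n)
      where
      module S = Small k n
      nonpositive : 0# ≤ - (1# - e ⁻¹ - ε - fromℕ A′ * fromℕ k ⁻¹)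
      nonpositive = ≤-by (e ⁻¹ + ε + (fromℕ A′ - fromℕ k) * fromℕ k ⁻¹) (fromℕ k * fromℕ k ⁻¹ - 1#)
        (+-nonneg (+-nonneg (⁻¹-nonneg (≤-trans 0≤1 1≤e) (1≤⇒≉0 1≤e)) 0≤ε)
          (*-nonneg (x≤y⇒0≤y-x (fromℕ-mono (ℕ.<⇒≤ (ℕ.≰⇒> A≰k)))) (fromℕ⁻¹-nonneg k)))
        (trans (+-congʳ (fromℕ-inverse k)) (-‿inverseʳ 1#))
        (solve 5 (λ e ε a k i → :- (𝟙 :- e :- ε :- a :* i) := con (ℤ.+ 0) :+ (e :+ ε :+ (a :- k) :* i) :+ (k :* i :- 𝟙)) refl
          (e ⁻¹) ε (fromℕ A′) (fromℕ k) (fromℕ k ⁻¹))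
        where open Exponential ℛ using (1≤e)

-- Choice of c from ε.

module Ceiling (ℛ : Reals) where
  open OrderedField ℛ

  ceiling : ∀ x → 0# ≤ x → Σ[ m ∈ ℕ ] (x ≤ fromℕ m × fromℕ m ≤ x + 1#)
  ceiling x 0≤x = let n , x≤n = archimedean x in go n x≤n
    where
    go : ∀ n → x ≤ fromℕ n → Σ[ m ∈ ℕ ] (x ≤ fromℕ m × fromℕ m ≤ x + 1#)
    go zero    x≤0 = 0 , x≤0 , +-nonneg 0≤x 0≤1
    go (suc n) x≤n with x ≤? fromℕ n
    ... | yes x≤n′ = go n x≤n′
    ... | no x≰n   = suc n , x≤n , ≤-respˡ-≈ (+-comm _ _) (+-mono
      ([ id , (λ x≤n → contradiction x≤n x≰n) ]′ (total (fromℕ n) x)) ≤-refl)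

theorem2 : (ℛ : Reals) → let open Streaming ℛ in
    Σ[ a ∈ ℕ ] Σ[ c ∈ ℕ ] Σ[ d ∈ ℕ ]
    ∀ (ε : Carrier) → 0# < ε → ε < 1# →
    Σ[ η ∈ (ℕ → ℕ) ]
    (Σ[ E ∈ ℕ ] fromℕ E ≤ fromℕ c * (ε ⁻¹) ^ d ×
    (∀ k → .{{NonZero k}} → η k ℕ.≤ a ℕ.* 2 ℕ.^ E ℕ.* k)) ×
    (Σ[ A ∈ ℕ ] Σ[ B ∈ ℕ ]
    ∀ k n → .{{NonZero k}} → .{{NonZero n}} →
    Σ[ 𝒜 ∈ Algorithm (η k) k n ]
    ∀ (f : Subset n → Carrier) → MonotoneSubmodular f →
    (1# - e ⁻¹ - ε - fromℕ A * fromℕ k ⁻¹) * OPT k f ≤ expectedValue 𝒜 f ×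
    All (λ ω → fromℕ (evaluations 𝒜 f ω) * fromℕ n ⁻¹
    ≤ fromℕ B * (1# + fromℕ (k ℕ.^ 2) * fromℕ n ⁻¹))
    (sampleSpace 𝒜))
-- With u the rounded-up 1/ε, c = 2u + 1 satisfies 2/c ≤ ε and c ≥ 3. The buffer has exponent E =
-- 5c, and u ≤ 1/ε + 1 together with 1 ≤ 1/ε gives 5 (2u + 1) ≤ 5 (2/ε + 3) ≤ 25/ε, whence 25 and
-- degree 1. The 4 comes from `η≤`.
theorem2 ℛ = 4 , 25 , 1 , λ ε (0≤ε , 0≉ε) (ε≤1 , ε≉1) →
  let open Choice ε 0≤ε (λ ε≈0 → 0≉ε (sym ε≈0)) ε≤1
      module An = Analysis ℛ (2 ℕ.* u) 2≤c′ in
  An.η , (suc (2 ℕ.* u) ℕ.* 5 , exponent , An.η≤) , An.A′ , An.B′ , An.Guarantee.guarantee ε 0≤ε 2/c≤ε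
  where
  open OrderedField ℛ
  open Ceiling ℛ
  module Choice (ε : Carrier) (0≤ε : 0# ≤ ε) (ε≉0 : ¬ ε ≈ 0#) (ε≤1 : ε ≤ 1#) where
    y : Carrier
    y = ε ⁻¹
    0≤y : 0# ≤ y
    0≤y = ⁻¹-nonneg 0≤ε ε≉0
    εy≈1 : ε * y ≈ 1#
    εy≈1 = ⁻¹-inverseʳ ε≉0
    1≤y : 1# ≤ y
    1≤y = ≤-respˡ-≈ εy≈1 (≤-respʳ-≈ (*-identityˡ y) (*-monoʳ 0≤y ε≤1))
    u : ℕ
    u = proj₁ (ceiling y 0≤y)
    y≤u : y ≤ fromℕ u
    y≤u = proj₁ (proj₂ (ceiling y 0≤y))
    u≤y+1 : fromℕ u ≤ y + 1#
    u≤y+1 = proj₂ (proj₂ (ceiling y 0≤y))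
    1≤u : ∀ v → y ≤ fromℕ v → 1 ℕ.≤ v
    1≤u zero    y≤0 = contradiction (antisym (≤-trans 1≤y y≤0) 0≤1) (λ 1≈0 → 0#≉1# (sym 1≈0))
    1≤u (suc v) _   = ℕ.s≤s ℕ.z≤n
    2≤c′ : 2 ℕ.≤ 2 ℕ.* u
    2≤c′ = ℕ.*-monoʳ-≤ 2 (1≤u u y≤u)
    two : fromℕ 2 ≈ 1# + 1#
    two = +-congˡ (+-identityʳ 1#)
    cᵣ : Carrier
    cᵣ = fromℕ (suc (2 ℕ.* u))
    cᵣ≈ : cᵣ ≈ 1# + (1# + 1#) * fromℕ u
    cᵣ≈ = +-congˡ (trans (fromℕ-* 2 u) (*-congʳ two))
    2/c≤ε : (1# + 1#) * cᵣ ⁻¹ ≤ ε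
    2/c≤ε = *-cancel-≤ (fromℕ-nonneg (suc (2 ℕ.* u))) (1≤⇒≉0 (1≤fromℕ (suc (2 ℕ.* u))))
      (≤-by (ε + (1# + 1#) * (ε * (fromℕ u - y)))
            ((1# + 1#) * ((ε * y - 1#) - (cᵣ * cᵣ ⁻¹ - 1#)) + ε * (cᵣ - (1# + (1# + 1#) * fromℕ u)))
        (+-nonneg 0≤ε (*-nonneg (+-nonneg 0≤1 0≤1) (*-nonneg 0≤ε (x≤y⇒0≤y-x y≤u))))
        (trans (+-cong (*-congˡ (+-cong (vanishes εy≈1) (-‿cong (vanishes (fromℕ-inverse (suc (2 ℕ.* u))))))) (*-congˡ (vanishes cᵣ≈)))
          (solve 1 (λ ε → let z = con (ℤ.+ 0) in 𝟚 :* (z :- z) :+ ε :* z := z) refl ε))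
        (solve 5 (λ ε y m c i → c :* ε := c :* (𝟚 :* i) :+ (ε :+ 𝟚 :* (ε :* (m :- y)))
           :+ (𝟚 :* ((ε :* y :- 𝟙) :- (c :* i :- 𝟙)) :+ ε :* (c :- (𝟙 :+ 𝟚 :* m))))
          refl ε y (fromℕ u) cᵣ (cᵣ ⁻¹)))
      where
      vanishes : ∀ {a b} → a ≈ b → a - b ≈ 0#
      vanishes {a} {b} a≈b = trans (+-congʳ a≈b) (-‿inverseʳ b)
    exponent : fromℕ (suc (2 ℕ.* u) ℕ.* 5) ≤ fromℕ 25 * y ^ 1
    exponent = ≤-respˡ-≈ (sym (trans (fromℕ-* (suc (2 ℕ.* u)) 5) (*-congʳ cᵣ≈)))
      (≤-respʳ-≈ (*-cong (sym (fromℕ-* 5 5)) (sym (*-identityʳ y)))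
      (≤-via (fromℕ 5 * ((1# + 1#) * (y + 1# - fromℕ u) + (1# + (1# + 1#)) * (y - 1#)))
        (*-nonneg (fromℕ-nonneg 5) (+-nonneg (*-nonneg (+-nonneg 0≤1 0≤1) (x≤y⇒0≤y-x u≤y+1))
          (*-nonneg (+-nonneg 0≤1 (+-nonneg 0≤1 0≤1)) (x≤y⇒0≤y-x 1≤y))))
        (trans (*-congʳ (*-congˡ five))
          (solve 3 (λ s y m → s :* con (ℤ.+ 5) :* y := (𝟙 :+ 𝟚 :* m) :* s :+ s :* (𝟚 :* (y :+ 𝟙 :- m) :+ (𝟙 :+ 𝟚) :* (y :- 𝟙))) refl (fromℕ 5) y (fromℕ u)))))
      where
      five : fromℕ 5 ≈ fromℤ (ℤ.+ 5)
      five = solve 0 (𝟙 :+ (𝟙 :+ (𝟙 :+ (𝟙 :+ (𝟙 :+ con (ℤ.+ 0))))) := con (ℤ.+ 5)) refl
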